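{- Let $G$ be a $6$-regular graph on $n$ vertices. Then $G$ has a path partition with at most $\frac{n}{7}$ components; that is, $\pi_p(G)\le \frac{n}{7}$.
   Context: All graphs are finite, simple and undirected. A path partition of a graph $G=(V,E)$ is a set of vertex-disjoint paths of $G$ (a single vertex is allowed as a path) whose vertex sets together cover $V$; its members are called components. $\pi_p(G)$ denotes the minimum number of components of a path partition of $G$. -}

module Defs where

open import Level using (0ℓ)
open import Data.Empty using (⊥-elim)
open import Data.Nat using (ℕ; suc; _≤_; z≤n; s≤s)
open import Data.Nat.Properties using (≤-trans; ≤-reflexive; +-mono-≤)
open import Data.Fin using (Fin; zero; suc; _≟_)
import Data.Fin.Properties as Fin
open import Data.List using (List; []; _∷_; [_]; length; lookup; filter; map; concat; allFin; cartesianProductWith)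
open import Data.List.Properties using (length-++)
open import Data.List.Extrema.Nat using (argmin; argmin-all; f[argmin]≤f[xs])
open import Data.List.Membership.Propositional using (_∈_)
open import Data.List.Membership.Propositional.Properties
  using (∈-allFin; ∈-lookup; ∈-map⁺; ∈-filter⁺; ∈-cartesianProductWith⁺)
open import Data.List.Membership.DecPropositional using (_∈?_)
open import Data.List.Relation.Binary.Disjoint.Propositional using (Disjoint)
open import Data.List.Relation.Binary.Disjoint.DecPropositional using (disjoint?)
open import Data.List.Relation.Unary.All as All using (All; []; _∷_)
open import Data.List.Relation.Unary.All.Properties as All using (all-filter)
open import Data.List.Relation.Unary.AllPairs as AllPairs using (AllPairs; []; _∷_)
import Data.List.Relation.Unary.AllPairs.Properties as AllPairs
open import Data.List.Relation.Unary.Any as Any using (Any; here; there)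
import Data.List.Relation.Unary.Any.Properties as Any
open import Data.List.Relation.Unary.Linked as Linked using (Linked; [-]; linked?)
open import Data.List.Relation.Unary.Unique.Propositional using (Unique)
open import Data.List.Relation.Unary.Unique.Propositional.Properties
  using (allFin⁺; concat⁺)
open import Data.List.Relation.Unary.Unique.DecPropositional using (unique?)
open import Data.Product using (_×_; _,_; proj₁; ∃-syntax)
open import Relation.Binary using (Rel; Symmetric; Irreflexive; Decidable)
open import Relation.Binary.PropositionalEquality using (_≡_; _≢_; refl; sym; cong)
open import Relation.Nullary using (Dec; yes; no)
open import Relation.Nullary.Decidable using (map′; _×-dec_)

-- Decidability of adjacency is what makes the graph a finite object
-- constructively (degrees and π_p are then natural numbers).
record Graph (n : ℕ) : Set₁ where
  field
    Adj    : Rel (Fin n) 0ℓ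
    adj?   : Decidable Adj
    symm   : Symmetric Adj
    irrefl : Irreflexive _≡_ Adj

  degree : Fin n → ℕ
  degree v = length (filter (adj? v) (allFin n))

open Graph public

Regular : ∀ {n} → ℕ → Graph n → Set
Regular {n} d G = (v : Fin n) → degree G v ≡ d

-- A path is given by one of its vertex sequences; [ v ] is a path.
record IsPath {n} (G : Graph n) (p : List (Fin n)) : Set where
  constructor mkIsPath
  field
    nonempty : p ≢ []
    distinct : Unique p
    linked   : Linked (Adj G) p

-- Since paths are nonempty, disjointness forces the members of the list to be
-- different, so its length is the number of components.
record IsPathPartition {n} (G : Graph n) (ps : List (List (Fin n))) : Set where
  constructor mkIsPathPartition
  field
    paths    : All (IsPath G) ps
    disjoint : AllPairs Disjoint ps
    covers   : (v : Fin n) → Any (v ∈_) ps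

nonempty? : ∀ {n} (p : List (Fin n)) → Dec (p ≢ [])
nonempty? []      = no λ ne → ne refl
nonempty? (_ ∷ _) = yes λ ()

isPath? : ∀ {n} (G : Graph n) (p : List (Fin n)) → Dec (IsPath G p)
isPath? G p =
  map′ (λ (a , b , c) → mkIsPath a b c)
       (λ (mkIsPath a b c) → a , b , c)
       (nonempty? p ×-dec unique? _≟_ p ×-dec linked? (adj? G) p)

isPathPartition? : ∀ {n} (G : Graph n) (ps : List (List (Fin n))) →
                   Dec (IsPathPartition G ps)
isPathPartition? G ps =
  map′ (λ (a , b , c) → mkIsPathPartition a b c)
       (λ (mkIsPathPartition a b c) → a , b , c)
       (All.all? (isPath? G) ps
         ×-dec AllPairs.allPairs? (disjoint? _≟_) ps
         ×-dec Fin.all? (λ v → Any.any? (_∈?_ _≟_ v) ps))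

-- All lists of length at most m with entries in xs.
listsUpTo : ∀ {A : Set} → ℕ → List A → List (List A)
listsUpTo 0       xs = [ [] ]
listsUpTo (suc m) xs = [] ∷ cartesianProductWith _∷_ xs (listsUpTo m xs)

∈-listsUpTo : ∀ {A : Set} {m} {xs ys : List A} →
              length ys ≤ m → All (_∈ xs) ys → ys ∈ listsUpTo m xs
∈-listsUpTo {m = 0}     z≤n       []         = here refl
∈-listsUpTo {m = suc m} z≤n       []         = here refl
∈-listsUpTo {m = suc m} (s≤s len) (y∈ ∷ ys∈) =
  there (∈-cartesianProductWith⁺ _∷_ y∈ (∈-listsUpTo len ys∈))

candidates : ∀ n → List (List (List (Fin n)))
candidates n = listsUpTo n (listsUpTo n (allFin n))

lookup-injective : ∀ {A : Set} {xs : List A} → Unique xs →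
                   ∀ i j → lookup xs i ≡ lookup xs j → i ≡ j
lookup-injective (_  ∷ _) zero    zero    _  = refl
lookup-injective (x∉ ∷ _) zero    (suc j) eq = ⊥-elim (All.lookup x∉ (∈-lookup j) eq)
lookup-injective (x∉ ∷ _) (suc i) zero    eq = ⊥-elim (All.lookup x∉ (∈-lookup i) (sym eq))
lookup-injective (_  ∷ u) (suc i) (suc j) eq = cong suc (lookup-injective u i j eq)

unique-length : ∀ {n} {xs : List (Fin n)} → Unique xs → length xs ≤ n
unique-length u = Fin.injective⇒≤ (λ {i j} → lookup-injective u i j)

length≤length-concat : ∀ {A : Set} {xss : List (List A)} →
                       All (_≢ []) xss → length xss ≤ length (concat xss)
length≤length-concat [] = z≤n
length≤length-concat {xss = [] ∷ _} (ne ∷ _) = ⊥-elim (ne refl)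
length≤length-concat {xss = (x ∷ xs) ∷ xss} (_ ∷ nes) =
  ≤-trans (+-mono-≤ (s≤s (z≤n {length xs})) (length≤length-concat nes))
          (≤-reflexive (sym (length-++ (x ∷ xs))))

partition∈candidates : ∀ {n} {G : Graph n} {ps} →
                       IsPathPartition G ps → ps ∈ candidates n
partition∈candidates {n} {G} {ps} (mkIsPathPartition paths disjoint _) =
  ∈-listsUpTo
    (≤-trans (length≤length-concat (All.map IsPath.nonempty paths))
             (unique-length (concat⁺ (All.map IsPath.distinct paths) disjoint)))
    (All.map (λ p → ∈-listsUpTo (unique-length (IsPath.distinct p))
                                (All.universal ∈-allFin _))
             paths)

singletons : ∀ n → List (List (Fin n))
singletons n = map [_] (allFin n)

singletons-isPathPartition : ∀ {n} (G : Graph n) → IsPathPartition G (singletons n)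
singletons-isPathPartition {n} G = mkIsPathPartition
  (All.map⁺ (All.universal (λ v → mkIsPath (λ ()) ([] ∷ []) [-]) (allFin n)))
  (AllPairs.map⁺ (AllPairs.map (λ { x≢y (here refl , here eq) → x≢y eq }) (allFin⁺ n)))
  (λ v → Any.map⁺ (Any.map here (∈-allFin v)))

minimumPathPartition : ∀ {n} (G : Graph n) →
  ∃[ ps ] IsPathPartition G ps × (∀ qs → IsPathPartition G qs → length ps ≤ length qs)
minimumPathPartition {n} G =
  argmin length (singletons n) valid ,
  argmin-all length (singletons-isPathPartition G)
    (all-filter (isPathPartition? G) (candidates n)) ,
  λ qs part → All.lookup (f[argmin]≤f[xs] (singletons n) valid)
    (∈-filter⁺ (isPathPartition? G) (partition∈candidates part) part)
  where
  valid : List (List (List (Fin n)))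
  valid = filter (isPathPartition? G) (candidates n)

πₚ : ∀ {n} → Graph n → ℕ
πₚ G = length (proj₁ (minimumPathPartition G))

-- Among the path partitions with the fewest components take one with the fewest
-- singletons, then with the most cyclic components (those whose ends are
-- adjacent), then with the largest sum of min(H v, 2), where H v is the number of
-- ends that see v by an edge off the path.  Alternating exchanges show that it has
-- no singleton.
--
-- The bound n ≥ 7 · #components is then a discharging argument.  Ends see inner
-- vertices of non-cyclic components only, and ask them for charge.  Two
-- consecutive vertices of a path are hardly ever both hit by ends, since cutting
-- the edge between them would save a component, so only a path on which heavily
-- hit vertices alternate with other ones is in danger of paying too much.  There,
-- cutting next to a hit vertex makes its neighbour y an end in place of one that
-- hits it.  By the choice of the partition, y then sees, apart from vertices that
-- were hit twice before, at most as many vertices as the old end had neighbours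
-- with at most two hits.  Both kinds of vertices have charge to spare for y.  What
-- remains is an inequality along each path that depends on the types of
-- consecutive vertices only; a potential reduces it to a finite check.
module Submission where

open import Defs
open import Data.Bool using (Bool; true; false; not; _∧_; _∨_)
open import Data.Bool.Properties using (∧-zeroʳ)
open import Data.Empty using (⊥; ⊥-elim)
open import Data.Fin using (Fin; zero; suc; _≟_)
open import Data.List using (List; []; _∷_; _++_; _ʳ++_; reverse; length; concat; filter; allFin; tabulate)
open import Data.List.Extrema.Nat using (argmin; argmin-all; f[argmin]≤f[xs])
open import Data.List.Membership.Propositional using (_∈_)
open import Data.List.Membership.Propositional.Properties using (∈-∃++; ∈-filter⁺)
open import Data.List.Properties
  using (++-identityʳ; ʳ++-ʳ++; ++-ʳ++; length-++; length-tabulate; reverse-involutive)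
open import Data.List.Relation.Binary.Disjoint.Propositional using (Disjoint)
open import Data.List.Relation.Binary.Permutation.Propositional using (_↭_; prep; swap; ↭-sym; ↭-refl)
import Data.List.Relation.Binary.Permutation.Propositional as Perm
open import Data.List.Relation.Binary.Permutation.Propositional.Properties
  using (All-resp-↭; ∈-resp-↭; ↭-length; shift)
open import Data.List.Relation.Unary.All as All using (All; []; _∷_)
import Data.List.Relation.Unary.All.Properties as All
open import Data.List.Relation.Unary.AllPairs using (AllPairs; []; _∷_)
open import Data.List.Relation.Unary.Any as Any using (Any; here; there)
open import Data.List.Relation.Unary.Linked using (Linked; []; [-]; _∷_)
open import Data.List.Relation.Unary.Unique.Propositional using (Unique)
open import Data.List.Relation.Unary.Unique.Propositional.Properties using (concat⁺)
open import Data.Nat hiding (_≟_)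
open import Data.Nat.Properties hiding (_≟_)
open import Data.Nat.Tactic.RingSolver using (solve-∀)
open import Data.Product using (_×_; _,_; proj₁; proj₂; ∃-syntax)
open import Data.Sum using (_⊎_; inj₁; inj₂)
open import Function using (_∘_; id; case_of_)
open import Relation.Binary.PropositionalEquality
open import Relation.Nullary using (Dec; yes; no; does; ¬_)
open import Relation.Nullary.Decidable using (_×-dec_)

-- The obstacle is a path on which unhit vertices alternate with vertices hit four times, the most
-- that 6-regularity leaves to an inner vertex. Such a pair is worth 72 but owes 96, so 24 must come
-- back, 12 for each of the two cuts at the hit vertex. At a cut the candidate y has four neighbours
-- off the path. One with at least two hits contributes 3. One with at most one hit would be a gain
-- in `Φ`, so every end that could give way to y must have as many rarely hit vertices to lose, and
-- those contribute instead. Four neighbours of the first kind yield exactly 12. Cyclic components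
-- are favoured because they can be opened at any vertex: an end of another component that sees one
-- merges with it, so their vertices never pay such an end. The rates come from the demand 252. The
-- ends of a non-cyclic component make ten hits, and 10 * 24 + 12 = 252; an end of a cyclic
-- component and its six neighbours are seven vertices, and 2 * 7 * 18 = 252.

private variable
  A B : Set

-- Indicators, finite sums and occurrences

#_ : Bool → ℕ
# true  = 1
# false = 0

infix 20 #_

#≤1 : ∀ b → # b ≤ 1
#≤1 true  = s≤s z≤n
#≤1 false = z≤n

∑ : List A → (A → ℕ) → ℕ
∑ []       f = 0
∑ (x ∷ xs) f = f x + ∑ xs f

infixr 10 ∑
syntax ∑ xs (λ x → e) = ∑[ x ∈ xs ] e

+-interchange : ∀ a b c d → (a + b) + (c + d) ≡ (a + c) + (b + d)
+-interchange a b c d = begin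
  a + b + (c + d)   ≡⟨ +-assoc a b (c + d) ⟩
  a + (b + (c + d)) ≡⟨ cong (a +_) (sym (+-assoc b c d)) ⟩
  a + (b + c + d)   ≡⟨ cong (λ z → a + (z + d)) (+-comm b c) ⟩
  a + (c + b + d)   ≡⟨ cong (a +_) (+-assoc c b d) ⟩
  a + (c + (b + d)) ≡⟨ +-assoc a c (b + d) ⟨
  a + c + (b + d)   ∎
  where open ≡-Reasoning

∑-cong : ∀ (xs : List A) {f g : A → ℕ} → (∀ x → f x ≡ g x) → ∑ xs f ≡ ∑ xs g
∑-cong []       eq = refl
∑-cong (x ∷ xs) eq = cong₂ _+_ (eq x) (∑-cong xs eq)

∑-mono : ∀ (xs : List A) {f g : A → ℕ} → (∀ x → f x ≤ g x) → ∑ xs f ≤ ∑ xs g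
∑-mono []       le = z≤n
∑-mono (x ∷ xs) le = +-mono-≤ (le x) (∑-mono xs le)

∑-0 : ∀ (xs : List A) → ∑[ _ ∈ xs ] 0 ≡ 0
∑-0 []       = refl
∑-0 (x ∷ xs) = ∑-0 xs

∑-+ : ∀ (xs : List A) (f g : A → ℕ) → ∑[ x ∈ xs ] (f x + g x) ≡ ∑ xs f + ∑ xs g
∑-+ []       f g = refl
∑-+ (x ∷ xs) f g =
  trans (cong (f x + g x +_) (∑-+ xs f g)) (+-interchange (f x) (g x) (∑ xs f) (∑ xs g))

∑-* : ∀ (xs : List A) c (f : A → ℕ) → ∑[ x ∈ xs ] (c * f x) ≡ c * ∑ xs f
∑-* []       c f = sym (*-zeroʳ c)
∑-* (x ∷ xs) c f =
  trans (cong (c * f x +_) (∑-* xs c f)) (sym (*-distribˡ-+ c (f x) (∑ xs f)))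

∑-*ʳ : ∀ (xs : List A) c (f : A → ℕ) → ∑[ x ∈ xs ] (f x * c) ≡ ∑ xs f * c
∑-*ʳ []       c f = refl
∑-*ʳ (x ∷ xs) c f =
  trans (cong (f x * c +_) (∑-*ʳ xs c f)) (sym (*-distribʳ-+ c (f x) (∑ xs f)))

∑-comm : ∀ (xs : List A) (ys : List B) (f : A → B → ℕ) →
         ∑[ x ∈ xs ] ∑[ y ∈ ys ] f x y ≡ ∑[ y ∈ ys ] ∑[ x ∈ xs ] f x y
∑-comm []       ys f = sym (∑-0 ys)
∑-comm (x ∷ xs) ys f =
  trans (cong (∑ ys (f x) +_) (∑-comm xs ys f))
        (sym (∑-+ ys (f x) (λ y → ∑[ x ∈ xs ] f x y)))

∑-++ : ∀ (xs : List A) {ys} (f : A → ℕ) → ∑ (xs ++ ys) f ≡ ∑ xs f + ∑ ys f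
∑-++ []       f = refl
∑-++ (x ∷ xs) f = trans (cong (f x +_) (∑-++ xs f)) (sym (+-assoc (f x) _ _))

∑-ʳ++ : ∀ (xs : List A) {ys} (f : A → ℕ) → ∑ (xs ʳ++ ys) f ≡ ∑ xs f + ∑ ys f
∑-ʳ++ []            f = refl
∑-ʳ++ (x ∷ xs) {ys} f = begin
  ∑ (xs ʳ++ (x ∷ ys)) f       ≡⟨ ∑-ʳ++ xs f ⟩
  ∑ xs f + (f x + ∑ ys f)     ≡⟨ +-assoc (∑ xs f) (f x) _ ⟨
  ∑ xs f + f x + ∑ ys f       ≡⟨ cong (_+ ∑ ys f) (+-comm (∑ xs f) (f x)) ⟩
  f x + ∑ xs f + ∑ ys f       ∎
  where open ≡-Reasoning

∑-reverse : ∀ (xs : List A) (f : A → ℕ) → ∑ (reverse xs) f ≡ ∑ xs f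
∑-reverse xs f = trans (∑-ʳ++ xs f) (+-identityʳ _)

∑-↭ : ∀ {xs ys : List A} → xs ↭ ys → (f : A → ℕ) → ∑ xs f ≡ ∑ ys f
∑-↭ Perm.refl         f = refl
∑-↭ (prep x p)        f = cong (f x +_) (∑-↭ p f)
∑-↭ (swap {xs} {ys} x y p) f = begin
  f x + (f y + ∑ xs f) ≡⟨ +-assoc (f x) _ _ ⟨
  f x + f y + ∑ xs f   ≡⟨ cong₂ _+_ (+-comm (f x) (f y)) (∑-↭ p f) ⟩
  f y + f x + ∑ ys f   ≡⟨ +-assoc (f y) _ _ ⟩
  f y + (f x + ∑ ys f) ∎
  where open ≡-Reasoning
∑-↭ (Perm.trans p q)  f = trans (∑-↭ p f) (∑-↭ q f)

∑-∈-≤ : ∀ {xs ys : List A} {x} → xs ↭ x ∷ ys → (f : A → ℕ) → f x ≤ ∑ xs f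
∑-∈-≤ p f = ≤-trans (m≤m+n _ _) (≤-reflexive (sym (∑-↭ p f)))

∑-const : ∀ (xs : List A) c → ∑[ _ ∈ xs ] c ≡ length xs * c
∑-const []       c = refl
∑-const (x ∷ xs) c = cong (c +_) (∑-const xs c)

length-as-∑ : ∀ (xs : List A) → length xs ≡ ∑[ _ ∈ xs ] 1
length-as-∑ xs = sym (trans (∑-const xs 1) (*-identityʳ (length xs)))

module _ {n : ℕ} where

  _==_ : Fin n → Fin n → Bool
  v == w = does (v ≟ w)

  ==-refl : ∀ v → (v == v) ≡ true
  ==-refl v with v ≟ v
  ... | yes _  = refl
  ... | no v≢v = ⊥-elim (v≢v refl)

  ==-≡ : ∀ {v w} → (v == w) ≡ true → v ≡ w
  ==-≡ {v} {w} eq with v ≟ w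
  ... | yes p = p

  ==-≢ : ∀ {v w} → v ≢ w → (v == w) ≡ false
  ==-≢ {v} {w} v≢w with v ≟ w
  ... | yes p = ⊥-elim (v≢w p)
  ... | no _  = refl

  ==-sym : ∀ v w → (v == w) ≡ (w == v)
  ==-sym v w with v ≟ w
  ... | yes refl = sym (==-refl v)
  ... | no v≢w   = sym (==-≢ (v≢w ∘ sym))

  occ : Fin n → List (Fin n) → ℕ
  occ v xs = ∑[ x ∈ xs ] # (x == v)

∑-tabulate : ∀ {n} (f : Fin n → A) (g : A → ℕ) →
             ∑ (tabulate f) g ≡ ∑ (allFin n) (g ∘ f)
∑-tabulate {n = zero}  f g = refl
∑-tabulate {n = suc n} f g =
  cong (g (f zero) +_)
    (trans (∑-tabulate (f ∘ suc) g) (sym (∑-tabulate suc (g ∘ f))))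

==-suc : ∀ {n} (v w : Fin n) → (suc v == suc w) ≡ (v == w)
==-suc v w = refl

∑-δ : ∀ {n} (v : Fin n) (g : Fin n → ℕ) → ∑[ w ∈ allFin n ] (# (v == w) * g w) ≡ g v
∑-δ {suc n} zero g = begin
  g zero + 0 + ∑ (tabulate suc) (λ w → # (zero == w) * g w)
    ≡⟨ cong₂ _+_ (+-identityʳ (g zero)) (∑-tabulate suc (λ w → # (zero == w) * g w)) ⟩
  g zero + ∑ (allFin n) (λ _ → 0)
    ≡⟨ cong (g zero +_) (∑-0 (allFin n)) ⟩
  g zero + 0
    ≡⟨ +-identityʳ _ ⟩
  g zero ∎
  where open ≡-Reasoning
∑-δ {suc n} (suc v) g = begin
  ∑ (tabulate suc) (λ w → # (suc v == w) * g w)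
    ≡⟨ ∑-tabulate suc (λ w → # (suc v == w) * g w) ⟩
  ∑ (allFin n) (λ w → # (suc v == suc w) * g (suc w))
    ≡⟨ ∑-cong (allFin n) (λ w → cong (λ z → # z * g (suc w)) (==-suc v w)) ⟩
  ∑ (allFin n) (λ w → # (v == w) * g (suc w))
    ≡⟨ ∑-δ v (g ∘ suc) ⟩
  g (suc v) ∎
  where open ≡-Reasoning

-- Turns sums over a path into sums over all vertices, where the order of summation can be changed.
∑-occ : ∀ {n} (xs : List (Fin n)) (g : Fin n → ℕ) → ∑ xs g ≡ ∑[ v ∈ allFin n ] (occ v xs * g v)
∑-occ {n} []       g = sym (∑-0 (allFin n))
∑-occ {n} (x ∷ xs) g = begin
  g x + ∑ xs g
    ≡⟨ cong₂ _+_ (sym (∑-δ x g)) (∑-occ xs g) ⟩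
  ∑[ v ∈ allFin n ] (# (x == v) * g v) + ∑[ v ∈ allFin n ] (occ v xs * g v)
    ≡⟨ ∑-+ (allFin n) (λ v → # (x == v) * g v) (λ v → occ v xs * g v) ⟨
  ∑[ v ∈ allFin n ] (# (x == v) * g v + occ v xs * g v)
    ≡⟨ ∑-cong (allFin n) (λ v → sym (*-distribʳ-+ (g v) (# (x == v)) (occ v xs))) ⟩
  ∑[ v ∈ allFin n ] ((# (x == v) + occ v xs) * g v) ∎
  where open ≡-Reasoning

module _ {A : Set} where

  reverse-ʳ++ : ∀ (xs ys : List A) → reverse (xs ʳ++ ys) ≡ ys ʳ++ xs
  reverse-ʳ++ xs ys = trans (ʳ++-ʳ++ xs) (cong (ys ʳ++_) (++-identityʳ xs))

∨-true : ∀ {a b} → a ∨ b ≡ true → (a ≡ true) ⊎ (b ≡ true)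
∨-true {true}  eq = inj₁ refl
∨-true {false} eq = inj₂ eq

∨-false : ∀ {a b} → a ∨ b ≡ false → (a ≡ false) × (b ≡ false)
∨-false {false} eq = refl , eq

∧-true : ∀ {a b} → a ∧ b ≡ true → (a ≡ true) × (b ≡ true)
∧-true {true} eq = refl , eq

true≢false : ∀ {b} → b ≡ true → b ≡ false → ⊥
true≢false refl ()

-- Oriented paths, hits and optimal covers

module Paths {n : ℕ} (G : Graph n) where

  V : Set
  V = Fin n

  Path : Set
  Path = List V

  adj : V → V → Bool
  adj v w = does (adj? G v w)

  adj-sound : ∀ {v w} → adj v w ≡ true → Adj G v w
  adj-sound {v} {w} eq with adj? G v w
  ... | yes p = p

  adj-complete : ∀ {v w} → Adj G v w → adj v w ≡ true
  adj-complete {v} {w} p with adj? G v w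
  ... | yes _ = refl
  ... | no ¬p = ⊥-elim (¬p p)

  adj-sym : ∀ v w → adj v w ≡ adj w v
  adj-sym v w with adj? G v w | adj? G w v
  ... | yes _ | yes _ = refl
  ... | yes p | no ¬q = ⊥-elim (¬q (symm G p))
  ... | no ¬p | yes q = ⊥-elim (¬p (symm G q))
  ... | no _  | no _  = refl

  adj-irrefl : ∀ v → adj v v ≡ false
  adj-irrefl v with adj? G v v
  ... | yes p = ⊥-elim (irrefl G refl p)
  ... | no _  = refl

  -- An oriented component O stands for its first vertex as an end of the
  -- component; hit O v says that this end sees v off the path.
  hit : Path → V → Bool
  hit []           v = false
  hit (e ∷ [])     v = adj e v
  hit (e ∷ e′ ∷ _) v = adj e v ∧ not (e′ == v)

  hit-inv : ∀ O {v} → hit O v ≡ true → ∃[ e ] ∃[ t ] (O ≡ e ∷ t × Adj G e v)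
  hit-inv (e ∷ [])     eq = e , [] , refl , adj-sound eq
  hit-inv (e ∷ e′ ∷ t) eq = e , e′ ∷ t , refl , adj-sound (proj₁ (∧-true eq))

  -- `hit` reads only the first two vertices, and these do not reach beyond `b`. So an exchange that
  -- leaves an end and its neighbour on the path in place leaves the hits of this end alone.
  hit-ʳ++ : ∀ l {a b R R′ v} → hit (l ʳ++ (a ∷ b ∷ R)) v ≡ hit (l ʳ++ (a ∷ b ∷ R′)) v
  hit-ʳ++ []      = refl
  hit-ʳ++ (x ∷ l) = hit-ʳ++ l

  LinkedG : Path → Set
  LinkedG = Linked (Adj G)

  linked-ʳ++⁺ : ∀ {x y} X {Y} → LinkedG (x ∷ X) → LinkedG (y ∷ Y) → Adj G x y →
                LinkedG ((x ∷ X) ʳ++ (y ∷ Y))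
  linked-ʳ++⁺ []       lx       ly xy = xy ∷ ly
  linked-ʳ++⁺ (x ∷ X)  (r ∷ lx) ly xy = linked-ʳ++⁺ X lx (xy ∷ ly) (symm G r)

  linked-ʳ++⁻ : ∀ {x y} X {Y} → LinkedG ((x ∷ X) ʳ++ (y ∷ Y)) →
                LinkedG (x ∷ X) × Adj G x y × LinkedG (y ∷ Y)
  linked-ʳ++⁻ []      (xy ∷ ly) = [-] , xy , ly
  linked-ʳ++⁻ (x ∷ X) l with linked-ʳ++⁻ X l
  ... | lX , xx′ , (xy ∷ ly) = symm G xx′ ∷ lX , xy , ly

  linked-reverse : ∀ {X} → LinkedG X → LinkedG (reverse X)
  linked-reverse {[]}        l        = []
  linked-reverse {x ∷ []}    l        = [-]
  linked-reverse {x ∷ y ∷ X} (xy ∷ l) = linked-ʳ++⁺ X l [-] (symm G xy)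

  data Good : Path → Set where
    good : ∀ {x xs} → LinkedG (x ∷ xs) → Good (x ∷ xs)

  infix 4 _~_
  -- Paths are glued at their first vertices, which `X ʳ++ Y` puts side by side.
  _~_ : Path → Path → Set
  X ~ Y = ∃[ x ] ∃[ X′ ] ∃[ y ] ∃[ Y′ ] (X ≡ x ∷ X′ × Y ≡ y ∷ Y′ × Adj G x y)

  ʳ++-nonempty : ∀ (X : Path) {y Y} → ∃[ z ] ∃[ Z ] X ʳ++ (y ∷ Y) ≡ z ∷ Z
  ʳ++-nonempty []      = _ , _ , refl
  ʳ++-nonempty (x ∷ X) = ʳ++-nonempty X

  linked⇒good : ∀ {X z Z} → X ≡ z ∷ Z → LinkedG X → Good X
  linked⇒good refl l = good l

  good-linked : ∀ {X} → Good X → LinkedG X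
  good-linked (good l) = l

  good-ʳ++ : ∀ {X Y} → Good X → Good Y → X ~ Y → Good (X ʳ++ Y)
  good-ʳ++ (good lx) (good ly) (x , X′ , y , Y′ , refl , refl , xy) =
    linked⇒good (proj₂ (proj₂ (ʳ++-nonempty (x ∷ X′)))) (linked-ʳ++⁺ X′ lx ly xy)

  good-reverse : ∀ {X} → Good X → Good (reverse X)
  good-reverse {x ∷ X} (good l) = linked⇒good (proj₂ (proj₂ (ʳ++-nonempty X))) (linked-reverse l)

  hit⇒~ : ∀ {O y Y} → hit O y ≡ true → O ~ (y ∷ Y)
  hit⇒~ {O} eq with e , t , refl , ey ← hit-inv O eq = e , t , _ , _ , refl , refl , ey

  -- Both halves start at the cut edge and run away from it, ready to be glued there by `ʳ++`. With
  -- a constructor for each orientation of `P`, every argument about a cut also serves for its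
  -- mirror image.
  data Cut : Path → Path → Path → Set where
    fwd : ∀ {P L R} → P ≡ L ʳ++ R → Cut P L R
    bwd : ∀ {P L R} → P ≡ R ʳ++ L → Cut P L R

  cut-swap : ∀ {P L R} → Cut P L R → Cut P R L
  cut-swap (fwd p) = bwd p
  cut-swap (bwd p) = fwd p

  cut-∑ : ∀ {P L R} → Cut P L R → ∀ f → ∑ P f ≡ ∑ L f + ∑ R f
  cut-∑ {L = L} {R} (fwd refl) f = ∑-ʳ++ L f
  cut-∑ {L = L} {R} (bwd refl) f = trans (∑-ʳ++ R f) (+-comm (∑ R f) (∑ L f))

  cut-good : ∀ {P u l w r} → Cut P (u ∷ l) (w ∷ r) → Good P →
             Good (u ∷ l) × Adj G u w × Good (w ∷ r)
  cut-good {l = l} (fwd refl) g with a , b , c ← linked-ʳ++⁻ l (good-linked g) =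
    good a , b , good c
  cut-good {r = r} (bwd refl) g with a , b , c ← linked-ʳ++⁻ r (good-linked g) =
    good c , symm G b , good a

  h₂ : Path → V → ℕ
  h₂ P v = # hit P v + # hit (reverse P) v

  h₂-reverse : ∀ P v → h₂ (reverse P) v ≡ h₂ P v
  h₂-reverse P v = trans (cong (λ z → # hit (reverse P) v + # hit z v) (reverse-involutive P))
                         (+-comm (# hit (reverse P) v) (# hit P v))

  cut-h₂ : ∀ {P L R} → Cut P L R → ∀ v → h₂ P v ≡ # hit (L ʳ++ R) v + # hit (R ʳ++ L) v
  cut-h₂ {L = L} {R} (fwd refl) v = cong (λ z → # hit (L ʳ++ R) v + # hit z v) (reverse-ʳ++ L R)
  cut-h₂ {L = L} {R} (bwd refl) v =
    trans (cong (λ z → # hit (R ʳ++ L) v + # hit z v) (reverse-ʳ++ R L)) (+-comm (# hit (R ʳ++ L) v) _)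

  closes : Path → Bool
  closes []       = false
  closes (p ∷ ps) = hit (reverse (p ∷ ps)) p

  cyc : Path → Bool
  cyc P = closes P ∨ closes (reverse P)

  single : Path → Bool
  single (_ ∷ []) = true
  single _        = false

  single-ʳ++ : ∀ (X : Path) {a b Y} → single (X ʳ++ (a ∷ b ∷ Y)) ≡ false
  single-ʳ++ []      = refl
  single-ʳ++ (x ∷ X) = single-ʳ++ X

  single-reverse : ∀ P → single (reverse P) ≡ single P
  single-reverse []           = refl
  single-reverse (x ∷ [])     = refl
  single-reverse (x ∷ y ∷ P)  = single-ʳ++ P

  data Oriented (D : Path) : Path → Set where
    fwd : ∀ {O} → O ≡ D → Oriented D O
    bwd : ∀ {O} → O ≡ reverse D → Oriented D O

  or-rev : ∀ {D O} → Oriented D O → Oriented D (reverse O)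
  or-rev         (fwd refl) = bwd refl
  or-rev {D} (bwd refl) = fwd (reverse-involutive D)

  or-∑ : ∀ {D O} → Oriented D O → ∀ f → ∑ O f ≡ ∑ D f
  or-∑     (fwd refl) f = refl
  or-∑ {D} (bwd refl) f = ∑-reverse D f

  or-h₂ : ∀ {D O} → Oriented D O → ∀ v → h₂ O v ≡ h₂ D v
  or-h₂     (fwd refl) v = refl
  or-h₂ {D} (bwd refl) v = h₂-reverse D v

  or-single : ∀ {D O} → Oriented D O → single O ≡ single D
  or-single     (fwd refl) = refl
  or-single {D} (bwd refl) = single-reverse D

  or-good : ∀ {D O} → Oriented D O → Good D → Good O
  or-good (fwd refl) g = g
  or-good (bwd refl) g = good-reverse g

  -- A path partition in counting form. One equation stands for covering, distinctness and
  -- disjointness at once, so an exchange is legitimate as soon as the old and the new paths have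
  -- equal totals of `occ`.
  record Cover (S : List Path) : Set where
    field
      allGood : All Good S
      once    : ∀ v → ∑[ P ∈ S ] occ v P ≡ 1

  open Cover public

  singles cycles : List Path → ℕ
  singles S = ∑[ P ∈ S ] # single P
  cycles  S = ∑[ P ∈ S ] # cyc P

  H : List Path → V → ℕ
  H S v = ∑[ P ∈ S ] h₂ P v

  Φ : List Path → ℕ
  Φ S = ∑[ v ∈ allFin n ] (H S v ⊓ 2)

  record Opt (S : List Path) : Set where
    field
      cover      : Cover S
      minLength  : ∀ {S′} → Cover S′ → length S ≤ length S′
      minSingles : ∀ {S′} → Cover S′ → length S′ ≤ length S → singles S ≤ singles S′
      maxCycles  : ∀ {S′} → Cover S′ → length S′ ≤ length S → singles S′ ≤ singles S →
                   cycles S′ ≤ cycles S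
      maxΦ       : ∀ {S′} → Cover S′ → length S′ ≤ length S → singles S′ ≤ singles S →
                   cycles S ≤ cycles S′ → Φ S′ ≤ Φ S

  replace : ∀ {S old new rest} → Cover S → S ↭ old ++ rest →
            (∀ v → ∑[ P ∈ new ] occ v P ≡ ∑[ P ∈ old ] occ v P) → All Good new →
            Cover (new ++ rest)
  replace {S} {old} {new} {rest} c p eq g = record
    { allGood = All.++⁺ g (All.++⁻ʳ old (All-resp-↭ p (allGood c)))
    ; once    = λ v → begin
        ∑ (new ++ rest) (occ v)       ≡⟨ ∑-++ new (occ v) ⟩
        ∑ new (occ v) + ∑ rest (occ v) ≡⟨ cong (_+ ∑ rest (occ v)) (eq v) ⟩
        ∑ old (occ v) + ∑ rest (occ v) ≡⟨ ∑-++ old (occ v) ⟨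
        ∑ (old ++ rest) (occ v)       ≡⟨ ∑-↭ p (occ v) ⟨
        ∑ S (occ v)                   ≡⟨ once c v ⟩
        1                             ∎
    }
    where open ≡-Reasoning

  module _ {S : List Path} (old new : List Path) {rest : List Path} (p : S ↭ old ++ rest) where

    length-replace : length new ≤ length old → length (new ++ rest) ≤ length S
    length-replace le = begin
      length (new ++ rest)       ≡⟨ length-++ new ⟩
      length new + length rest   ≤⟨ +-monoˡ-≤ (length rest) le ⟩
      length old + length rest   ≡⟨ length-++ old ⟨
      length (old ++ rest)       ≡⟨ ↭-length p ⟨
      length S                   ∎
      where open ≤-Reasoning

    ∑-replace-≤ : (f : Path → ℕ) → ∑ new f ≤ ∑ old f → ∑ (new ++ rest) f ≤ ∑ S f
    ∑-replace-≤ f le = begin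
      ∑ (new ++ rest) f     ≡⟨ ∑-++ new f ⟩
      ∑ new f + ∑ rest f    ≤⟨ +-monoˡ-≤ (∑ rest f) le ⟩
      ∑ old f + ∑ rest f    ≡⟨ ∑-++ old f ⟨
      ∑ (old ++ rest) f     ≡⟨ ∑-↭ p f ⟨
      ∑ S f                 ∎
      where open ≤-Reasoning

    ∑-replace-≥ : (f : Path → ℕ) → ∑ old f ≤ ∑ new f → ∑ S f ≤ ∑ (new ++ rest) f
    ∑-replace-≥ f le = begin
      ∑ S f                 ≡⟨ ∑-↭ p f ⟩
      ∑ (old ++ rest) f     ≡⟨ ∑-++ old f ⟩
      ∑ old f + ∑ rest f    ≤⟨ +-monoˡ-≤ (∑ rest f) le ⟩
      ∑ new f + ∑ rest f    ≡⟨ ∑-++ new f ⟨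
      ∑ (new ++ rest) f     ∎
      where open ≤-Reasoning

    ∑-replace-< : (f : Path → ℕ) → ∑ old f < ∑ new f → ∑ S f < ∑ (new ++ rest) f
    ∑-replace-< f lt = begin-strict
      ∑ S f                 ≡⟨ ∑-↭ p f ⟩
      ∑ (old ++ rest) f     ≡⟨ ∑-++ old f ⟩
      ∑ old f + ∑ rest f    <⟨ +-monoˡ-< (∑ rest f) lt ⟩
      ∑ new f + ∑ rest f    ≡⟨ ∑-++ new f ⟨
      ∑ (new ++ rest) f     ∎
      where open ≤-Reasoning

    ∑-replace-> : (f : Path → ℕ) → ∑ new f < ∑ old f → ∑ (new ++ rest) f < ∑ S f
    ∑-replace-> f lt = begin-strict
      ∑ (new ++ rest) f     ≡⟨ ∑-++ new f ⟩
      ∑ new f + ∑ rest f    <⟨ +-monoˡ-< (∑ rest f) lt ⟩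
      ∑ old f + ∑ rest f    ≡⟨ ∑-++ old f ⟨
      ∑ (old ++ rest) f     ≡⟨ ∑-↭ p f ⟨
      ∑ S f                 ∎
      where open ≤-Reasoning

  -- Merging arguments need the minimum length only.  They also apply after an
  -- exchange, which preserves Min but need not preserve Opt.
  record Min (S : List Path) : Set where
    field
      cov : Cover S
      min : ∀ {S′} → Cover S′ → length S ≤ length S′

  opt⇒min : ∀ {S} → Opt S → Min S
  opt⇒min o = record { cov = Opt.cover o ; min = Opt.minLength o }

  noMerge : ∀ {S} old new {rest} → Min S → S ↭ old ++ rest →
            (∀ v → ∑[ P ∈ new ] occ v P ≡ ∑[ P ∈ old ] occ v P) → All Good new →
            length new < length old → ⊥
  noMerge {S} old new {rest} m p eq g lt =
    <⇒≱ lt′ (Min.min m (replace (Min.cov m) p eq g))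
    where
    lt′ : length (new ++ rest) < length S
    lt′ = subst₂ _<_ (sym (length-as-∑ (new ++ rest))) (sym (length-as-∑ S))
            (∑-replace-> old new p (λ _ → 1) (subst₂ _<_ (length-as-∑ new) (length-as-∑ old) lt))

-- Merging components

module Merges {n : ℕ} (G : Graph n) where
  open Paths G

  good-of : ∀ {S P rest} → Min S → S ↭ P ∷ rest → Good P
  good-of m p = All.head (All-resp-↭ p (allGood (Min.cov m)))

  good-of₂ : ∀ {S P Q rest} → Min S → S ↭ P ∷ Q ∷ rest → Good Q
  good-of₂ m p = All.head (All.tail (All-resp-↭ p (allGood (Min.cov m))))

  good-of₃ : ∀ {S P Q R rest} → Min S → S ↭ P ∷ Q ∷ R ∷ rest → Good R
  good-of₃ m p = All.head (All.tail (All.tail (All-resp-↭ p (allGood (Min.cov m)))))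

  -- Gluing at the two ends would save a component. `Z` may be any path on the vertices of `Q`, such
  -- as its reversal or a rotation.
  ends-apart : ∀ {S D Q rest O Z} → Min S → S ↭ D ∷ Q ∷ rest → Oriented D O →
               (∀ v → occ v Z ≡ occ v Q) → Good Z → ¬ O ~ Z
  ends-apart {D = D} {Q} {O = O} {Z} m p o eq gZ oz =
    noMerge (D ∷ Q ∷ []) ((O ʳ++ Z) ∷ []) m p
      (λ v → begin
        occ v (O ʳ++ Z) + 0           ≡⟨ cong (_+ 0) (∑-ʳ++ O _) ⟩
        occ v O + occ v Z + 0         ≡⟨ cong₂ (λ x y → x + y + 0) (or-∑ o _) (eq v) ⟩
        occ v D + occ v Q + 0         ≡⟨ +-assoc (occ v D) _ _ ⟩
        occ v D + (occ v Q + 0)       ∎)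
      (good-ʳ++ (or-good o (good-of m p)) gZ oz ∷ [])
      (s≤s (s≤s z≤n))
    where open ≡-Reasoning

  -- D is joined to P at one end of an edge that is cut; a chord from the end of
  -- P on that side re-attaches the other half.
  chord-apart : ∀ {S P D rest O u l w r} → Min S → S ↭ P ∷ D ∷ rest → Oriented D O →
                Cut P (u ∷ l) (w ∷ r) → hit O u ≡ true →
                ¬ hit ((u ∷ l) ʳ++ (w ∷ r)) w ≡ true
  chord-apart {P = P} {D} {O = O} {u} {l} {w} {r} m p o c Ou aw
    with e , t , eq , ew ← hit-inv ((u ∷ l) ʳ++ (w ∷ r)) aw
       | gL , uw , gR ← cut-good c (good-of m p) =
    noMerge (P ∷ D ∷ []) ((O ʳ++ ((u ∷ l) ++ (w ∷ r))) ∷ []) m p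
      (λ v → begin
        occ v (O ʳ++ ((u ∷ l) ++ (w ∷ r))) + 0
          ≡⟨ cong (_+ 0) (trans (∑-ʳ++ O _) (cong (occ v O +_) (∑-++ (u ∷ l) _))) ⟩
        occ v O + (occ v (u ∷ l) + occ v (w ∷ r)) + 0
          ≡⟨ cong₂ (λ x y → x + y + 0) (or-∑ o _) (sym (cut-∑ c _)) ⟩
        occ v D + occ v P + 0
          ≡⟨ cong (_+ 0) (+-comm (occ v D) (occ v P)) ⟩
        occ v P + occ v D + 0
          ≡⟨ +-assoc (occ v P) _ _ ⟩
        occ v P + (occ v D + 0) ∎)
      (good-ʳ++ (or-good o (good-of₂ m p)) gLR (hit⇒~ Ou) ∷ [])
      (s≤s (s≤s z≤n))
    where
    open ≡-Reasoning
    head-rev : ∃[ e ] ∃[ t ] (reverse (u ∷ l) ≡ e ∷ t × Adj G e w)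
    head-rev = go l aw
      where
      go : ∀ l → hit ((u ∷ l) ʳ++ (w ∷ r)) w ≡ true → ∃[ e ] ∃[ t ] (reverse (u ∷ l) ≡ e ∷ t × Adj G e w)
      -- With `l` empty the end in question is `u`, whose edge to `w` is the cut edge itself and
      -- thus no hit.
      go []       h = ⊥-elim (true≢false (proj₂ (∧-true h)) (cong not (==-refl w)))
      go (u′ ∷ l) h = hit-inv (reverse (u ∷ u′ ∷ l)) (trans (hit-ʳ++ l) h)
    gLR : Good ((u ∷ l) ++ (w ∷ r))
    gLR with e , t , eq , ew ← head-rev | gL , uw , gR ← cut-good c (good-of m p) =
      subst Good (ʳ++-ʳ++ (u ∷ l))
        (good-ʳ++ (good-reverse gL) gR (e , t , w , r , eq , refl , ew))

  -- D and D′ would take one half of P each.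
  cross-apart : ∀ {S P D D′ rest O O′ u l w r} → Min S → S ↭ P ∷ D ∷ D′ ∷ rest →
                Oriented D O → Oriented D′ O′ → Cut P (u ∷ l) (w ∷ r) →
                hit O u ≡ true → ¬ hit O′ w ≡ true
  cross-apart {P = P} {D} {D′} {O = O} {O′} {u} {l} {w} {r} m p o o′ c Ou O′w
    with gL , uw , gR ← cut-good c (good-of m p) =
    noMerge (P ∷ D ∷ D′ ∷ []) ((O ʳ++ (u ∷ l)) ∷ (O′ ʳ++ (w ∷ r)) ∷ []) m p
      (λ v → begin
        occ v (O ʳ++ (u ∷ l)) + (occ v (O′ ʳ++ (w ∷ r)) + 0)
          ≡⟨ cong₂ (λ x y → x + (y + 0)) (∑-ʳ++ O _) (∑-ʳ++ O′ _) ⟩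
        occ v O + occ v (u ∷ l) + (occ v O′ + occ v (w ∷ r) + 0)
          ≡⟨ cong₂ (λ x y → x + occ v (u ∷ l) + (y + occ v (w ∷ r) + 0)) (or-∑ o _) (or-∑ o′ _) ⟩
        occ v D + occ v (u ∷ l) + (occ v D′ + occ v (w ∷ r) + 0)
          ≡⟨ shuffle (occ v D) (occ v (u ∷ l)) (occ v D′) (occ v (w ∷ r)) ⟩
        occ v (u ∷ l) + occ v (w ∷ r) + (occ v D + (occ v D′ + 0))
          ≡⟨ cong (_+ (occ v D + (occ v D′ + 0))) (cut-∑ c _) ⟨
        occ v P + (occ v D + (occ v D′ + 0)) ∎)
      (good-ʳ++ (or-good o (good-of₂ m p)) gL (hit⇒~ Ou) ∷
       good-ʳ++ (or-good o′ (good-of₃ m p)) gR (hit⇒~ O′w) ∷ [])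
      (s≤s (s≤s (s≤s z≤n)))
    where
    open ≡-Reasoning
    shuffle : ∀ d l d′ r → d + l + (d′ + r + 0) ≡ l + r + (d + (d′ + 0))
    shuffle = solve-∀

  -- D would fit into the edge.
  insert-apart : ∀ {S P D rest O u l w r} → Min S → S ↭ P ∷ D ∷ rest →
                 Oriented D O → Cut P (u ∷ l) (w ∷ r) →
                 hit O u ≡ true → ¬ hit (reverse O) w ≡ true
  insert-apart {P = P} {D} {O = O} {u} {l} {w} {r} m p o c Ou O′w
    with gL , uw , gR ← cut-good c (good-of m p)
       | e , t , refl , ew ← hit-inv O Ou =
    noMerge (P ∷ D ∷ []) (((u ∷ l) ʳ++ (reverse O ʳ++ (w ∷ r))) ∷ []) m p
      (λ v → begin
        occ v ((u ∷ l) ʳ++ (reverse O ʳ++ (w ∷ r))) + 0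
          ≡⟨ cong (_+ 0) (trans (∑-ʳ++ (u ∷ l) _) (cong (occ v (u ∷ l) +_)
               (trans (∑-ʳ++ (reverse O) _) (cong (_+ occ v (w ∷ r)) (trans (∑-reverse O _) (or-∑ o _)))))) ⟩
        occ v (u ∷ l) + (occ v D + occ v (w ∷ r)) + 0
          ≡⟨ shuffle (occ v (u ∷ l)) (occ v D) (occ v (w ∷ r)) ⟩
        occ v (u ∷ l) + occ v (w ∷ r) + (occ v D + 0)
          ≡⟨ cong (_+ (occ v D + 0)) (cut-∑ c _) ⟨
        occ v P + (occ v D + 0) ∎)
      (good-ʳ++ gL (good-ʳ++ (good-reverse gO) gR (hit⇒~ O′w))
        (u , l , e , t ++ (w ∷ r) , refl , ʳ++-ʳ++ (e ∷ t) , symm G ew) ∷ [])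
      (s≤s (s≤s z≤n))
    where
    open ≡-Reasoning
    gO : Good O
    gO = or-good o (good-of₂ m p)
    shuffle : ∀ l d r → l + (d + r) + 0 ≡ l + r + (d + 0)
    shuffle = solve-∀

∧-intro : ∀ {a b} → a ≡ true → b ≡ true → a ∧ b ≡ true
∧-intro refl refl = refl

-- Truncated hit counts when one end replaces another

module _ {n : ℕ} (H H′ : Fin n → ℕ) (M N : Fin n → Bool) (u : Fin n)
         (M-u : M u ≡ true) (N-u : N u ≡ true)
         (H′-eq : ∀ v → H′ v + # M v ≡ H v + # N v) where

  private
    gain loss : Fin n → ℕ
    gain v = # (N v ∧ (not (u == v) ∧ (H v ≤ᵇ 1)))
    loss v = # (M v ∧ (not (u == v) ∧ (H v ≤ᵇ 2)))

    up : ∀ h → # (h ≤ᵇ 1) + (h ⊓ 2) ≤ suc h ⊓ 2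
    up 0 = s≤s z≤n
    up 1 = s≤s (s≤s z≤n)
    up 2 = s≤s (s≤s z≤n)
    up (suc (suc (suc h))) = s≤s (s≤s z≤n)

    both : ∀ h → # (h ≤ᵇ 1) + (h ⊓ 2) ≤ (h ⊓ 2) + # (h ≤ᵇ 2)
    both 0 = s≤s z≤n
    both 1 = s≤s (s≤s z≤n)
    both 2 = s≤s (s≤s z≤n)
    both (suc (suc (suc h))) = s≤s (s≤s z≤n)

    down : ∀ h → suc h ⊓ 2 ≤ (h ⊓ 2) + # (suc h ≤ᵇ 2)
    down 0 = s≤s z≤n
    down 1 = s≤s (s≤s z≤n)
    down 2 = s≤s (s≤s z≤n)
    down (suc (suc (suc h))) = s≤s (s≤s z≤n)

    step : ∀ h h′ m k e → h′ + # m ≡ h + # k → (e ≡ true → m ≡ true × k ≡ true) →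
           # (k ∧ (not e ∧ (h ≤ᵇ 1))) + (h ⊓ 2) ≤ (h′ ⊓ 2) + # (m ∧ (not e ∧ (h ≤ᵇ 2)))
    step h h′ m k true eq both-hit with refl , refl ← both-hit refl
      with refl ← +-cancelʳ-≡ 1 h′ h eq = m≤m+n (h ⊓ 2) 0
    step h h′ true  true  false eq _ with refl ← +-cancelʳ-≡ 1 h′ h eq = both h
    step h h′ true  false false eq _
      with refl ← trans (+-comm 1 h′) (trans eq (+-identityʳ h)) = down h′
    step h h′ false true  false eq _
      with refl ← trans (trans (sym (+-identityʳ h′)) eq) (+-comm h 1) =
      ≤-trans (up h) (m≤m+n _ 0)
    step h h′ false false false eq _
      with refl ← +-cancelʳ-≡ 0 h′ h eq = m≤m+n (h ⊓ 2) 0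

    pointwise : ∀ v → gain v + (H v ⊓ 2) ≤ (H′ v ⊓ 2) + loss v
    pointwise v = step (H v) (H′ v) (M v) (N v) (u == v) (H′-eq v)
      (λ e → case ==-≡ {v = u} {v} e of λ { refl → M-u , N-u })

  -- An end that hits `M` gives way to one that hits `N`. A vertex of `N` alone raises the truncated
  -- sum if it had at most one hit, a vertex of `M` alone lowers it if it had at most two; a vertex
  -- of both keeps its count, and may be counted on both sides because 1 is below 2.
  truncated-exchange : ∑[ v ∈ allFin n ] (H′ v ⊓ 2) ≤ ∑[ v ∈ allFin n ] (H v ⊓ 2) →
    ∑[ v ∈ allFin n ] # (N v ∧ (not (u == v) ∧ (H v ≤ᵇ 1)))
      ≤ ∑[ v ∈ allFin n ] # (M v ∧ (not (u == v) ∧ (H v ≤ᵇ 2)))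
  truncated-exchange le = +-cancelʳ-≤ (∑[ v ∈ allFin n ] (H v ⊓ 2)) _ _ (begin
    ∑ (allFin n) gain + ∑[ v ∈ allFin n ] (H v ⊓ 2)
      ≡⟨ ∑-+ (allFin n) gain (λ v → H v ⊓ 2) ⟨
    ∑[ v ∈ allFin n ] (gain v + (H v ⊓ 2))
      ≤⟨ ∑-mono (allFin n) pointwise ⟩
    ∑[ v ∈ allFin n ] ((H′ v ⊓ 2) + loss v)
      ≡⟨ ∑-+ (allFin n) (λ v → H′ v ⊓ 2) loss ⟩
    ∑[ v ∈ allFin n ] (H′ v ⊓ 2) + ∑ (allFin n) loss
      ≤⟨ +-monoˡ-≤ _ le ⟩
    ∑[ v ∈ allFin n ] (H v ⊓ 2) + ∑ (allFin n) loss
      ≡⟨ +-comm (∑[ v ∈ allFin n ] (H v ⊓ 2)) _ ⟩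
    ∑ (allFin n) loss + ∑[ v ∈ allFin n ] (H v ⊓ 2) ∎)
    where open ≤-Reasoning

-- Opening cyclic components and creating new ones

module Exchange {n : ℕ} (G : Graph n) where
  open Paths G
  open Merges G

  first-ʳ++ : ∀ (X : Path) {a Y Y′} → ∃[ e ] ∃[ s ] ∃[ s′ ]
              (X ʳ++ (a ∷ Y) ≡ e ∷ s × X ʳ++ (a ∷ Y′) ≡ e ∷ s′)
  first-ʳ++ []      = _ , _ , _ , refl , refl
  first-ʳ++ (x ∷ X) = first-ʳ++ X

  hit-head : ∀ {x} X {Y v} → hit ((x ∷ X) ʳ++ Y) v ≡ true →
             ∃[ e ] ∃[ t ] (reverse (x ∷ X) ≡ e ∷ t × Adj G e v)
  hit-head {x} X {Y} h with e , s , s′ , p , q ← first-ʳ++ X {x} {Y} {[]}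
    with e′ , t , r , a ← hit-inv _ h with refl ← trans (sym p) r = e , s′ , q , a

  occ-split : ∀ (x : V) (Q : Path) → 1 ≤ occ x Q → ∃[ L ] ∃[ R ] (Q ≡ L ʳ++ (x ∷ R))
  occ-split x Q = go [] Q
    where
    go : ∀ (L Q : Path) → 1 ≤ occ x Q → ∃[ L′ ] ∃[ R ] (L ʳ++ Q ≡ L′ ʳ++ (x ∷ R))
    go L (q ∷ Q) le with q ≟ x
    ... | yes refl = L , Q , refl
    ... | no _     = go (q ∷ L) Q le

  occ-≤1 : ∀ {S P rest} → Cover S → S ↭ P ∷ rest → ∀ v → occ v P ≤ 1
  occ-≤1 {P = P} c p v = ≤-trans (∑-∈-≤ p (occ v)) (≤-reflexive (once c v))

  Rotation : Path → V → Set
  Rotation Q x = ∃[ Z ] (Good (x ∷ Z) × (∀ v → occ v (x ∷ Z) ≡ occ v Q))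

  -- The new path runs from `x` to the last vertex of `Q`, takes the closing edge to the first
  -- vertex and goes on up to the predecessor of `x`.
  rotate-closed : ∀ x Q → Good Q → closes Q ≡ true → 1 ≤ occ x Q → Rotation Q x
  rotate-closed x Q g c le with occ-split x Q le
  ... | [] , R , refl = R , g , λ _ → refl
  ... | (l ∷ L) , R , refl with gL , lx , gR ← cut-good {l = L} (fwd refl) g
    with p , s , s′ , eq , eq′ ← first-ʳ++ L {l} {x ∷ R} {[]}
    with p′ , t , eq″ , a ← hit-head R (subst (λ z → hit z p ≡ true)
           (trans (cong reverse (sym eq)) (reverse-ʳ++ (l ∷ L) (x ∷ R))) (subst (λ z → closes z ≡ true) eq c)) =
    R ++ reverse (l ∷ L) ,
    subst Good (ʳ++-ʳ++ (x ∷ R))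
      (good-ʳ++ (good-reverse gR) (good-reverse gL) (p′ , t , p , s′ , eq″ , eq′ , a)) ,
    λ v → begin
      occ v ((x ∷ R) ++ reverse (l ∷ L))       ≡⟨ ∑-++ (x ∷ R) _ ⟩
      occ v (x ∷ R) + occ v (reverse (l ∷ L))  ≡⟨ cong (occ v (x ∷ R) +_) (∑-reverse (l ∷ L) _) ⟩
      occ v (x ∷ R) + occ v (l ∷ L)            ≡⟨ +-comm (occ v (x ∷ R)) _ ⟩
      occ v (l ∷ L) + occ v (x ∷ R)            ≡⟨ ∑-ʳ++ (l ∷ L) _ ⟨
      occ v ((l ∷ L) ʳ++ (x ∷ R))              ∎
    where open ≡-Reasoning

  rotate : ∀ {Q x} → Good Q → cyc Q ≡ true → 1 ≤ occ x Q → Rotation Q x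
  rotate {Q} {x} g c le with ∨-true c
  ... | inj₁ c₁ = rotate-closed x Q g c₁ le
  ... | inj₂ c₂ with rotate-closed x (reverse Q) (good-reverse g) c₂ (subst (1 ≤_) (sym (∑-reverse Q _)) le)
  ...   | Z , gZ , eq = Z , gZ , λ v → trans (eq v) (∑-reverse Q _)

  -- Opening `Q` at `x` makes `x` an end, and adjacent ends of different components merge.
  cyclic-apart : ∀ {S D Q rest e O x} → Min S → S ↭ D ∷ Q ∷ rest → Oriented D (e ∷ O) →
                 cyc Q ≡ true → 1 ≤ occ x Q → ¬ Adj G e x
  cyclic-apart {e = e} {O} {x} m p o c le ex with Z , gZ , eq ← rotate (good-of₂ m p) c le =
    ends-apart m p o eq gZ (e , O , x , Z , refl , refl , ex)

  module _ {S : List Path} (o : Opt S) where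

    noMoreCycles : ∀ old new {rest} → S ↭ old ++ rest →
      (∀ v → ∑[ P ∈ new ] occ v P ≡ ∑[ P ∈ old ] occ v P) → All Good new →
      length new ≤ length old → singles new ≤ singles old → cycles old < cycles new → ⊥
    noMoreCycles old new {rest} p eq g ln sg cy =
      <⇒≱ (∑-replace-< old new p (#_ ∘ cyc) cy)
        (Opt.maxCycles o (replace (Opt.cover o) p eq g) (length-replace old new p ln)
          (∑-replace-≤ old new p (#_ ∘ single) sg))

    -- The crossing chords of Ore's argument: with them the vertices of `P` form the cycle that goes
    -- from `w` to the far end of `r`, back to `u`, to the far end of `l` and back to `w`.
    chords-apart : ∀ {P rest u l w r} → S ↭ P ∷ rest → Cut P (u ∷ l) (w ∷ r) → cyc P ≡ false →
                   hit ((w ∷ r) ʳ++ (u ∷ l)) u ≡ true → ¬ hit ((u ∷ l) ʳ++ (w ∷ r)) w ≡ true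
    chords-apart {P} {rest} {u} {l} {w} {r} p c nc bu aw
      with gL , uw , gR ← cut-good c (good-of (opt⇒min o) p)
         | e , t , eq , a ← hit-head r bu =
      noMoreCycles (P ∷ []) (C ∷ []) p
        (λ v → cong (_+ 0) (trans (∑-++ (w ∷ r) _) (trans (+-comm (occ v (w ∷ r)) _) (sym (cut-∑ c _)))))
        (subst Good (ʳ++-ʳ++ (w ∷ r)) (good-ʳ++ (good-reverse gR) gL (e , t , u , l , eq , refl , a)) ∷ [])
        ≤-refl
        (≤-trans (≤-reflexive (cong (λ b → # b + 0) (single-C r))) z≤n)
        (subst₂ _<_ (cong (λ b → # b + 0) (sym nc)) (cong (λ b → # b + 0) (sym cyc-C)) (s≤s z≤n))
      where
      C : Path
      C = (w ∷ r) ++ (u ∷ l)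
      single-C : ∀ r → single ((w ∷ r) ++ (u ∷ l)) ≡ false
      single-C []      = refl
      single-C (_ ∷ _) = refl
      closes-C : ∀ l → hit ((u ∷ l) ʳ++ (w ∷ r)) w ≡ true → hit (reverse ((w ∷ r) ++ (u ∷ l))) w ≡ true
      closes-C []       h = ⊥-elim (true≢false (proj₂ (∧-true h)) (cong not (==-refl w)))
      closes-C (u′ ∷ l) h = trans (cong (λ z → hit z w) (++-ʳ++ (w ∷ r))) (trans (hit-ʳ++ l) h)
      cyc-C : cyc C ≡ true
      cyc-C = cong (_∨ closes (reverse C)) (closes-C l aw)

    -- The half at `u` is closed by the chord and becomes a cyclic component, while `D` takes the
    -- half at `w`. This is a net gain because no cyclic component is used up.
    cycle-splits : ∀ {P D rest O u l w r} → S ↭ P ∷ D ∷ rest → Oriented D O →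
                   Cut P (u ∷ l) (w ∷ r) → cyc P ≡ false → cyc D ≡ false →
                   hit ((u ∷ l) ʳ++ (w ∷ r)) u ≡ true → ¬ hit O w ≡ true
    cycle-splits {l = []} {w} {r} p d c ncP ncD au Ow =
      true≢false (proj₁ (∧-true au)) (adj-irrefl _)
    cycle-splits {P} {D} {O = O} {u} {u′ ∷ l} {w} {r} p d c ncP ncD au Ow
      with gL , uw , gR ← cut-good c (good-of (opt⇒min o) p)
         | e , t , refl , ew ← hit-inv O Ow =
      noMoreCycles (P ∷ D ∷ []) ((u ∷ u′ ∷ l) ∷ (O ʳ++ (w ∷ r)) ∷ []) p
        (λ v → begin
          occ v (u ∷ u′ ∷ l) + (occ v (O ʳ++ (w ∷ r)) + 0)
            ≡⟨ cong (λ z → occ v (u ∷ u′ ∷ l) + (z + 0)) (∑-ʳ++ O _) ⟩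
          occ v (u ∷ u′ ∷ l) + (occ v O + occ v (w ∷ r) + 0)
            ≡⟨ cong (λ z → occ v (u ∷ u′ ∷ l) + (z + occ v (w ∷ r) + 0)) (or-∑ d _) ⟩
          occ v (u ∷ u′ ∷ l) + (occ v D + occ v (w ∷ r) + 0)
            ≡⟨ shuffle (occ v (u ∷ u′ ∷ l)) (occ v D) (occ v (w ∷ r)) ⟩
          occ v (u ∷ u′ ∷ l) + occ v (w ∷ r) + (occ v D + 0)
            ≡⟨ cong (_+ (occ v D + 0)) (cut-∑ c _) ⟨
          occ v P + (occ v D + 0) ∎)
        (gL ∷ good-ʳ++ (or-good d (good-of₂ (opt⇒min o) p)) gR (hit⇒~ Ow) ∷ [])
        ≤-refl
        (≤-trans (≤-reflexive (cong (λ b → # b + 0) (single-ʳ++ t))) z≤n)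
        (subst₂ (λ a b → # a + (# b + 0) < # cyc (u ∷ u′ ∷ l) + (# cyc (O ʳ++ (w ∷ r)) + 0))
          (sym ncP) (sym ncD)
          (subst (λ a → 0 < # a + (# cyc (O ʳ++ (w ∷ r)) + 0)) (sym cyc-L) (s≤s z≤n)))
      where
      open ≡-Reasoning
      shuffle : ∀ l d r → l + (d + r + 0) ≡ l + r + (d + 0)
      shuffle = solve-∀
      cyc-L : cyc (u ∷ u′ ∷ l) ≡ true
      cyc-L = cong (_∨ closes (reverse (u ∷ u′ ∷ l))) (trans (hit-ʳ++ l) au)

-- Exchanges that replace one end

module Moves {n : ℕ} (G : Graph n) where
  open Paths G
  open Merges G
  open Exchange G

  -- The two sides of `truncated-exchange` when the first vertex of `R` becomes an end in place of
  -- that of `O`; `u` is seen by both and left out.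
  gain loss : List Path → Path → V → ℕ
  gain S R u = ∑[ v ∈ allFin n ] # (hit R v ∧ (not (u == v) ∧ (H S v ≤ᵇ 1)))
  loss S O u = ∑[ v ∈ allFin n ] # (hit O v ∧ (not (u == v) ∧ (H S v ≤ᵇ 2)))

  cut-disjoint : ∀ {P L R v} → Cut P L R → occ v P ≤ 1 → 1 ≤ occ v L → 1 ≤ occ v R → ⊥
  cut-disjoint {v = v} c le l r = 1+n≰n (≤-trans (+-mono-≤ l r) (≤-trans (≤-reflexive (sym (cut-∑ c _))) le))

  occ-here : ∀ (v : V) xs → 1 ≤ occ v (v ∷ xs)
  occ-here v xs rewrite ==-refl v = s≤s z≤n

  occ-there : ∀ (v w : V) xs → 1 ≤ occ v xs → 1 ≤ occ v (w ∷ xs)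
  occ-there v w xs le = ≤-trans le (m≤n+m _ (# (w == v)))

  ∈⇒occ : ∀ {v} {P : Path} → v ∈ P → 1 ≤ occ v P
  ∈⇒occ {v} {x ∷ P} (here refl) = occ-here v P
  ∈⇒occ {v} {x ∷ P} (there v∈)  = occ-there v x P (∈⇒occ v∈)

  hit-cut : ∀ {P u l y y′ r} → Cut P (u ∷ l) (y ∷ y′ ∷ r) → Good P → occ u P ≤ 1 →
            hit (y ∷ y′ ∷ r) u ≡ true
  hit-cut {u = u} {l} {y} {y′} {r} c g le with gL , uy , gR ← cut-good c g =
    ∧-intro (adj-complete (symm G uy)) (cong not (==-≢ {v = y′} {u} λ { refl →
      cut-disjoint c le (occ-here u l) (occ-there u y (u ∷ r) (occ-here u r)) }))

  Min-replace : ∀ {S old new rest} → Min S → S ↭ old ++ rest →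
                (∀ v → ∑[ P ∈ new ] occ v P ≡ ∑[ P ∈ old ] occ v P) → All Good new →
                length new ≤ length old → Min (new ++ rest)
  Min-replace {old = old} {new} m p eq g le = record
    { cov = replace (Min.cov m) p eq g
    ; min = λ c → ≤-trans (length-replace old new p le) (Min.min m c) }

  -- `L` is attached to the end of `D` that hits `u`, and `y` becomes an end in its place. Both
  -- halves have two vertices; if `D` has two as well, every other end keeps its neighbour on the
  -- path, and the only change is that `hit O` is traded for `hit R`.
  module Ext {S : List Path} {P D : Path} {rest : List Path} {O : Path} {u u′ : V} {l : Path} {y y′ : V} {r : Path}
             (m : Min S) (p : S ↭ P ∷ D ∷ rest) (d : Oriented D O)
             (c : Cut P (u ∷ u′ ∷ l) (y ∷ y′ ∷ r)) (Ou : hit O u ≡ true) where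

    L R : Path
    L = u ∷ u′ ∷ l
    R = y ∷ y′ ∷ r

    new : List Path
    new = (O ʳ++ L) ∷ R ∷ []

    goods : All Good new
    goods with gL , uw , gR ← cut-good c (good-of m p) =
      good-ʳ++ (or-good d (good-of₂ m p)) gL (hit⇒~ Ou) ∷ gR ∷ []

    same-vertices : ∀ v → ∑[ P ∈ new ] occ v P ≡ ∑[ P ∈ P ∷ D ∷ [] ] occ v P
    same-vertices v = begin
      occ v (O ʳ++ L) + (occ v R + 0)      ≡⟨ cong (_+ (occ v R + 0)) (∑-ʳ++ O _) ⟩
      occ v O + occ v L + (occ v R + 0)    ≡⟨ cong (λ z → z + occ v L + (occ v R + 0)) (or-∑ d _) ⟩
      occ v D + occ v L + (occ v R + 0)    ≡⟨ shuffle (occ v D) (occ v L) (occ v R) ⟩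
      occ v L + occ v R + (occ v D + 0)    ≡⟨ cong (_+ (occ v D + 0)) (cut-∑ c _) ⟨
      occ v P + (occ v D + 0)              ∎
      where
      open ≡-Reasoning
      shuffle : ∀ d l r → d + l + (r + 0) ≡ l + r + (d + 0)
      shuffle = solve-∀

    freed : Min (new ++ rest)
    freed = Min-replace m p same-vertices goods ≤-refl

    module _ (notSingle : single D ≡ false) where

      O≥2 : ∃[ o ] ∃[ o′ ] ∃[ t ] O ≡ o ∷ o′ ∷ t
      O≥2 with hit-inv O Ou
      ... | o , []     , refl , _ = ⊥-elim (true≢false (sym (or-single d)) notSingle)
      ... | o , o′ ∷ t , refl , _ = o , o′ , t , refl

      H-new : ∀ v → H (new ++ rest) v + # hit O v ≡ H S v + # hit R v
      H-new v with o , o′ , t , refl ← O≥2 = begin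
        # hit (O ʳ++ L) v + # hit (reverse (O ʳ++ L)) v + (# hit R v + # hit (reverse R) v + H rest v) + # hit O v
          ≡⟨ cong₂ (λ x y → # x + # y + (# hit R v + # hit (reverse R) v + H rest v) + # hit O v)
               (hit-ʳ++ t) (trans (cong (λ z → hit z v) (reverse-ʳ++ O L)) (hit-ʳ++ l)) ⟩
        # hit (reverse O) v + # hit (L ʳ++ R) v + (# hit R v + # hit (reverse R) v + H rest v) + # hit O v
          ≡⟨ cong (λ x → # hit (reverse O) v + # hit (L ʳ++ R) v + (# hit R v + # x + H rest v) + # hit O v)
               (hit-ʳ++ r) ⟩
        # hit (reverse O) v + # hit (L ʳ++ R) v + (# hit R v + # hit (R ʳ++ L) v + H rest v) + # hit O v
          ≡⟨ shuffle (# hit (reverse O) v) (# hit (L ʳ++ R) v) (# hit R v) (# hit (R ʳ++ L) v) (H rest v) (# hit O v) ⟩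
        # hit (L ʳ++ R) v + # hit (R ʳ++ L) v + (h₂ O v + H rest v) + # hit R v
          ≡⟨ cong₂ (λ x y → x + (y + H rest v) + # hit R v) (cut-h₂ c v) (sym (or-h₂ d v)) ⟨
        h₂ P v + (h₂ D v + H rest v) + # hit R v
          ≡⟨ cong (_+ # hit R v) (∑-↭ p (λ P → h₂ P v)) ⟨
        H S v + # hit R v ∎
        where
        open ≡-Reasoning
        shuffle : ∀ a b c d e f → a + b + (c + d + e) + f ≡ b + d + (f + a + e) + c
        shuffle = solve-∀

  -- The exchange destroys no cyclic component and creates no singleton, so the new cover competes
  -- with `S` in `Φ`.
  external-exchange : ∀ {S P D rest O u u′ l y y′ r} → Opt S → S ↭ P ∷ D ∷ rest → Oriented D O →
    Cut P (u ∷ u′ ∷ l) (y ∷ y′ ∷ r) → cyc P ≡ false → cyc D ≡ false → single D ≡ false →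
    hit O u ≡ true → gain S (y ∷ y′ ∷ r) u ≤ loss S O u
  external-exchange {S} {P} {D} {rest} {O} {u} {u′} {l} {y} {y′} {r} o p d c ncP ncD sD Ou =
    truncated-exchange (H S) (H (E.new ++ rest)) (hit O) (hit (y ∷ y′ ∷ r)) u Ou
      (hit-cut c (good-of (opt⇒min o) p) (occ-≤1 (Opt.cover o) p u))
      (E.H-new sD)
      (Opt.maxΦ o (Min.cov E.freed) (length-replace (P ∷ D ∷ []) E.new p ≤-refl)
        (∑-replace-≤ (P ∷ D ∷ []) E.new p (#_ ∘ single) singles-new)
        (∑-replace-≥ (P ∷ D ∷ []) E.new p (#_ ∘ cyc)
          (subst₂ (λ a b → # a + (# b + 0) ≤ cycles E.new) (sym ncP) (sym ncD) z≤n)))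
    where
    module E = Ext {l = l} {r = r} (opt⇒min o) p d c Ou
    singles-new : singles E.new ≤ singles (P ∷ D ∷ [])
    singles-new with e , t , refl , _ ← hit-inv O Ou =
      ≤-trans (≤-reflexive (cong (λ b → # b + 0) (single-ʳ++ t))) z≤n

  -- A Pósa rotation: the far end of `R` sees `u`, so the same component can be traversed from `y`
  -- to that end, on to `u` and through `L`. Then `y` is an end in its place.
  module Own {S : List Path} {P : Path} {rest : List Path} {u u′ : V} {l : Path} {y y′ : V} {r : Path}
             (m : Min S) (p : S ↭ P ∷ rest)
             (c : Cut P (u ∷ u′ ∷ l) (y ∷ y′ ∷ r))
             (bu : hit ((y ∷ y′ ∷ r) ʳ++ (u ∷ u′ ∷ l)) u ≡ true) where

    L R : Path
    L = u ∷ u′ ∷ l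
    R = y ∷ y′ ∷ r

    new : List Path
    new = (R ++ L) ∷ []

    goods : All Good new
    goods with gL , uw , gR ← cut-good c (good-of m p) | e , t , eq , a ← hit-head (y′ ∷ r) bu =
      subst Good (ʳ++-ʳ++ R) (good-ʳ++ (good-reverse gR) gL (e , t , u , u′ ∷ l , eq , refl , a)) ∷ []

    same-vertices : ∀ v → ∑[ P ∈ new ] occ v P ≡ ∑[ P ∈ P ∷ [] ] occ v P
    same-vertices v = cong (_+ 0) (trans (∑-++ R {L} (λ x → # (x == v))) (trans (+-comm (occ v R) (occ v L)) (sym (cut-∑ c (λ x → # (x == v))))))

    freed : Min (new ++ rest)
    freed = Min-replace m p same-vertices goods ≤-refl

    H-new : ∀ v → H (new ++ rest) v + # hit (R ʳ++ L) v ≡ H S v + # hit R v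
    H-new v = begin
      # hit R v + # hit (reverse (R ++ L)) v + H rest v + # hit (R ʳ++ L) v
        ≡⟨ cong (λ x → # hit R v + # x + H rest v + # hit (R ʳ++ L) v)
             (trans (cong (λ z → hit z v) (++-ʳ++ R)) (hit-ʳ++ l)) ⟩
      # hit R v + # hit (L ʳ++ R) v + H rest v + # hit (R ʳ++ L) v
        ≡⟨ shuffle (# hit R v) (# hit (L ʳ++ R) v) (H rest v) (# hit (R ʳ++ L) v) ⟩
      # hit (L ʳ++ R) v + # hit (R ʳ++ L) v + H rest v + # hit R v
        ≡⟨ cong (λ x → x + H rest v + # hit R v) (cut-h₂ c v) ⟨
      h₂ P v + H rest v + # hit R v
        ≡⟨ cong (_+ # hit R v) (∑-↭ p (λ P → h₂ P v)) ⟨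
      H S v + # hit R v ∎
      where
      open ≡-Reasoning
      shuffle : ∀ a b c d → a + b + c + d ≡ b + d + c + a
      shuffle = solve-∀

  internal-exchange : ∀ {S P rest u u′ l y y′ r} → Opt S → S ↭ P ∷ rest →
    Cut P (u ∷ u′ ∷ l) (y ∷ y′ ∷ r) → cyc P ≡ false →
    hit ((y ∷ y′ ∷ r) ʳ++ (u ∷ u′ ∷ l)) u ≡ true →
    gain S (y ∷ y′ ∷ r) u ≤ loss S ((y ∷ y′ ∷ r) ʳ++ (u ∷ u′ ∷ l)) u
  internal-exchange {S} {P} {rest} {u} {u′} {l} {y} {y′} {r} o p c ncP bu =
    truncated-exchange (H S) (H (E.new ++ rest)) (hit ((y ∷ y′ ∷ r) ʳ++ (u ∷ u′ ∷ l))) (hit (y ∷ y′ ∷ r)) u bu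
      (hit-cut c (good-of (opt⇒min o) p) (occ-≤1 (Opt.cover o) p u))
      E.H-new
      (Opt.maxΦ o (Min.cov E.freed) (length-replace (P ∷ []) E.new p ≤-refl)
        (∑-replace-≤ (P ∷ []) E.new p (#_ ∘ single) z≤n)
        (∑-replace-≥ (P ∷ []) E.new p (#_ ∘ cyc)
          (subst (λ a → # a + 0 ≤ cycles E.new) (sym ncP) z≤n)))
    where
    module E = Own {l = l} {r = r} (opt⇒min o) p c bu

  -- The exchange makes `y` an end of a partition that still has the minimum number of components,
  -- so `cyclic-apart` applies to `y`.
  external-cyclic : ∀ {S P D Q rest O u u′ l y y′ r x} → Min S → S ↭ P ∷ D ∷ Q ∷ rest → Oriented D O →
    Cut P (u ∷ u′ ∷ l) (y ∷ y′ ∷ r) → hit O u ≡ true → cyc Q ≡ true → 1 ≤ occ x Q → ¬ Adj G y x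
  external-cyclic {O = O} {u} {u′} {l} {y} {y′} {r} m p d c Ou cQ x∈ =
    cyclic-apart {O = y′ ∷ r} (E.freed)
      (Perm.trans (swap _ _ ↭-refl) (prep _ (swap _ _ ↭-refl))) (fwd refl) cQ x∈
    where module E = Ext {l = l} {r = r} m p d c Ou

  internal-cyclic : ∀ {S P Q rest u u′ l y y′ r x} → Min S → S ↭ P ∷ Q ∷ rest →
    Cut P (u ∷ u′ ∷ l) (y ∷ y′ ∷ r) → hit ((y ∷ y′ ∷ r) ʳ++ (u ∷ u′ ∷ l)) u ≡ true →
    cyc Q ≡ true → 1 ≤ occ x Q → ¬ Adj G y x
  internal-cyclic {u = u} {u′} {l} {y} {y′} {r} m p c bu cQ x∈ =
    cyclic-apart {O = y′ ∷ r ++ (u ∷ u′ ∷ l)} E.freed ↭-refl (fwd refl) cQ x∈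
    where module E = Own {l = l} {r = r} m p c bu

-- Components of a cover and sums over them

∈⇒↭ : ∀ {A : Set} {x : A} {xs} → x ∈ xs → ∃[ ys ] (xs ↭ x ∷ ys)
∈⇒↭ x∈ with as , bs , refl ← ∈-∃++ x∈ = as ++ bs , shift _ as bs

↭⇒∈ : ∀ {A : Set} {x : A} {xs ys} → xs ↭ x ∷ ys → x ∈ xs
↭⇒∈ p = ∈-resp-↭ (↭-sym p) (here refl)

∑-find : ∀ {A : Set} (xs : List A) (f : A → ℕ) → 1 ≤ ∑ xs f → ∃[ x ] (x ∈ xs × 1 ≤ f x)
∑-find (x ∷ xs) f le with f x in eq
... | suc k = x , here refl , ≤-trans (s≤s z≤n) (≤-reflexive (sym eq))
... | zero with y , y∈ , fy ← ∑-find xs f le = y , there y∈ , fy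

∑-cong-∈ : ∀ {A : Set} (xs : List A) {f g : A → ℕ} → (∀ {x} → x ∈ xs → f x ≡ g x) → ∑ xs f ≡ ∑ xs g
∑-cong-∈ []       eq = refl
∑-cong-∈ (x ∷ xs) eq = cong₂ _+_ (eq (here refl)) (∑-cong-∈ xs (eq ∘ there))

∑-mono-∈ : ∀ {A : Set} (xs : List A) {f g : A → ℕ} → (∀ {x} → x ∈ xs → f x ≤ g x) → ∑ xs f ≤ ∑ xs g
∑-mono-∈ []       le = z≤n
∑-mono-∈ (x ∷ xs) le = +-mono-≤ (le (here refl)) (∑-mono-∈ xs (le ∘ there))

∑-filter : ∀ {A : Set} {P : A → Set} (P? : ∀ x → Dec (P x)) xs →
           length (filter P? xs) ≡ ∑[ x ∈ xs ] # does (P? x)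
∑-filter P? []       = refl
∑-filter P? (x ∷ xs) with does (P? x)
... | true  = cong suc (∑-filter P? xs)
... | false = ∑-filter P? xs

-- For the predicate `Exposed` below: it speaks of arbitrary sequences of exchanges and comes
-- without a decision procedure, but counting needs one. As the goal there is absurdity, decisions
-- may be assumed.
¬¬-all-dec : ∀ {n} (B : Fin n → Set) → ¬ ¬ (∀ v → Dec (B v))
¬¬-all-dec {zero}  B k = k λ ()
¬¬-all-dec {suc n} B k = ¬¬-all-dec (B ∘ suc) λ rest →
  let decide : Dec (B zero) → ⊥
      decide d = k λ { zero → d ; (suc v) → rest v }
  in decide (no λ b → decide (yes b))

module Covers {n : ℕ} (G : Graph n) where
  open Paths G
  open Merges G
  open Exchange G
  open Moves G

  ∑-vertices : ∀ {S} → Cover S → (g : V → ℕ) → ∑[ P ∈ S ] ∑ P g ≡ ∑ (allFin n) g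
  ∑-vertices {S} c g = begin
    ∑[ P ∈ S ] ∑ P g
      ≡⟨ ∑-cong S (λ P → ∑-occ P g) ⟩
    ∑[ P ∈ S ] ∑[ v ∈ allFin n ] (occ v P * g v)
      ≡⟨ ∑-comm S (allFin n) (λ P v → occ v P * g v) ⟩
    ∑[ v ∈ allFin n ] ∑[ P ∈ S ] (occ v P * g v)
      ≡⟨ ∑-cong (allFin n) (λ v → ∑-*ʳ S (g v) (occ v)) ⟩
    ∑[ v ∈ allFin n ] (∑[ P ∈ S ] occ v P * g v)
      ≡⟨ ∑-cong (allFin n) (λ v → trans (cong (_* g v) (once c v)) (*-identityˡ (g v))) ⟩
    ∑ (allFin n) g ∎
    where open ≡-Reasoning

  component : ∀ {S} → Cover S → ∀ v → ∃[ P ] (P ∈ S × 1 ≤ occ v P)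
  component {S} c v = ∑-find S (occ v) (≤-reflexive (sym (once c v)))

  same-component : ∀ {S P Q} → Cover S → ∀ {v} → P ∈ S → Q ∈ S → 1 ≤ occ v P → 1 ≤ occ v Q → P ≡ Q
  same-component {S} {P} {Q} c {v} P∈ Q∈ vP vQ with rest , p ← ∈⇒↭ P∈ with ∈-resp-↭ p Q∈
  ... | here eq  = sym eq
  ... | there Q∈rest with rest′ , q ← ∈⇒↭ Q∈rest = ⊥-elim (1+n≰n (begin
    2                                ≤⟨ +-mono-≤ vP (≤-trans vQ (∑-∈-≤ q (occ v))) ⟩
    occ v P + ∑ rest (occ v)         ≡⟨ ∑-↭ p (occ v) ⟨
    ∑ S (occ v)                      ≡⟨ once c v ⟩
    1                                ∎))
    where open ≤-Reasoning

  unique-in : ∀ {S P} → Cover S → P ∈ S → ∀ v → occ v P ≤ 1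
  unique-in c P∈ v with rest , p ← ∈⇒↭ P∈ = occ-≤1 c p v

-- Excluding singletons

module NoSingles {n : ℕ} (G : Graph n) (reg : ∀ v → ∑[ w ∈ allFin n ] # Paths.adj G v w ≡ 6) where
  open Paths G
  open Merges G
  open Exchange G
  open Moves G
  open Covers G

  -- The part of optimality that survives the exchanges of singletons below; they may change
  -- `cycles` and `Φ`.
  record FewSingles (S : List Path) : Set where
    field
      minimum : Min S
      fewest  : ∀ {S′} → Cover S′ → length S′ ≤ length S → singles S ≤ singles S′

  open FewSingles

  FewSingles-replace : ∀ {S} old new {rest} → FewSingles S → S ↭ old ++ rest →
    (∀ v → ∑[ P ∈ new ] occ v P ≡ ∑[ P ∈ old ] occ v P) → All Good new →
    length new ≤ length old → singles new ≤ singles old → FewSingles (new ++ rest)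
  FewSingles-replace old new f p eq g le sle = record
    { minimum = Min-replace (minimum f) p eq g le
    ; fewest  = λ c le′ → ≤-trans (∑-replace-≤ old new p (#_ ∘ single) sle)
        (fewest f c (≤-trans le′ (length-replace old new p le))) }

  fewer-singles-⊥ : ∀ {S} old new {rest} → FewSingles S → S ↭ old ++ rest →
    (∀ v → ∑[ P ∈ new ] occ v P ≡ ∑[ P ∈ old ] occ v P) → All Good new →
    length new ≤ length old → singles new < singles old → ⊥
  fewer-singles-⊥ old new f p eq g le lt =
    <⇒≱ (∑-replace-> old new p (#_ ∘ single) lt)
      (fewest f (replace (Min.cov (minimum f)) p eq g) (length-replace old new p le))

  -- Otherwise attaching half of the component of x to b gets rid of the singleton.
  singleton-neighbour : ∀ {S b P rest x} → FewSingles S → S ↭ (b ∷ []) ∷ P ∷ rest → 1 ≤ occ x P →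
                        Adj G b x → ∃[ l ] ∃[ r ] (P ≡ l ∷ x ∷ r ∷ [])
  singleton-neighbour {b = b} {P} {x = x} f p x∈ bx with occ-split x P x∈ | good-of₂ (minimum f) p
  ... | [] , R , refl | g =
    ⊥-elim (ends-apart (minimum f) p (fwd refl) (λ _ → refl) g (b , [] , x , R , refl , refl , bx))
  ... | L@(_ ∷ _) , [] , refl | g =
    ⊥-elim (ends-apart (minimum f) p (fwd refl)
      (λ v → trans (+-comm (# (x == v)) (occ v L)) (trans (cong (occ v L +_) (sym (+-identityʳ _))) (sym (∑-ʳ++ L _))))
      (subst Good (reverse-ʳ++ L (x ∷ [])) (good-reverse g)) (b , [] , x , L , refl , refl , bx))
  ... | l ∷ [] , r ∷ [] , refl | g = l , r , refl
  ... | l ∷ L , r ∷ r′ ∷ R , refl | g with gL , _ , gR ← cut-good {l = l ∷ L} (fwd refl) g =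
    ⊥-elim (fewer-singles-⊥ (_ ∷ _ ∷ []) ((b ∷ x ∷ l ∷ L) ∷ (r ∷ r′ ∷ R) ∷ []) f p
      (λ v → trans (shuffle (# (b == v)) (occ v (x ∷ l ∷ L)) (occ v (r ∷ r′ ∷ R)))
                   (cong (λ z → # (b == v) + 0 + (z + 0)) (sym (∑-ʳ++ (x ∷ l ∷ L) _))))
      (good (bx ∷ good-linked gL) ∷ gR ∷ []) ≤-refl (s≤s z≤n))
    where
    shuffle : ∀ a b c → a + b + (c + 0) ≡ a + 0 + (b + c + 0)
    shuffle = solve-∀
  ... | l ∷ l′ ∷ L , r ∷ [] , refl | g with gL , _ , gR ← cut-good {l = l′ ∷ L} (fwd refl) g =
    ⊥-elim (fewer-singles-⊥ (_ ∷ _ ∷ []) ((b ∷ x ∷ r ∷ []) ∷ (l ∷ l′ ∷ L) ∷ []) f p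
      (λ v → trans (shuffle (# (b == v)) (occ v (x ∷ r ∷ [])) (occ v (l ∷ l′ ∷ L)))
                   (cong (λ z → # (b == v) + 0 + (z + 0)) (sym (∑-ʳ++ (l ∷ l′ ∷ L) _))))
      (good (bx ∷ good-linked gR) ∷ gL ∷ []) ≤-refl (s≤s z≤n))
    where
    shuffle : ∀ a b c → a + b + (c + 0) ≡ a + 0 + (c + b + 0)
    shuffle = solve-∀

  data Reach (S : List Path) : List Path → Set where
    stay  : Reach S S
    stepˡ : ∀ {S′ b l x r rest} → Reach S S′ → S′ ↭ (b ∷ []) ∷ (l ∷ x ∷ r ∷ []) ∷ rest → Adj G b x →
            Reach S ((b ∷ x ∷ r ∷ []) ∷ (l ∷ []) ∷ rest)
    stepʳ : ∀ {S′ b l x r rest} → Reach S S′ → S′ ↭ (b ∷ []) ∷ (l ∷ x ∷ r ∷ []) ∷ rest → Adj G b x →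
            Reach S ((l ∷ x ∷ b ∷ []) ∷ (r ∷ []) ∷ rest)

  reach-few : ∀ {S S′} → FewSingles S → Reach S S′ → FewSingles S′
  reach-few f stay = f
  reach-few f (stepˡ {b = b} {l} {x} {r} s p bx) with f′ ← reach-few f s
    with good (lx ∷ xr ∷ [-]) ← good-of₂ (minimum f′) p =
    FewSingles-replace (_ ∷ _ ∷ []) (_ ∷ _ ∷ []) f′ p
      (λ v → shuffle (# (b == v)) (# (l == v)) (# (x == v)) (# (r == v)))
      (good (bx ∷ xr ∷ [-]) ∷ good [-] ∷ []) ≤-refl ≤-refl
    where
    shuffle : ∀ b l x r → b + (x + (r + 0)) + (l + 0 + 0) ≡ b + 0 + (l + (x + (r + 0)) + 0)
    shuffle = solve-∀
  reach-few f (stepʳ {b = b} {l} {x} {r} s p bx) with f′ ← reach-few f s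
    with good (lx ∷ xr ∷ [-]) ← good-of₂ (minimum f′) p =
    FewSingles-replace (_ ∷ _ ∷ []) (_ ∷ _ ∷ []) f′ p
      (λ v → shuffle (# (b == v)) (# (l == v)) (# (x == v)) (# (r == v)))
      (good (lx ∷ symm G bx ∷ [-]) ∷ good [-] ∷ []) ≤-refl ≤-refl
    where
    shuffle : ∀ b l x r → l + (x + (b + 0)) + (r + 0 + 0) ≡ b + 0 + (l + (x + (r + 0)) + 0)
    shuffle = solve-∀

  module _ {S : List Path} (f : FewSingles S) where

    private
      cv : Cover S
      cv = Min.cov (minimum f)

    -- An exposed vertex sees only centres, and every centre has two exposed
    -- neighbours of its own, so 6-regularity leaves no room for a singleton.
    Exposed : V → Set
    Exposed v = ∃[ S′ ] (Reach S S′ × (v ∷ []) ∈ S′)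

    Centre : V → Set
    Centre x = ∃[ l ] ∃[ r ] ((l ∷ x ∷ r ∷ []) ∈ S × Exposed l × Exposed r)

    both-exposed : ∀ {S′ b l x r rest} → Reach S S′ → S′ ↭ (b ∷ []) ∷ (l ∷ x ∷ r ∷ []) ∷ rest →
                   Adj G b x → Exposed l × Exposed r
    both-exposed s p bx = (_ , stepˡ s p bx , there (here refl)) , (_ , stepʳ s p bx , there (here refl))

    -- A step keeps the middle vertex of the triple it alters. Tracing it back to the first step
    -- that used it leads to a triple of `S`, both sides of which that step can expose.
    triples : ∀ {S′} → Reach S S′ → ∀ {l x r} → (l ∷ x ∷ r ∷ []) ∈ S′ →
              ((l ∷ x ∷ r ∷ []) ∈ S) ⊎ Centre x
    centre : ∀ {S′ b l x r rest} → Reach S S′ → S′ ↭ (b ∷ []) ∷ (l ∷ x ∷ r ∷ []) ∷ rest →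
             Adj G b x → Centre x
    triples stay t∈ = inj₁ t∈
    triples (stepˡ s p bx) (here refl)           = inj₂ (centre s p bx)
    triples (stepˡ s p bx) (there (there t∈))    = triples s (∈-resp-↭ (↭-sym p) (there (there t∈)))
    triples (stepʳ s p bx) (here refl)           = inj₂ (centre s p bx)
    triples (stepʳ s p bx) (there (there t∈))    = triples s (∈-resp-↭ (↭-sym p) (there (there t∈)))
    centre s p bx with triples s (∈-resp-↭ (↭-sym p) (there (here refl)))
    ... | inj₁ t∈ = let el , er = both-exposed s p bx in _ , _ , t∈ , el , er
    ... | inj₂ c  = c

    exposed-neighbour : ∀ {v x} → Exposed v → Adj G v x → Centre x
    exposed-neighbour {v} {x} (S′ , s , v∈) vx
      with f′ ← reach-few f s
      with rest , p ← ∈⇒↭ v∈ | P , P∈ , x∈ ← component (Min.cov (minimum f′)) x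
      with ∈-resp-↭ p P∈
    ... | here refl with x ≟ v
    ...   | yes refl = ⊥-elim (irrefl G refl vx)
    ...   | no x≢v   = ⊥-elim (<⇒≱ x∈ (≤-reflexive (cong (λ b → # b + 0) (==-≢ (x≢v ∘ sym)))))
    exposed-neighbour {v} {x} (S′ , s , v∈) vx
        | there P∈′ with rest′ , q ← ∈⇒↭ P∈′
      with p′ ← Perm.trans p (prep _ q)
      with l , r , refl ← singleton-neighbour f′ p′ x∈ vx = centre s p′ vx

    module _ (dec : ∀ v → Dec (Exposed v)) where

      private
        f₀ c g : V → ℕ
        f₀ v = # does (dec v)
        c  x = ∑[ v ∈ allFin n ] (f₀ v * # adj v x)
        g  x = 1 ⊓ c x

        f₀-yes : ∀ {v} → Exposed v → f₀ v ≡ 1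
        f₀-yes {v} e with dec v
        ... | yes _ = refl
        ... | no ¬e = ⊥-elim (¬e e)

        g-centre : ∀ x → 1 ≤ g x → Centre x
        g-centre x le with v , _ , le′ ← ∑-find (allFin n) (λ v → f₀ v * # adj v x) (≤-trans le (m⊓n≤n 1 (c x)))
          with dec v | adj v x in eq
        ... | yes e | true = exposed-neighbour e (adj-sound eq)

        c≤6 : ∀ x → c x ≤ 6
        c≤6 x = begin
          ∑[ v ∈ allFin n ] (f₀ v * # adj v x)
            ≤⟨ ∑-mono (allFin n) (λ v → *-monoˡ-≤ (# adj v x) (#≤1 (does (dec v)))) ⟩
          ∑[ v ∈ allFin n ] (1 * # adj v x)
            ≡⟨ ∑-cong (allFin n) (λ v → trans (*-identityˡ _) (cong #_ (adj-sym v x))) ⟩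
          ∑[ v ∈ allFin n ] # adj x v
            ≡⟨ reg x ⟩
          6 ∎
          where open ≤-Reasoning

        c≤6g : ∀ x → c x ≤ 6 * g x
        c≤6g x with c x | c≤6 x
        ... | zero  | _  = z≤n
        ... | suc _ | le = le

        -- The edges from exposed vertices are counted at both ends: exactly six at each exposed
        -- vertex, at most six at each vertex that is seen by one.
        exposed≤centres : ∑ (allFin n) f₀ ≤ ∑ (allFin n) g
        exposed≤centres = *-cancelˡ-≤ 6 (begin
          6 * ∑ (allFin n) f₀
            ≡⟨ ∑-* (allFin n) 6 f₀ ⟨
          ∑[ v ∈ allFin n ] (6 * f₀ v)
            ≡⟨ ∑-cong (allFin n) (λ v → trans (*-comm 6 (f₀ v)) (trans (cong (f₀ v *_) (sym (reg v)))
                 (sym (∑-* (allFin n) (f₀ v) (λ x → # adj v x))))) ⟩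
          ∑[ v ∈ allFin n ] ∑[ x ∈ allFin n ] (f₀ v * # adj v x)
            ≡⟨ ∑-comm (allFin n) (allFin n) (λ v x → f₀ v * # adj v x) ⟩
          ∑[ x ∈ allFin n ] c x
            ≤⟨ ∑-mono (allFin n) c≤6g ⟩
          ∑[ x ∈ allFin n ] (6 * g x)
            ≡⟨ ∑-* (allFin n) 6 g ⟩
          6 * ∑ (allFin n) g ∎)
          where open ≤-Reasoning

        zero-or : ∀ m → (m ≡ 0) ⊎ (1 ≤ m)
        zero-or zero    = inj₁ refl
        zero-or (suc m) = inj₂ (s≤s z≤n)

        -- A centre is the middle of a triple of `S`, and `y` lies in no other component than this
        -- one.
        g-side : ∀ {l x r y} → (l ∷ x ∷ r ∷ []) ∈ S → y ≢ x → y ∈ (l ∷ x ∷ r ∷ []) → g y ≡ 0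
        g-side {y = y} t∈ y≢x y∈ with zero-or (g y)
        ... | inj₁ eq = eq
        ... | inj₂ le with l′ , r′ , t′∈ , _ ← g-centre y le
          with refl ← same-component cv t∈ t′∈ (∈⇒occ y∈) (∈⇒occ {y} {l′ ∷ y ∷ r′ ∷ []} (there (here refl))) =
          ⊥-elim (y≢x refl)

        -- A component with a vertex seen by an exposed one is a triple whose two sides are exposed,
        -- and only its middle is seen. A singleton is itself exposed and not seen.
        per-component : ∀ {P} → P ∈ S → 2 * ∑ P g + # single P ≤ ∑ P f₀
        per-component {P} P∈ with zero-or (∑ P g)
        per-component {[]} P∈ | inj₁ eq = z≤n
        per-component {v ∷ []} P∈ | inj₁ eq = begin
          2 * (g v + 0) + 1 ≡⟨ cong (λ z → 2 * z + 1) eq ⟩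
          1                 ≡⟨ f₀-yes (S , stay , P∈) ⟨
          f₀ v              ≡⟨ +-identityʳ (f₀ v) ⟨
          f₀ v + 0          ∎
          where open ≤-Reasoning
        per-component {v ∷ w ∷ P} P∈ | inj₁ eq rewrite eq = z≤n
        per-component {P} P∈ | inj₂ le with x , x∈ , gx ← ∑-find P g le
          with l , r , t∈ , el , er ← g-centre x gx
          with refl ← same-component cv P∈ t∈ (∈⇒occ x∈) (∈⇒occ {x} {l ∷ x ∷ r ∷ []} (there (here refl))) =
          (begin
            2 * (g l + (g x + (g r + 0))) + 0
              ≡⟨ cong₂ (λ a b → 2 * (a + (g x + (b + 0))) + 0)
                   (g-side t∈ l≢x (here refl)) (g-side t∈ r≢x (there (there (here refl)))) ⟩
            2 * (g x + 0) + 0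
              ≡⟨ trans (+-identityʳ _) (cong (2 *_) (+-identityʳ (g x))) ⟩
            2 * g x
              ≤⟨ *-monoʳ-≤ 2 (m⊓n≤m 1 (c x)) ⟩
            2
              ≤⟨ s≤s (m≤n+m 1 (f₀ x)) ⟩
            1 + (f₀ x + 1)
              ≡⟨ cong₂ (λ a b → a + (f₀ x + b)) (sym (f₀-yes el)) (sym (trans (+-identityʳ _) (f₀-yes er))) ⟩
            f₀ l + (f₀ x + (f₀ r + 0)) ∎)
          where
          open ≤-Reasoning
          le1 : occ x (l ∷ x ∷ r ∷ []) ≤ 1
          le1 = unique-in cv t∈ x
          l≢x : l ≢ x
          l≢x refl = 1+n≰n (≤-trans (+-mono-≤ (≤-reflexive (sym (cong #_ (==-refl x)))) (occ-here x (r ∷ []))) le1)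
          r≢x : r ≢ x
          r≢x refl = 1+n≰n (≤-trans (≤-trans (+-mono-≤ (≤-reflexive (sym (cong #_ (==-refl x)))) (occ-here x []))
                       (m≤n+m _ (# (l == x)))) le1)

      few-singles : singles S ≡ 0
      few-singles with zero-or (singles S)
      ... | inj₁ eq = eq
      ... | inj₂ le = ⊥-elim (1+n≰n (begin
        1 + ∑ (allFin n) g
          ≤⟨ +-mono-≤ le (m≤m+n _ (∑ (allFin n) g + 0)) ⟩
        singles S + 2 * ∑ (allFin n) g
          ≡⟨ cong (λ b → singles S + 2 * b) (∑-vertices cv g) ⟨
        singles S + 2 * ∑[ P ∈ S ] ∑ P g
          ≡⟨ trans (+-comm (singles S) _) (cong (_+ singles S) (sym (∑-* S 2 (λ P → ∑ P g)))) ⟩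
        ∑[ P ∈ S ] (2 * ∑ P g) + singles S
          ≡⟨ ∑-+ S (λ P → 2 * ∑ P g) (#_ ∘ single) ⟨
        ∑[ P ∈ S ] (2 * ∑ P g + # single P)
          ≤⟨ ∑-mono-∈ S per-component ⟩
        ∑[ P ∈ S ] ∑ P f₀
          ≡⟨ ∑-vertices cv f₀ ⟩
        ∑ (allFin n) f₀
          ≤⟨ exposed≤centres ⟩
        ∑ (allFin n) g ∎))
        where
        open ≤-Reasoning

  no-singles : ∀ {S} → FewSingles S → singles S ≡ 0
  no-singles {S} f with singles S in eq
  ... | zero  = refl
  ... | suc k = ⊥-elim (¬¬-all-dec (Exposed f) λ dec → case trans (sym eq) (few-singles f dec) of λ ())

-- The finite check behind the balance along a path

pos : ℕ → Bool
pos zero    = false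
pos (suc _) = true

-- The type (p , κ , a , b) of a vertex of a component P: it is hit by p ends of
-- other components that are not cyclic and by κ ends of cyclic ones, and a and b
-- tell whether it is hit by the first and by the last vertex of P.
Type : Set
Type = ℕ × ℕ × Bool × Bool

hitsN hits : Type → ℕ
hitsN (p , κ , a , b) = p + (# a + # b)
hits  t@(p , κ , a , b) = hitsN t + κ

-- In order: crossing chords (`chords-apart`); an outer hit next to a crossing chord (`chord-apart`,
-- on both sides); two neighbours with outer hits, which can only come from one and the same end
-- (`cross-apart`, `insert-apart`); a chord that closes one half while a non-cyclic component takes
-- the other (`cycle-splits`, on both sides). The last exchange gains nothing from a cyclic
-- component, hence `p` without `κ`.
compatible : Type → Type → Bool
compatible (p , κ , a , b) (p′ , κ′ , a′ , b′) =
  not (b ∧ a′) ∧ (not (pos (p + κ) ∧ a′) ∧ (not (b ∧ pos (p′ + κ′)) ∧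
  ((not (pos (p + κ) ∧ pos (p′ + κ′)) ∨ ((p ≡ᵇ p′) ∧ ((κ ≡ᵇ κ′) ∧ (p + κ ≡ᵇ 1)))) ∧
  (not (a ∧ pos p′) ∧ not (b′ ∧ pos p)))))

-- A vertex is worth 36 and a component needs 252 = 7 * 36.  A vertex pays 24 to
-- each of the h ends of non-cyclic components that hit it and 18 to each of the κ
-- ends of cyclic ones.  If it has at least two hits it pays 6 along each of its
-- other edges off the path, and if it has at most two, 8 for every one of the h
-- ends, to be shared by the vertices that can replace this end.
costOf : ℕ → ℕ → ℕ
costOf h κ = 24 * h + 18 * κ + (# (2 ≤ᵇ h + κ) * (6 * (4 ∸ (h + κ))) + # (h + κ ≤ᵇ 2) * (8 * h))

cost : Type → ℕ
cost t@(_ , κ , _ , _) = costOf (hitsN t) κ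

gainʳ gainˡ : Type → ℕ
gainʳ (p , κ , a , b) = 12 ⊓ (4 * (p + 2 * # b))
gainˡ (p , κ , a , b) = 12 ⊓ (4 * (p + 2 * # a))

edgeGainʳ edgeGainˡ : Type → Type → ℕ
edgeGainʳ t t′ = # (hits t′ ≡ᵇ 0) * gainʳ t
edgeGainˡ t t′ = # (hits t ≡ᵇ 0) * gainˡ t′

-- The potential: an upper bound, shifted by 36 to be nonnegative, for the sum
-- of cost ∸ 36 minus the gains over a prefix of P ending with the given type.
β : Type → ℕ
β (0 , 0 , false , false) = 12
β (0 , 1 , false , false) = 12
β (0 , 0 , false , true)  = 52
β (0 , 1 , false , true)  = 56
β t                       = cost t ∸ (24 + gainˡ t)

-- Values up to 4 suffice because two of the six edges at an inner vertex belong to its path.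
∀<5 : (ℕ → Bool) → Bool
∀<5 f = f 0 ∧ (f 1 ∧ (f 2 ∧ (f 3 ∧ f 4)))

∀B : (Bool → Bool) → Bool
∀B f = f true ∧ f false

∀T : (Type → Bool) → Bool
∀T f = ∀<5 λ p → ∀<5 λ κ → ∀B λ a → ∀B λ b → f (p , κ , a , b)

∀<5-sound : ∀ f → ∀<5 f ≡ true → ∀ {m} → m ≤ 4 → f m ≡ true
∀<5-sound f e le with f 0 in e0 | f 1 in e1 | f 2 in e2 | f 3 in e3 | f 4 in e4
∀<5-sound f e {0} le | true | true | true | true | true = e0
∀<5-sound f e {1} le | true | true | true | true | true = e1
∀<5-sound f e {2} le | true | true | true | true | true = e2
∀<5-sound f e {3} le | true | true | true | true | true = e3
∀<5-sound f e {4} le | true | true | true | true | true = e4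
∀<5-sound f e {suc (suc (suc (suc (suc m))))} (s≤s (s≤s (s≤s (s≤s ())))) | true | true | true | true | true

∀B-sound : ∀ f → ∀B f ≡ true → ∀ b → f b ≡ true
∀B-sound f e true  = proj₁ (∧-true e)
∀B-sound f e false = proj₂ (∧-true {f true} e)

∀T-sound : ∀ f → ∀T f ≡ true → ∀ t → hits t ≤ 4 → f t ≡ true
∀T-sound f e (p , κ , a , b) le =
  ∀B-sound (λ b → f (p , κ , a , b)) (∀B-sound (λ a → ∀B λ b → f (p , κ , a , b))
    (∀<5-sound (λ κ → ∀B λ a → ∀B λ b → f (p , κ , a , b))
      (∀<5-sound (λ p → ∀<5 λ κ → ∀B λ a → ∀B λ b → f (p , κ , a , b)) e p≤4) κ≤4) a) b
  where
  p≤4 : p ≤ 4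
  p≤4 = ≤-trans (m≤m+n p (# a + # b)) (≤-trans (m≤m+n _ κ) le)
  κ≤4 : κ ≤ 4
  κ≤4 = ≤-trans (m≤n+m κ _) le

_⇒ᵇ_ : Bool → Bool → Bool
true  ⇒ᵇ b = b
false ⇒ᵇ b = true

infixr 3 _⇒ᵇ_

⇒ᵇ-elim : ∀ {a b} → (a ⇒ᵇ b) ≡ true → a ≡ true → b ≡ true
⇒ᵇ-elim {true} e refl = e

≤ᵇ-sound : ∀ m k → (m ≤ᵇ k) ≡ true → m ≤ k
≤ᵇ-sound m k e = ≤ᵇ⇒≤ m k (subst Data.Bool.T (sym e) _)

≤ᵇ-complete : ∀ {m k} → m ≤ k → (m ≤ᵇ k) ≡ true
≤ᵇ-complete {m} {k} le with m ≤ᵇ k | ≤⇒≤ᵇ le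
... | true | _ = refl

valid : Type → Bool
valid t = hits t ≤ᵇ 4

noType : Type
noType = 0 , 0 , false , false

final-check : ∀T (λ t → valid t ⇒ᵇ β t ≤ᵇ 60) ≡ true
final-check = refl

step-check : ∀T (λ t → valid t ⇒ᵇ ∀T (λ t′ → valid t′ ⇒ᵇ compatible t t′ ⇒ᵇ
               cost t′ + β t ≤ᵇ 36 + β t′ + (edgeGainʳ t t′ + edgeGainˡ t t′))) ≡ true
step-check = refl

-- For the second vertex of a path: its predecessor is an end and unhit, and the edge between them
-- is on the path, so `a` is false.
start-check : ∀T (λ { t@(_ , _ , a , _) → valid t ⇒ᵇ compatible noType t ⇒ᵇ not a ⇒ᵇ cost t ≤ᵇ 36 + β t }) ≡ true
start-check = refl

final-bound : ∀ t → hits t ≤ 4 → β t ≤ 60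
final-bound t le = ≤ᵇ-sound (β t) 60
  (⇒ᵇ-elim (∀T-sound (λ t → valid t ⇒ᵇ β t ≤ᵇ 60) final-check t le) (≤ᵇ-complete le))

step-bound : ∀ t t′ → hits t ≤ 4 → hits t′ ≤ 4 → compatible t t′ ≡ true →
             cost t′ + β t ≤ 36 + β t′ + (edgeGainʳ t t′ + edgeGainˡ t t′)
step-bound t t′ le le′ c = ≤ᵇ-sound (cost t′ + β t) (36 + β t′ + (edgeGainʳ t t′ + edgeGainˡ t t′))
  (⇒ᵇ-elim (⇒ᵇ-elim
    (∀T-sound (λ t′ → valid t′ ⇒ᵇ compatible t t′ ⇒ᵇ cost t′ + β t ≤ᵇ 36 + β t′ + (edgeGainʳ t t′ + edgeGainˡ t t′))
      (⇒ᵇ-elim (∀T-sound (λ t → valid t ⇒ᵇ ∀T (λ t′ → valid t′ ⇒ᵇ compatible t t′ ⇒ᵇ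
          cost t′ + β t ≤ᵇ 36 + β t′ + (edgeGainʳ t t′ + edgeGainˡ t t′))) step-check t le) (≤ᵇ-complete le))
      t′ le′) (≤ᵇ-complete le′)) c)

start-bound : ∀ p κ b → hits (p , κ , false , b) ≤ 4 → compatible noType (p , κ , false , b) ≡ true →
              cost (p , κ , false , b) ≤ 36 + β (p , κ , false , b)
start-bound p κ b le c = ≤ᵇ-sound (cost (p , κ , false , b)) (36 + β (p , κ , false , b))
  (⇒ᵇ-elim (⇒ᵇ-elim (∀T-sound (λ { t@(_ , _ , a , _) → valid t ⇒ᵇ compatible noType t ⇒ᵇ not a ⇒ᵇ cost t ≤ᵇ 36 + β t })
    start-check (p , κ , false , b) le) (≤ᵇ-complete le)) c)

-- Adding up the check over the cuts of a path

module _ {A : Set} where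

  cutsFrom : List A → List A → List (List A × List A)
  cutsFrom L []      = []
  cutsFrom L (w ∷ R) = (L , w ∷ R) ∷ cutsFrom (w ∷ L) R

  cuts : List A → List (List A × List A)
  cuts []      = []
  cuts (p ∷ P) = cutsFrom (p ∷ []) P

  more : List A → Bool
  more (_ ∷ _ ∷ _) = true
  more _           = false

module PathBound {V : Set} (τ : V → Type) where

  -- The factors `more` ask for two vertices in the half that is to begin with the new end, since
  -- this end must keep a neighbour on its path.
  γ : List V × List V → ℕ
  γ (L@(u ∷ _) , R@(w ∷ _)) = # more R * edgeGainʳ (τ u) (τ w) + # more L * edgeGainˡ (τ u) (τ w)
  γ _ = 0

  module _ (P : List V)
    (compat   : ∀ u l w r → P ≡ (u ∷ l) ʳ++ (w ∷ r) → compatible (τ u) (τ w) ≡ true)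
    (interior : ∀ u u′ l w r → P ≡ (u ∷ u′ ∷ l) ʳ++ (w ∷ r) → hits (τ u) ≤ 4)
    (last     : ∀ u l w → P ≡ (u ∷ l) ʳ++ (w ∷ []) → τ w ≡ noType) where

    -- `β` is the debt handed on by the prefix. It is at most 60 on reaching the last vertex, which
    -- is unhit and worth 36; hence the 24.
    suffix-bound : ∀ u u′ l w r → P ≡ (u ∷ u′ ∷ l) ʳ++ (w ∷ r) →
      ∑[ v ∈ w ∷ r ] cost (τ v) + β (τ u) ≤
        36 * length (w ∷ r) + 24 + ∑ (cutsFrom (u ∷ u′ ∷ l) (w ∷ r)) γ
    suffix-bound u u′ l w [] eq rewrite last u (u′ ∷ l) w eq =
      ≤-trans (final-bound (τ u) (interior u u′ l w [] eq)) (m≤m+n 60 _)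
    suffix-bound u u′ l w (w′ ∷ r) eq = begin
      cost (τ w) + C + β (τ u)
        ≡⟨ shuffle₁ (cost (τ w)) C (β (τ u)) ⟩
      cost (τ w) + β (τ u) + C
        ≤⟨ +-monoˡ-≤ C (step-bound (τ u) (τ w) (interior u u′ l w (w′ ∷ r) eq)
             (interior w u (u′ ∷ l) w′ r eq) (compat u (u′ ∷ l) w (w′ ∷ r) eq)) ⟩
      36 + β (τ w) + (g + g′) + C
        ≡⟨ shuffle₂ (β (τ w)) (g + g′) C ⟩
      36 + (g + g′) + (C + β (τ w))
        ≤⟨ +-monoʳ-≤ (36 + (g + g′)) (suffix-bound w u (u′ ∷ l) w′ r eq) ⟩
      36 + (g + g′) + (36 * length (w′ ∷ r) + 24 + Γ)
        ≡⟨ shuffle₃ g g′ (length (w′ ∷ r)) Γ ⟩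
      36 * suc (length (w′ ∷ r)) + 24 + (1 * g + 1 * g′ + Γ) ∎
      where
      open ≤-Reasoning
      C g g′ Γ : ℕ
      C  = ∑[ v ∈ w′ ∷ r ] cost (τ v)
      g  = edgeGainʳ (τ u) (τ w)
      g′ = edgeGainˡ (τ u) (τ w)
      Γ  = ∑ (cutsFrom (w ∷ u ∷ u′ ∷ l) (w′ ∷ r)) γ
      shuffle₁ : ∀ a b c → a + b + c ≡ a + c + b
      shuffle₁ = solve-∀
      shuffle₂ : ∀ b g c → 36 + b + g + c ≡ 36 + g + (c + b)
      shuffle₂ = solve-∀
      shuffle₃ : ∀ g g′ k c → 36 + (g + g′) + (36 * k + 24 + c) ≡ 36 * suc k + 24 + (1 * g + 1 * g′ + c)
      shuffle₃ = solve-∀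

  -- The two unhit ends are worth 72, the final potential is at most 60, and 12 remain: what a
  -- non-cyclic component needs beyond 24 for each of its ten hits.
  path-bound : ∀ p₁ p₂ P → τ p₁ ≡ noType → proj₁ (proj₂ (proj₂ (τ p₂))) ≡ false →
    (∀ u l w r → p₁ ∷ p₂ ∷ P ≡ (u ∷ l) ʳ++ (w ∷ r) → compatible (τ u) (τ w) ≡ true) →
    (∀ u u′ l w r → p₁ ∷ p₂ ∷ P ≡ (u ∷ u′ ∷ l) ʳ++ (w ∷ r) → hits (τ u) ≤ 4) →
    (∀ u l w → p₁ ∷ p₂ ∷ P ≡ (u ∷ l) ʳ++ (w ∷ []) → τ w ≡ noType) →
    ∑[ v ∈ p₁ ∷ p₂ ∷ P ] cost (τ v) + 12 ≤ 36 * length (p₁ ∷ p₂ ∷ P) + ∑ (cuts (p₁ ∷ p₂ ∷ P)) γ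
  path-bound p₁ p₂ [] e₁ a₂ compat interior last
    rewrite e₁ | last p₁ [] p₂ refl = ≤-trans (m≤m+n 12 60) (m≤m+n 72 _)
  path-bound p₁ p₂ (w ∷ P) e₁ a₂ compat interior last = begin
    cost (τ p₁) + (cost (τ p₂) + C) + 12
      ≡⟨ cong (λ t → cost t + (cost (τ p₂) + C) + 12) e₁ ⟩
    cost (τ p₂) + C + 12
      ≤⟨ +-monoˡ-≤ 12 (+-monoˡ-≤ C (first (τ p₂) a₂ (interior p₂ p₁ [] w P refl)
           (subst (λ t → compatible t (τ p₂) ≡ true) e₁ (compat p₁ [] p₂ (w ∷ P) refl)))) ⟩
    36 + β (τ p₂) + C + 12
      ≡⟨ shuffle₁ (β (τ p₂)) C ⟩
    48 + (C + β (τ p₂))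
      ≤⟨ +-monoʳ-≤ 48 (suffix-bound (p₁ ∷ p₂ ∷ w ∷ P) compat interior last p₂ p₁ [] w P refl) ⟩
    48 + (36 * length (w ∷ P) + 24 + Γ)
      ≡⟨ shuffle₂ (length (w ∷ P)) Γ ⟩
    36 * suc (suc (length (w ∷ P))) + Γ
      ≤⟨ +-monoʳ-≤ (36 * suc (suc (length (w ∷ P)))) (m≤n+m Γ (γ (p₁ ∷ [] , p₂ ∷ w ∷ P))) ⟩
    36 * suc (suc (length (w ∷ P))) + (γ (p₁ ∷ [] , p₂ ∷ w ∷ P) + Γ) ∎
    where
    open ≤-Reasoning
    C Γ : ℕ
    C = ∑[ v ∈ w ∷ P ] cost (τ v)
    Γ = ∑ (cutsFrom (p₂ ∷ p₁ ∷ []) (w ∷ P)) γ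
    first : ∀ t → proj₁ (proj₂ (proj₂ t)) ≡ false → hits t ≤ 4 → compatible noType t ≡ true → cost t ≤ 36 + β t
    first (p , κ , _ , b) refl = start-bound p κ b
    shuffle₁ : ∀ b c → 36 + b + c + 12 ≡ 48 + (c + b)
    shuffle₁ = solve-∀
    shuffle₂ : ∀ k c → 48 + (36 * k + 24 + c) ≡ 36 * suc (suc k) + c
    shuffle₂ = solve-∀

module _ {A : Set} where

  headˡ headʳ : (A → ℕ) → List A × List A → ℕ
  headˡ f (u ∷ _ , _) = f u
  headˡ f ([] , _)    = 0
  headʳ f (_ , w ∷ _) = f w
  headʳ f (_ , [])    = 0

  lastOf : A → List A → A
  lastOf u []      = u
  lastOf u (w ∷ r) = lastOf w r

  ∑-cutsFrom-headˡ : ∀ f (u : A) l R → ∑ (cutsFrom (u ∷ l) R) (headˡ f) + f (lastOf u R) ≡ f u + ∑ R f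
  ∑-cutsFrom-headˡ f u l []      = sym (+-identityʳ (f u))
  ∑-cutsFrom-headˡ f u l (w ∷ R) = begin
    f u + ∑ (cutsFrom (w ∷ u ∷ l) R) (headˡ f) + f (lastOf w R)   ≡⟨ +-assoc (f u) _ _ ⟩
    f u + (∑ (cutsFrom (w ∷ u ∷ l) R) (headˡ f) + f (lastOf w R)) ≡⟨ cong (f u +_) (∑-cutsFrom-headˡ f w (u ∷ l) R) ⟩
    f u + (f w + ∑ R f)                                           ∎
    where open ≡-Reasoning

  ∑-cutsFrom-headʳ : ∀ f (L : List A) R → ∑ (cutsFrom L R) (headʳ f) ≡ ∑ R f
  ∑-cutsFrom-headʳ f L []      = refl
  ∑-cutsFrom-headʳ f L (w ∷ R) = cong (f w +_) (∑-cutsFrom-headʳ f (w ∷ L) R)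

  ∑-cuts-headˡ-≤ : ∀ f (P : List A) → ∑ (cuts P) (headˡ f) ≤ ∑ P f
  ∑-cuts-headˡ-≤ f []      = z≤n
  ∑-cuts-headˡ-≤ f (p ∷ P) = ≤-trans (m≤m+n _ _) (≤-reflexive (∑-cutsFrom-headˡ f p [] P))

  ∑-cuts-headʳ-≤ : ∀ f (P : List A) → ∑ (cuts P) (headʳ f) ≤ ∑ P f
  ∑-cuts-headʳ-≤ f []      = z≤n
  ∑-cuts-headʳ-≤ f (p ∷ P) = ≤-trans (≤-reflexive (∑-cutsFrom-headʳ f (p ∷ []) P)) (m≤n+m _ (f p))

  cutsFrom-∈ : ∀ {Q : List A} L R → Q ≡ L ʳ++ R → ∀ {L′ R′} → (L′ , R′) ∈ cutsFrom L R → Q ≡ L′ ʳ++ R′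
  cutsFrom-∈ L (w ∷ R) eq (here refl) = eq
  cutsFrom-∈ L (w ∷ R) eq (there m)   = cutsFrom-∈ (w ∷ L) R eq m

  cuts-∈ : ∀ {P : List A} {L R} → (L , R) ∈ cuts P → P ≡ L ʳ++ R
  cuts-∈ {p ∷ P} m = cutsFrom-∈ (p ∷ []) P refl m

∑-remove : ∀ {n} (f : Fin n → Bool) u →
           ∑[ v ∈ allFin n ] # (f v ∧ not (u == v)) + # f u ≡ ∑[ v ∈ allFin n ] # f v
∑-remove {n} f u = begin
  ∑[ v ∈ allFin n ] # (f v ∧ not (u == v)) + # f u
    ≡⟨ cong (∑[ v ∈ allFin n ] # (f v ∧ not (u == v)) +_) (∑-δ u (#_ ∘ f)) ⟨
  ∑[ v ∈ allFin n ] # (f v ∧ not (u == v)) + ∑[ v ∈ allFin n ] (# (u == v) * # f v)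
    ≡⟨ ∑-+ (allFin n) (λ v → # (f v ∧ not (u == v))) (λ v → # (u == v) * # f v) ⟨
  ∑[ v ∈ allFin n ] (# (f v ∧ not (u == v)) + # (u == v) * # f v)
    ≡⟨ ∑-cong (allFin n) (λ v → split (f v) (u == v)) ⟩
  ∑[ v ∈ allFin n ] # f v ∎
  where
  open ≡-Reasoning
  split : ∀ a b → # (a ∧ not b) + # b * # a ≡ # a
  split true  true  = refl
  split true  false = refl
  split false true  = refl
  split false false = refl

-- Degrees along a path

module Degrees {n : ℕ} (G : Graph n) (reg : ∀ v → ∑[ w ∈ allFin n ] # Paths.adj G v w ≡ 6) where
  open Paths G
  open Merges G
  open Exchange G
  open Moves G
  open Covers G

  hits-5 : ∀ {e e′ t} → Good (e ∷ e′ ∷ t) → ∑[ v ∈ allFin n ] # hit (e ∷ e′ ∷ t) v ≡ 5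
  hits-5 {e} {e′} (good (ee′ ∷ _)) = +-cancelʳ-≡ 1 _ 5 (trans
    (cong (λ b → ∑[ v ∈ allFin n ] # (adj e v ∧ not (e′ == v)) + # b) (sym (adj-complete ee′)))
    (trans (∑-remove (adj e) e′) (reg e)))

  -- free x (L , R): the first vertex of R, an inner vertex of L ʳ++ R, sees x
  -- along an edge that is not in the path.
  free : V → Path × Path → ℕ
  free x (u ∷ _ , R@(w ∷ w′ ∷ _)) = # (hit R x ∧ not (u == x))
  free x _                        = 0

  flip : Path × Path → Path × Path
  flip (L , R) = R , L

  -- Summed over all cuts of a path without repetitions, the number of path edges at `x`.
  ends : V → Path × Path → ℕ
  ends x c = headˡ (λ u → # (u == x)) c + headʳ (λ w → # (w == x)) c

  private
    bit-last : ∀ A U W → (U ≡ true → A ≡ true) → 0 + # (A ∧ not U) + (# U + # W + 0) ≤ # A + 0 + # W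
    bit-last true  true  true  h = ≤-refl
    bit-last true  true  false h = ≤-refl
    bit-last true  false true  h = ≤-refl
    bit-last true  false false h = ≤-refl
    bit-last false true  W     h with () ← h refl
    bit-last false false true  h = ≤-refl
    bit-last false false false h = ≤-refl

    bit-step : ∀ A U W → (U ≡ true → A ≡ true) → (W ≡ true → A ≡ true) → (U ≡ true → W ≡ true → ⊥) →
               # ((A ∧ not W) ∧ not U) + # U + # W ≤ # A
    bit-step true  true  true  h h′ k = ⊥-elim (k refl refl)
    bit-step true  true  false h h′ k = ≤-refl
    bit-step true  false true  h h′ k = ≤-refl
    bit-step true  false false h h′ k = ≤-refl
    bit-step false true  W     h h′ k with () ← h refl
    bit-step false false true  h h′ k with () ← h′ refl
    bit-step false false false h h′ k = ≤-refl

  -- Each neighbour of `x` on the suffix is charged once: as the far end, by an edge off the path,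
  -- or by a path edge. The extra `# (w == x)` pays for the path edge from `x` back to `u`, which
  -- lies outside the suffix.
  free-from : ∀ x u l w r → LinkedG (u ∷ w ∷ r) → occ x (u ∷ w ∷ r) ≤ 1 →
    ∑ (cutsFrom (u ∷ l) (w ∷ r)) (free x) + # hit ((w ∷ r) ʳ++ (u ∷ l)) x + ∑ (cutsFrom (u ∷ l) (w ∷ r)) (ends x)
      ≤ ∑[ v ∈ w ∷ r ] # adj v x + # (w == x)
  free-from x u l w [] (uw ∷ _) le =
    bit-last (adj w x) (u == x) (w == x) λ e → case ==-≡ {v = u} {x} e of λ { refl → adj-complete (symm G uw) }
  free-from x u l w (w′ ∷ r) (uw ∷ lw@(ww′ ∷ _)) le = begin
    N + Σn + h + (# (u == x) + # (w == x) + Σe)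
      ≡⟨ shuffle₁ N Σn h (# (u == x)) (# (w == x)) Σe ⟩
    N + # (u == x) + # (w == x) + (Σn + h + Σe)
      ≤⟨ +-monoʳ-≤ (N + # (u == x) + # (w == x))
           (free-from x w (u ∷ l) w′ r lw (≤-trans (m≤n+m _ (# (u == x))) le)) ⟩
    N + # (u == x) + # (w == x) + (∑[ v ∈ w′ ∷ r ] # adj v x + # (w′ == x))
      ≡⟨ shuffle₂ N (# (u == x)) (# (w == x)) (∑[ v ∈ w′ ∷ r ] # adj v x) (# (w′ == x)) ⟩
    N + # (u == x) + # (w′ == x) + (∑[ v ∈ w′ ∷ r ] # adj v x + # (w == x))
      ≤⟨ +-monoˡ-≤ _ (bit-step (adj w x) (u == x) (w′ == x)
           (λ e → case ==-≡ {v = u} {x} e of λ { refl → adj-complete (symm G uw) })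
           (λ e → case ==-≡ {v = w′} {x} e of λ { refl → adj-complete ww′ })
           (λ e e′ → case ==-≡ {v = u} {x} e , ==-≡ {v = w′} {x} e′ of λ { (refl , refl) →
             1+n≰n (≤-trans (+-mono-≤ (≤-reflexive (cong #_ (sym (==-refl x))))
               (occ-there x w (x ∷ r) (occ-here x r))) le) })) ⟩
    # adj w x + (∑[ v ∈ w′ ∷ r ] # adj v x + # (w == x))
      ≡⟨ +-assoc (# adj w x) _ _ ⟨
    # adj w x + ∑[ v ∈ w′ ∷ r ] # adj v x + # (w == x) ∎
    where
    open ≤-Reasoning
    N Σn h Σe : ℕ
    N  = free x (u ∷ l , w ∷ w′ ∷ r)
    Σn = ∑ (cutsFrom (w ∷ u ∷ l) (w′ ∷ r)) (free x)
    h  = # hit ((w′ ∷ r) ʳ++ (w ∷ u ∷ l)) x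
    Σe = ∑ (cutsFrom (w ∷ u ∷ l) (w′ ∷ r)) (ends x)
    shuffle₁ : ∀ a b c d e f → a + b + c + (d + e + f) ≡ a + d + e + (b + c + f)
    shuffle₁ = solve-∀
    shuffle₂ : ∀ a b c d e → a + b + c + (d + e) ≡ a + b + e + (d + c)
    shuffle₂ = solve-∀

  free-path : ∀ x {p p′ P} → Good (p ∷ p′ ∷ P) → occ x (p ∷ p′ ∷ P) ≤ 1 →
    h₂ (p ∷ p′ ∷ P) x + ∑ (cuts (p ∷ p′ ∷ P)) (free x) + ∑ (cuts (p ∷ p′ ∷ P)) (ends x)
      ≤ ∑[ v ∈ p ∷ p′ ∷ P ] # adj v x
  free-path x {p} {p′} {P} (good l@(pp′ ∷ _)) le = begin
    # hit Q x + # hit (reverse Q) x + Σn + Σe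
      ≡⟨ shuffle (# hit Q x) (# hit (reverse Q) x) Σn Σe ⟩
    # hit Q x + (Σn + # hit (reverse Q) x + Σe)
      ≤⟨ +-monoʳ-≤ (# hit Q x) (free-from x p [] p′ P l le) ⟩
    # hit Q x + (∑[ v ∈ p′ ∷ P ] # adj v x + # (p′ == x))
      ≡⟨ shuffle′ (# hit Q x) (∑[ v ∈ p′ ∷ P ] # adj v x) (# (p′ == x)) ⟩
    # hit Q x + # (p′ == x) + ∑[ v ∈ p′ ∷ P ] # adj v x
      ≤⟨ +-monoˡ-≤ _ (bit (adj p x) (p′ == x) λ e → case ==-≡ {v = p′} {x} e of λ { refl → adj-complete pp′ }) ⟩
    # adj p x + ∑[ v ∈ p′ ∷ P ] # adj v x ∎
    where
    open ≤-Reasoning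
    Q : Path
    Q = p ∷ p′ ∷ P
    Σn Σe : ℕ
    Σn = ∑ (cuts Q) (free x)
    Σe = ∑ (cuts Q) (ends x)
    shuffle : ∀ a b c d → a + b + c + d ≡ a + (c + b + d)
    shuffle = solve-∀
    shuffle′ : ∀ a b c → a + (b + c) ≡ a + c + b
    shuffle′ = solve-∀
    bit : ∀ A W → (W ≡ true → A ≡ true) → # (A ∧ not W) + # W ≤ # A
    bit true  true  h = ≤-refl
    bit true  false h = ≤-refl
    bit false true  h with () ← h refl
    bit false false h = ≤-refl

  -- An inner vertex heads the right half of one cut and the left half of the next, and its edges
  -- off the path are the same from both sides.
  free-flip : ∀ x P → ∑ (cuts P) (free x ∘ flip) ≡ ∑ (cuts P) (free x)
  free-flip x []           = refl
  free-flip x (p ∷ [])     = refl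
  free-flip x (p ∷ p′ ∷ P) = go p [] p′ P
    where
    swap-∧ : ∀ a b c → (a ∧ b) ∧ c ≡ (a ∧ c) ∧ b
    swap-∧ true  true  true  = refl
    swap-∧ true  true  false = refl
    swap-∧ true  false true  = refl
    swap-∧ true  false false = refl
    swap-∧ false b     c     = refl
    go : ∀ u l w r → ∑ (cutsFrom (w ∷ u ∷ l) r) (free x ∘ flip) ≡ ∑ (cutsFrom (u ∷ l) (w ∷ r)) (free x)
    go u l w []       = refl
    go u l w (w′ ∷ r) = cong₂ _+_ (cong #_ (swap-∧ (adj w x) (not (u == x)) (not (w′ == x)))) (go w (u ∷ l) w′ r)

  ends-inner : ∀ x {p P} → 1 ≤ occ x (p ∷ P) → p ≢ x → lastOf p P ≢ x → 2 ≤ ∑ (cuts (p ∷ P)) (ends x)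
  ends-inner x {p} {P} le p≢x l≢x = begin
    2
      ≤⟨ +-mono-≤ le le ⟩
    occ x (p ∷ P) + occ x (p ∷ P)
      ≡⟨ cong₂ _+_ (sym headˡ-eq) (trans (cong (λ b → # b + occ x P) (==-≢ p≢x)) (sym (∑-cutsFrom-headʳ _ (p ∷ []) P))) ⟩
    ∑ (cuts (p ∷ P)) (headˡ λ u → # (u == x)) + ∑ (cuts (p ∷ P)) (headʳ λ w → # (w == x))
      ≡⟨ ∑-+ (cuts (p ∷ P)) _ _ ⟨
    ∑ (cuts (p ∷ P)) (ends x) ∎
    where
    open ≤-Reasoning
    headˡ-eq : ∑ (cuts (p ∷ P)) (headˡ λ u → # (u == x)) ≡ occ x (p ∷ P)
    headˡ-eq = trans (sym (+-identityʳ _))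
      (trans (cong (λ b → ∑ (cuts (p ∷ P)) (headˡ λ u → # (u == x)) + # b) (sym (==-≢ l≢x)))
             (∑-cutsFrom-headˡ (λ u → # (u == x)) p [] P))

-- Types of the vertices on a non-cyclic component

not-true : ∀ {b} → not b ≡ true → b ≡ false
not-true {false} e = refl

bool-false : ∀ {b} → (b ≡ true → ⊥) → b ≡ false
bool-false {true}  k = ⊥-elim (k refl)
bool-false {false} k = refl

≤1-split : ∀ b c → 1 ≤ # b + # c → (b ≡ true) ⊎ (c ≡ true)
≤1-split true  c    le = inj₁ refl
≤1-split false true le = inj₂ refl

pos-≤ : ∀ {m} → pos m ≡ true → 1 ≤ m
pos-≤ {suc m} e = s≤s z≤n

*-≤1 : ∀ b m → 1 ≤ # b * m → b ≡ true × 1 ≤ m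
*-≤1 true m le = refl , ≤-trans le (≤-reflexive (+-identityʳ m))

module Local {n : ℕ} (G : Graph n) (reg : ∀ v → ∑[ w ∈ allFin n ] # Paths.adj G v w ≡ 6) where
  open Paths G
  open Merges G
  open Exchange G
  open Moves G
  open Covers G
  open Degrees G reg

  hN hC : List Path → V → ℕ
  hN S v = ∑[ D ∈ S ] (# not (cyc D) * h₂ D v)
  hC S v = ∑[ D ∈ S ] (# cyc D * h₂ D v)

  H≡hN+hC : ∀ S v → H S v ≡ hN S v + hC S v
  H≡hN+hC S v = trans (∑-cong S (λ D → split (cyc D) (h₂ D v)))
                      (∑-+ S (λ D → # not (cyc D) * h₂ D v) (λ D → # cyc D * h₂ D v))
    where
    split : ∀ b m → m ≡ # not b * m + # b * m
    split true  m = sym (+-identityʳ m)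
    split false m = sym (trans (+-identityʳ _) (+-identityʳ m))

  Hit : List Path → V → Set
  Hit S v = ∃[ D ] ∃[ O ] (D ∈ S × Oriented D O × hit O v ≡ true)

  h₂-hit : ∀ D v → 1 ≤ h₂ D v → ∃[ O ] (Oriented D O × hit O v ≡ true)
  h₂-hit D v le with ≤1-split (hit D v) (hit (reverse D) v) le
  ... | inj₁ e = D , fwd refl , e
  ... | inj₂ e = reverse D , bwd refl , e

  hN-hit : ∀ S v → 1 ≤ hN S v → ∃[ D ] ∃[ O ] (D ∈ S × Oriented D O × hit O v ≡ true × cyc D ≡ false)
  hN-hit S v le with D , D∈ , le′ ← ∑-find S (λ D → # not (cyc D) * h₂ D v) le
    with nc , le″ ← *-≤1 (not (cyc D)) (h₂ D v) le′
    with O , o , e ← h₂-hit D v le″ = D , O , D∈ , o , e , not-true nc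

  H-hit : ∀ S v → 1 ≤ H S v → Hit S v
  H-hit S v le with D , D∈ , le′ ← ∑-find S (λ D → h₂ D v) le
    with O , o , e ← h₂-hit D v le′ = D , O , D∈ , o , e

  last-split : ∀ L (p : V) P → ∃[ l ] (L ʳ++ (p ∷ P) ≡ l ʳ++ (lastOf p P ∷ []))
  last-split L p []      = L , refl
  last-split L p (q ∷ P) = last-split (p ∷ L) q P

  reverse-last : ∀ p P → ∃[ l ] (reverse (p ∷ P) ≡ lastOf p P ∷ l)
  reverse-last p P with l , eq ← last-split [] p P = l , trans (cong reverse eq) (reverse-ʳ++ l _)

  end-unhit : ∀ {S P rest z Z} → Min S → S ↭ P ∷ rest → Oriented P (z ∷ Z) → ¬ Hit rest z
  end-unhit m p o (D , O , D∈ , d , e) with rest′ , q ← ∈⇒↭ D∈ =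
    ends-apart m (Perm.trans p (Perm.trans (prep _ q) (swap _ _ ↭-refl))) d
      (λ v → or-∑ o _) (or-good o (good-of m p)) (hit⇒~ e)

  two : ∀ {S P} → Min S → singles S ≡ 0 → P ∈ S → ∃[ p ] ∃[ p′ ] ∃[ P′ ] P ≡ p ∷ p′ ∷ P′
  two {S} {P} m ns P∈ with rest , q ← ∈⇒↭ P∈
    with good {x} {xs} l ← good-of m q with xs
  ... | p′ ∷ P′ = x , p′ , P′ , refl
  ... | []      = ⊥-elim (1+n≰n (≤-trans (∑-∈-≤ q (#_ ∘ single)) (≤-reflexive ns)))

  not-single : ∀ {S P} → Min S → singles S ≡ 0 → P ∈ S → single P ≡ false
  not-single m ns P∈ with _ , _ , _ , refl ← two m ns P∈ = refl

  -- Of the six edges at `x`, two belong to its path; every hit and every free edge uses one of the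
  -- rest.
  capacity : ∀ {S P p P′ x} → Min S → singles S ≡ 0 → P ∈ S → P ≡ p ∷ P′ →
             1 ≤ occ x P → p ≢ x → lastOf p P′ ≢ x →
             H S x + ∑[ Q ∈ S ] ∑ (cuts Q) (free x) ≤ 4
  capacity {S} {P} {p} {P′} {x} m ns P∈ refl x∈ p≢x l≢x = +-cancelʳ-≤ 2 _ 4 (begin
    H S x + ∑[ Q ∈ S ] ∑ (cuts Q) (free x) + 2
      ≤⟨ +-monoʳ-≤ _ (ends-inner x {p} {P′} x∈ p≢x l≢x) ⟩
    H S x + ∑[ Q ∈ S ] ∑ (cuts Q) (free x) + ∑ (cuts P) (ends x)
      ≤⟨ +-monoʳ-≤ _ (∑-∈-≤ (proj₂ (∈⇒↭ P∈)) (λ Q → ∑ (cuts Q) (ends x))) ⟩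
    H S x + ∑[ Q ∈ S ] ∑ (cuts Q) (free x) + ∑[ Q ∈ S ] ∑ (cuts Q) (ends x)
      ≡⟨ cong (_+ ∑[ Q ∈ S ] ∑ (cuts Q) (ends x)) (∑-+ S (λ Q → h₂ Q x) (λ Q → ∑ (cuts Q) (free x))) ⟨
    ∑[ Q ∈ S ] (h₂ Q x + ∑ (cuts Q) (free x)) + ∑[ Q ∈ S ] ∑ (cuts Q) (ends x)
      ≡⟨ ∑-+ S (λ Q → h₂ Q x + ∑ (cuts Q) (free x)) (λ Q → ∑ (cuts Q) (ends x)) ⟨
    ∑[ Q ∈ S ] (h₂ Q x + ∑ (cuts Q) (free x) + ∑ (cuts Q) (ends x))
      ≤⟨ ∑-mono-∈ S per-path ⟩
    ∑[ Q ∈ S ] ∑[ v ∈ Q ] # adj v x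
      ≡⟨ ∑-vertices (Min.cov m) (λ v → # adj v x) ⟩
    ∑[ v ∈ allFin n ] # adj v x
      ≡⟨ ∑-cong (allFin n) (λ v → cong #_ (adj-sym v x)) ⟩
    ∑[ v ∈ allFin n ] # adj x v
      ≡⟨ reg x ⟩
    6 ∎)
    where
    open ≤-Reasoning
    per-path : ∀ {Q} → Q ∈ S →
               h₂ Q x + ∑ (cuts Q) (free x) + ∑ (cuts Q) (ends x) ≤ ∑[ v ∈ Q ] # adj v x
    per-path Q∈ with q , q′ , Q′ , refl ← two m ns Q∈ =
      free-path x (good-of m (proj₂ (∈⇒↭ Q∈))) (unique-in (Min.cov m) Q∈ x)

  module Component {S : List Path} (o : Opt S) (ns : singles S ≡ 0) {P : Path} {rest : List Path}
                   (p : S ↭ P ∷ rest) (nc : cyc P ≡ false) where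

    m : Min S
    m = opt⇒min o

    pN κC : V → ℕ
    pN = hN rest
    κC = hC rest

    τ : V → Type
    τ v = pN v , κC v , hit P v , hit (reverse P) v

    hN-τ : ∀ v → hN S v ≡ hitsN (τ v)
    hN-τ v = trans (∑-↭ p (λ D → # not (cyc D) * h₂ D v))
      (trans (cong (λ b → # not b * h₂ P v + pN v) nc)
        (trans (cong (_+ pN v) (+-identityʳ (h₂ P v))) (+-comm (h₂ P v) (pN v))))

    hC-τ : ∀ v → hC S v ≡ κC v
    hC-τ v = trans (∑-↭ p (λ D → # cyc D * h₂ D v)) (cong (λ b → # b * h₂ P v + κC v) nc)

    H-τ : ∀ v → H S v ≡ hits (τ v)
    H-τ v = trans (H≡hN+hC S v) (cong₂ _+_ (hN-τ v) (hC-τ v))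

    hit-of : ∀ v → pos (pN v + κC v) ≡ true → Hit rest v
    hit-of v e = H-hit rest v (≤-trans (pos-≤ e) (≤-reflexive (sym (H≡hN+hC rest v))))

    P∈S : P ∈ S
    P∈S = ↭⇒∈ p

    module _ {u w : V} {l r : Path} (c : Cut P (u ∷ l) (w ∷ r)) where

      no-chord : Hit rest u → hit ((u ∷ l) ʳ++ (w ∷ r)) w ≡ true → ⊥
      no-chord (D , O , D∈ , d , e) with rest′ , q ← ∈⇒↭ D∈ =
        chord-apart m (Perm.trans p (prep _ q)) d c e

      no-split : 1 ≤ hN rest w → hit ((u ∷ l) ʳ++ (w ∷ r)) u ≡ true → ⊥
      no-split le au with D , O , D∈ , d , e , ncD ← hN-hit rest w le with rest′ , q ← ∈⇒↭ D∈ =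
        cycle-splits o (Perm.trans p (prep _ q)) d c nc ncD au e

      -- An end of a third component that hits `u` contradicts `cross-apart`, the other end of `D`
      -- contradicts `insert-apart`. The factor `g` treats hits by cyclic and by non-cyclic
      -- components alike.
      only : ∀ {D O} → D ∈ rest → Oriented D O → hit O w ≡ true →
             (g : Bool → ℕ) → ∑[ E ∈ rest ] (g (cyc E) * h₂ E u) ≡ g (cyc D) * # hit O u
      only {D} {O} D∈ d e g with rest′ , q ← ∈⇒↭ D∈ = begin
        ∑[ E ∈ rest ] (g (cyc E) * h₂ E u)
          ≡⟨ ∑-↭ q (λ E → g (cyc E) * h₂ E u) ⟩
        g (cyc D) * h₂ D u + ∑[ E ∈ rest′ ] (g (cyc E) * h₂ E u)
          ≡⟨ cong₂ _+_ (cong (g (cyc D) *_) D-part) (trans (∑-cong-∈ rest′ others) (∑-0 rest′)) ⟩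
        g (cyc D) * # hit O u + 0
          ≡⟨ +-identityʳ _ ⟩
        g (cyc D) * # hit O u ∎
        where
        open ≡-Reasoning
        D-part : h₂ D u ≡ # hit O u
        D-part = trans (sym (or-h₂ d u)) (trans (cong (λ b → # hit O u + # b) (bool-false λ e′ →
          insert-apart m (Perm.trans p (prep _ q)) (or-rev d) c e′
            (trans (cong (λ z → hit z w) (reverse-involutive O)) e))) (+-identityʳ _))
        others : ∀ {E} → E ∈ rest′ → g (cyc E) * h₂ E u ≡ 0
        others {E} E∈ with rest″ , q′ ← ∈⇒↭ E∈ =
          trans (cong (g (cyc E) *_) (cong₂ (λ a b → # a + # b) (miss (fwd refl)) (miss (bwd refl)))) (*-zeroʳ (g (cyc E)))
          where
          miss : ∀ {O′} → Oriented E O′ → hit O′ u ≡ false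
          miss o′ = bool-false λ e′ → cross-apart m
            (Perm.trans p (prep _ (Perm.trans q (Perm.trans (prep _ q′) (swap _ _ ↭-refl))))) o′ d c e′ e

    compatible-cut : ∀ u l w r → P ≡ (u ∷ l) ʳ++ (w ∷ r) → compatible (τ u) (τ w) ≡ true
    compatible-cut u l w r eq =
      ∧-intro (nand λ e e′ → chords-apart o p c nc (trans (sym (hitʳ u)) e) (trans (sym (hitˡ w)) e′))
      (∧-intro (nand λ e e′ → no-chord c (hit-of u e) (trans (sym (hitˡ w)) e′))
      (∧-intro (nand λ e e′ → no-chord (cut-swap c) (hit-of w e′) (trans (sym (hitʳ u)) e))
      (∧-intro same-hit
      (∧-intro (nand λ e e′ → no-split c (pos-≤ e′) (trans (sym (hitˡ u)) e))
               (nand λ e e′ → no-split (cut-swap c) (pos-≤ e′) (trans (sym (hitʳ w)) e))))))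
      where
      c : Cut P (u ∷ l) (w ∷ r)
      c = fwd eq
      hitˡ : ∀ v → hit P v ≡ hit ((u ∷ l) ʳ++ (w ∷ r)) v
      hitˡ v = cong (λ z → hit z v) eq
      hitʳ : ∀ v → hit (reverse P) v ≡ hit ((w ∷ r) ʳ++ (u ∷ l)) v
      hitʳ v = cong (λ z → hit z v) (trans (cong reverse eq) (reverse-ʳ++ (u ∷ l) (w ∷ r)))
      nand : ∀ {a b} → (a ≡ true → b ≡ true → ⊥) → not (a ∧ b) ≡ true
      nand {true}  {true}  k = ⊥-elim (k refl refl)
      nand {true}  {false} k = refl
      nand {false}         k = refl
      same-hit : (not (pos (pN u + κC u) ∧ pos (pN w + κC w)) ∨
                  ((pN u ≡ᵇ pN w) ∧ ((κC u ≡ᵇ κC w) ∧ (pN u + κC u ≡ᵇ 1)))) ≡ true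
      same-hit with pos (pN u + κC u) in e | pos (pN w + κC w) in e′
      ... | false | _     = refl
      ... | true  | false = refl
      -- The end that hits `w` is the only outer one that can hit `u`. As `u` is hit, it does so,
      -- and by symmetry it is then the only outer one at `w`.
      ... | true  | true
        with D , O , D∈ , d , Ow ← hit-of w e′ | D′ , O′ , D′∈ , d′ , O′u ← hit-of u e =
        finish (only c D∈ d Ow (#_ ∘ not)) (only c D∈ d Ow #_)
               (λ Ou → only (cut-swap c) D∈ d Ou (#_ ∘ not)) (λ Ou → only (cut-swap c) D∈ d Ou #_) e
        where
        finish : pN u ≡ # not (cyc D) * # hit O u → κC u ≡ # cyc D * # hit O u →
                 (hit O u ≡ true → pN w ≡ # not (cyc D) * # hit O w) →
                 (hit O u ≡ true → κC w ≡ # cyc D * # hit O w) →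
                 pos (pN u + κC u) ≡ true →
                 ((pN u ≡ᵇ pN w) ∧ ((κC u ≡ᵇ κC w) ∧ (pN u + κC u ≡ᵇ 1))) ≡ true
        finish eq₁ eq₂ eq₃ eq₄ ps with hit O u
        finish eq₁ eq₂ eq₃ eq₄ ps | false rewrite eq₁ | eq₂ | *-zeroʳ (# not (cyc D)) | *-zeroʳ (# cyc D) with () ← ps
        finish eq₁ eq₂ eq₃ eq₄ ps | true rewrite eq₁ | eq₂ | eq₃ refl | eq₄ refl | Ow with cyc D
        ... | true  = refl
        ... | false = refl

    -- An outer end that sees `z` would merge with `P`, the opposite end of `P` would make it
    -- cyclic, and there are no loops.
    end-type : ∀ {z Z} → Oriented P (z ∷ Z) → τ z ≡ noType
    end-type {z} {Z} or = cong₂ _,_ (proj₁ zero-ext) (cong₂ _,_ (proj₂ zero-ext) (own or))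
      where
      zero-sum : ∀ a b → (1 ≤ a + b → ⊥) → a ≡ 0 × b ≡ 0
      zero-sum zero zero k = refl , refl
      zero-sum zero (suc b) k = ⊥-elim (k (s≤s z≤n))
      zero-sum (suc a) b k = ⊥-elim (k (s≤s z≤n))
      zero-ext : pN z ≡ 0 × κC z ≡ 0
      zero-ext = zero-sum (pN z) (κC z) λ le → end-unhit m p or
        (H-hit rest z (≤-trans le (≤-reflexive (sym (H≡hN+hC rest z)))))
      self : ∀ z Z → hit (z ∷ Z) z ≡ false
      self z []      = adj-irrefl z
      self z (_ ∷ _) = cong (_∧ _) (adj-irrefl z)
      own : Oriented P (z ∷ Z) → (hit P z , hit (reverse P) z) ≡ (false , false)
      own (fwd eq) = cong₂ _,_ (subst (λ Q → hit Q z ≡ false) eq (self z Z))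
        (subst (λ Q → hit (reverse Q) z ≡ false) eq
          (subst (λ Q → closes Q ≡ false) (sym eq) (proj₁ (∨-false nc))))
      own (bwd eq) = cong₂ _,_
        (subst (λ Q → hit Q z ≡ false) (trans (cong reverse eq) (reverse-involutive P))
          (subst (λ Q → closes Q ≡ false) (sym eq) (proj₂ (∨-false {closes P} nc))))
        (subst (λ Q → hit Q z ≡ false) eq (self z Z))

    -- The ends of P are not hit, so x is an inner vertex.
    hit-capacity : ∀ {x} → 1 ≤ occ x P → 1 ≤ H S x → H S x + ∑[ Q ∈ S ] ∑ (cuts Q) (free x) ≤ 4
    hit-capacity {x} x∈ le with q , q′ , Q , refl ← two m ns P∈S
      with l , eq ← reverse-last q (q′ ∷ Q) =
      capacity m ns P∈S refl x∈
        (λ { refl → <⇒≱ le (≤-reflexive (trans (H-τ x) (cong hits (end-type (fwd refl))))) })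
        (λ { refl → <⇒≱ le (≤-reflexive (trans (H-τ x) (cong hits (end-type (bwd (sym eq)))))) })

    valid-inner : ∀ {x} → 1 ≤ occ x P → hits (τ x) ≤ 4
    valid-inner {x} x∈ with H S x in eq
    ... | zero  = ≤-trans (≤-reflexive (trans (sym (H-τ x)) eq)) z≤n
    ... | suc k = ≤-trans (≤-reflexive (sym (H-τ x))) (≤-trans (m≤m+n (H S x) _)
                    (hit-capacity x∈ (≤-trans (s≤s z≤n) (≤-reflexive (sym eq)))))

    component-bound : ∑[ v ∈ P ] cost (τ v) + 12 ≤ 36 * length P + ∑ (cuts P) (PathBound.γ τ)
    component-bound with q , q′ , Q , eq ← two m ns P∈S =
      subst (λ P → ∑[ v ∈ P ] cost (τ v) + 12 ≤ 36 * length P + ∑ (cuts P) (PathBound.γ τ)) (sym eq)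
        (PathBound.path-bound τ q q′ Q
          (end-type (fwd (sym eq)))
          (subst (λ Z → hit Z q′ ≡ false) (sym eq)
            (trans (cong (λ b → adj q q′ ∧ not b) (==-refl q′)) (∧-zeroʳ (adj q q′))))
          (λ u l w r e → compatible-cut u l w r (trans eq e))
          (λ u u′ l w r e → valid-inner (subst (λ Z → 1 ≤ occ u Z) (sym (trans eq e))
            (≤-trans (occ-here u (u′ ∷ l)) (≤-trans (m≤m+n _ _) (≤-reflexive (sym (∑-ʳ++ (u ∷ u′ ∷ l) _)))))))
          (λ u l w e → end-type (bwd (sym (trans (cong reverse (trans eq e)) (reverse-ʳ++ (u ∷ l) (w ∷ [])))))))

-- Gains at the cuts of a component

split-≤1 : ∀ h → # (h ≤ᵇ 1) + # (2 ≤ᵇ h) ≡ 1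
split-≤1 0 = refl
split-≤1 1 = refl
split-≤1 (suc (suc h)) = refl

module Gains {n : ℕ} (G : Graph n) (reg : ∀ v → ∑[ w ∈ allFin n ] # Paths.adj G v w ≡ 6)
             {S : List (List (Fin n))} (o : Paths.Opt G S) (ns : Paths.singles G S ≡ 0) where
  open Paths G
  open Merges G
  open Exchange G
  open Moves G
  open Covers G
  open Degrees G reg
  open Local G reg

  private
    mn : Min S
    mn = opt⇒min o
    cv : Cover S
    cv = Opt.cover o

  -- By `once` this is 0 or 1. As a sum over components it lets sums over non-cyclic paths become
  -- sums over vertices.
  inN : V → ℕ
  inN x = ∑[ Q ∈ S ] (# not (cyc Q) * occ x Q)

  inN-pos : ∀ {Q x} → Q ∈ S → 1 ≤ occ x Q → cyc Q ≡ false → 1 ≤ inN x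
  inN-pos {Q} {x} Q∈ le nc = ≤-trans
    (≤-trans le (≤-reflexive (trans (sym (+-identityʳ _)) (cong (λ b → # not b * occ x Q) (sym nc)))))
    (∑-∈-≤ (proj₂ (∈⇒↭ Q∈)) (λ Q → # not (cyc Q) * occ x Q))

  inN-or : ∀ x → (1 ≤ inN x) ⊎ (∃[ Q ] (Q ∈ S × 1 ≤ occ x Q × cyc Q ≡ true))
  inN-or x with Q , Q∈ , le ← component cv x with cyc Q in eq
  ... | true  = inj₂ (Q , Q∈ , le , eq)
  ... | false = inj₁ (inN-pos Q∈ le eq)

  weight : V → ℕ
  weight x = # (2 ≤ᵇ H S x) * inN x

  targets : Path × Path → ℕ
  targets c = ∑[ x ∈ allFin n ] (free x c * weight x)

  moves : Path → V → ℕ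
  moves O u = # hit O u * loss S O u

  moves₂ : Path → V → ℕ
  moves₂ D u = moves D u + moves (reverse D) u

  -- Besides `u` and `w′`, its neighbours on the path, `w` has four neighbours; they are sorted by
  -- their number of hits.
  gain-split : ∀ {P u l w w′ r} → P ∈ S → Cut P (u ∷ l) (w ∷ w′ ∷ r) →
    gain S (w ∷ w′ ∷ r) u + ∑[ x ∈ allFin n ] (free x (u ∷ l , w ∷ w′ ∷ r) * # (2 ≤ᵇ H S x)) ≡ 4
  gain-split {P} {u} {l} {w} {w′} {r} P∈ c = begin
    gain S R u + ∑[ x ∈ allFin n ] (free x (u ∷ l , R) * # (2 ≤ᵇ H S x))
      ≡⟨ ∑-+ (allFin n) (λ x → # (hit R x ∧ (not (u == x) ∧ (H S x ≤ᵇ 1)))) _ ⟨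
    ∑[ x ∈ allFin n ] (# (hit R x ∧ (not (u == x) ∧ (H S x ≤ᵇ 1))) + free x (u ∷ l , R) * # (2 ≤ᵇ H S x))
      ≡⟨ ∑-cong (allFin n) (λ x → bits (hit R x) (not (u == x)) (H S x)) ⟩
    ∑[ x ∈ allFin n ] # (hit R x ∧ not (u == x))
      ≡⟨ +-cancelʳ-≡ 1 _ 4 (trans
           (cong (λ b → ∑[ x ∈ allFin n ] # (hit R x ∧ not (u == x)) + # b)
             (sym (hit-cut c gP (unique-in cv P∈ u))))
           (trans (∑-remove (hit R) u) (hits-5 (proj₂ (proj₂ (cut-good c gP)))))) ⟩
    4 ∎
    where
    open ≡-Reasoning
    R : Path
    R = w ∷ w′ ∷ r
    gP : Good P
    gP = good-of mn (proj₂ (∈⇒↭ P∈))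
    bits : ∀ a b h → # (a ∧ (b ∧ (h ≤ᵇ 1))) + # (a ∧ b) * # (2 ≤ᵇ h) ≡ # (a ∧ b)
    bits false b     h = refl
    bits true  false h = refl
    bits true  true  h = trans (cong (# (h ≤ᵇ 1) +_) (+-identityʳ _)) (split-≤1 h)

  -- With `T = 4 - D` the right side is linear in `D` and runs from 12 at `D = 0` to `4 * Ω` at
  -- `D = 4`, so it never falls below the smaller of the two.
  trade-off : ∀ Ω D T → D + T ≡ 4 → 12 ⊓ (4 * Ω) ≤ 3 * T + Ω * D
  trade-off Ω 0 .4 refl = ≤-trans (m⊓n≤m 12 (4 * Ω)) (m≤m+n 12 (Ω * 0))
  trade-off Ω 1 .3 refl = go Ω
    where
    go : ∀ Ω → 12 ⊓ (4 * Ω) ≤ 9 + Ω * 1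
    go 0 = z≤n
    go 1 = m≤m+n 4 6
    go 2 = m≤m+n 8 3
    go (suc (suc (suc Ω))) = ≤-trans (m⊓n≤m 12 _) (m≤m+n 12 (Ω * 1))
  trade-off Ω 2 .2 refl = go Ω
    where
    go : ∀ Ω → 12 ⊓ (4 * Ω) ≤ 6 + Ω * 2
    go 0 = z≤n
    go 1 = m≤m+n 4 4
    go 2 = m≤m+n 8 2
    go (suc (suc (suc Ω))) = ≤-trans (m⊓n≤m 12 _) (m≤m+n 12 (Ω * 2))
  trade-off Ω 3 .1 refl = go Ω
    where
    go : ∀ Ω → 12 ⊓ (4 * Ω) ≤ 3 + Ω * 3
    go 0 = z≤n
    go 1 = m≤m+n 4 2
    go 2 = m≤m+n 8 1
    go (suc (suc (suc Ω))) = ≤-trans (m⊓n≤m 12 _) (m≤m+n 12 (Ω * 3))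
  trade-off Ω 4 .0 refl = ≤-trans (m⊓n≤n 12 (4 * Ω)) (≤-reflexive (*-comm 4 Ω))
  trade-off Ω (suc (suc (suc (suc (suc D))))) T ()

  module Side {P : Path} {rest : List Path} (p : S ↭ P ∷ rest) (nc : cyc P ≡ false) where
    open Component o ns p nc

    reward : V → ℕ
    reward u = ∑[ D ∈ rest ] (# not (cyc D) * moves₂ D u)

    -- `D` of the four neighbours of `w` off the path have at most one hit; by the exchange
    -- inequalities each non-cyclic end that hits `u` from outside or across this cut has at least
    -- `D` rarely hit vertices to lose. The other `T` neighbours contribute 3 each.
    side : ∀ u l w r → Cut P (u ∷ l) (w ∷ r) →
           # more (w ∷ r) * (12 ⊓ (4 * (pN u + 2 * # hit ((w ∷ r) ʳ++ (u ∷ l)) u)))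
             ≤ 3 * targets (u ∷ l , w ∷ r) + (reward u + 2 * moves ((w ∷ r) ʳ++ (u ∷ l)) u)
    side u l w [] c = z≤n
    -- Here `u` is an end of `P`, hence unhit, and the gain is zero.
    side u [] w (w′ ∷ r) c = ≤-trans (≤-reflexive (end-side c)) z≤n
      where
      end-side : Cut P (u ∷ []) (w ∷ w′ ∷ r) →
                 1 * (12 ⊓ (4 * (pN u + 2 * # hit ((w ∷ w′ ∷ r) ʳ++ (u ∷ [])) u))) ≡ 0
      end-side (fwd refl) with e ← end-type (fwd refl) =
        cong₂ (λ a b → 1 * (12 ⊓ (4 * (a + 2 * # b)))) (cong proj₁ e)
          (trans (cong (λ z → hit z u) (sym (reverse-ʳ++ (u ∷ []) (w ∷ w′ ∷ r)))) (cong (λ t → proj₂ (proj₂ (proj₂ t))) e))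
      end-side (bwd refl) with e ← end-type (bwd (sym (reverse-ʳ++ (w ∷ w′ ∷ r) (u ∷ [])))) =
        cong₂ (λ a b → 1 * (12 ⊓ (4 * (a + 2 * # b)))) (cong proj₁ e) (cong (λ t → proj₁ (proj₂ (proj₂ t))) e)
    side u (u′ ∷ l) w (w′ ∷ r) c with pN u + 2 * # hit (R ʳ++ L) u in Ω-eq
      where
      L R : Path
      L = u ∷ u′ ∷ l
      R = w ∷ w′ ∷ r
    ... | zero  = z≤n
    ... | suc k = begin
      1 * (12 ⊓ (4 * suc k))
        ≡⟨ *-identityˡ _ ⟩
      12 ⊓ (4 * suc k)
        ≤⟨ trade-off (suc k) D T (gain-split P∈S c) ⟩
      3 * T + suc k * D
        ≡⟨ cong (λ Ω → 3 * T + Ω * D) Ω-eq ⟨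
      3 * T + (pN u + 2 * # hit (R ʳ++ L) u) * D
        ≡⟨ cong (3 * T +_) (trans (*-distribʳ-+ D (pN u) _) (cong (pN u * D +_) (*-assoc 2 (# hit (R ʳ++ L) u) D))) ⟩
      3 * T + (pN u * D + 2 * (# hit (R ʳ++ L) u * D))
        ≤⟨ +-mono-≤ (*-monoʳ-≤ 3 (∑-mono (allFin n) T-le)) (+-mono-≤ ext-le (*-monoʳ-≤ 2 own-le)) ⟩
      3 * targets (L , R) + (reward u + 2 * moves (R ʳ++ L) u) ∎
      where
      open ≤-Reasoning
      L R : Path
      L = u ∷ u′ ∷ l
      R = w ∷ w′ ∷ r
      D T : ℕ
      D = gain S R u
      T = ∑[ x ∈ allFin n ] (free x (L , R) * # (2 ≤ᵇ H S x))
      bit-le : ∀ b {x y} → (b ≡ true → x ≤ y) → # b * x ≤ # b * y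
      bit-le true  k = *-monoʳ-≤ 1 (k refl)
      bit-le false k = z≤n
      own-le : # hit (R ʳ++ L) u * D ≤ moves (R ʳ++ L) u
      own-le = bit-le (hit (R ʳ++ L) u) (internal-exchange o p c nc)
      arc-le : ∀ {E O} → E ∈ rest → cyc E ≡ false → Oriented E O → # hit O u * D ≤ moves O u
      arc-le {E} {O} E∈ ncE d = bit-le (hit O u) λ e →
        external-exchange o (Perm.trans p (prep _ (proj₂ (∈⇒↭ E∈)))) d c nc ncE
          (not-single mn ns (∈-resp-↭ (↭-sym p) (there E∈))) e
      ext-le : pN u * D ≤ reward u
      ext-le = begin
        pN u * D
          ≡⟨ ∑-*ʳ rest D (λ E → # not (cyc E) * h₂ E u) ⟨
        ∑[ E ∈ rest ] (# not (cyc E) * h₂ E u * D)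
          ≤⟨ ∑-mono-∈ rest per-arc ⟩
        reward u ∎
        where
        per-arc : ∀ {E} → E ∈ rest → # not (cyc E) * h₂ E u * D ≤ # not (cyc E) * moves₂ E u
        per-arc {E} E∈ with cyc E in ncE
        ... | true  = z≤n
        ... | false = begin
          (h₂ E u + 0) * D
            ≡⟨ cong (_* D) (+-identityʳ (h₂ E u)) ⟩
          (# hit E u + # hit (reverse E) u) * D
            ≡⟨ *-distribʳ-+ D (# hit E u) _ ⟩
          # hit E u * D + # hit (reverse E) u * D
            ≤⟨ +-mono-≤ (arc-le E∈ ncE (fwd refl)) (arc-le E∈ ncE (bwd refl)) ⟩
          moves₂ E u
            ≡⟨ +-identityʳ _ ⟨
          moves₂ E u + 0 ∎
      -- Since `u` is hit by an end that can be exchanged, `w` can be made an end, and then it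
      -- cannot see `Q`. Hence the heavily hit neighbours of `w` lie on components that pay.
      off-cycles : ∀ {x Q} → hit R x ≡ true → Q ∈ S → 1 ≤ occ x Q → cyc Q ≡ true → ⊥
      off-cycles {x} {Q} Rx Q∈ x∈ cQ with ∈-resp-↭ p Q∈
      ... | here refl = true≢false cQ nc
      ... | there Q∈rest with hit (R ʳ++ L) u in bu
      ...   | true = internal-cyclic mn (Perm.trans p (prep _ (proj₂ (∈⇒↭ Q∈rest)))) c bu cQ x∈
                       (adj-sound (proj₁ (∧-true Rx)))
      ...   | false with E , O , E∈ , d , e , ncE ← hN-hit rest u
                      (≤-trans (s≤s z≤n) (≤-reflexive (trans (sym Ω-eq) (+-identityʳ (pN u)))))
        with rest′ , q ← ∈⇒↭ E∈ with ∈-resp-↭ q Q∈rest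
      ...     | here refl  = true≢false cQ ncE
      ...     | there Q∈′ =
        external-cyclic mn (Perm.trans p (prep _ (Perm.trans q (prep _ (proj₂ (∈⇒↭ Q∈′)))))) d c e cQ x∈
          (adj-sound (proj₁ (∧-true Rx)))
      T-le : ∀ x → free x (L , R) * # (2 ≤ᵇ H S x) ≤ free x (L , R) * weight x
      T-le x = bit-le (hit R x ∧ not (u == x)) λ e → case inN-or x of λ where
        (inj₁ le) → ≤-trans (≤-reflexive (sym (*-identityʳ _))) (*-monoʳ-≤ (# (2 ≤ᵇ H S x)) le)
        (inj₂ (Q , Q∈ , x∈ , cQ)) → ⊥-elim (off-cycles (proj₁ (∧-true e)) Q∈ x∈ cQ)

    gains-≤ : ∑ (cuts P) (PathBound.γ τ) ≤
              ∑ (cuts P) (λ c → 3 * targets c + 3 * targets (flip c)) +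
              2 * ∑[ v ∈ P ] ∑[ D ∈ S ] (# not (cyc D) * moves₂ D v)
    gains-≤ = begin
      ∑ (cuts P) (PathBound.γ τ)
        ≤⟨ ∑-mono-∈ (cuts P) per-cut ⟩
      ∑ (cuts P) (λ c → (3 * targets c + 3 * targets (flip c)) + (headˡ Mʳ c + headʳ Mˡ c))
        ≡⟨ trans (∑-+ (cuts P) _ _) (cong (∑ (cuts P) (λ c → 3 * targets c + 3 * targets (flip c)) +_)
             (∑-+ (cuts P) (headˡ Mʳ) (headʳ Mˡ))) ⟩
      ∑ (cuts P) (λ c → 3 * targets c + 3 * targets (flip c)) + (∑ (cuts P) (headˡ Mʳ) + ∑ (cuts P) (headʳ Mˡ))
        ≤⟨ +-monoʳ-≤ (∑ (cuts P) (λ c → 3 * targets c + 3 * targets (flip c))) (+-mono-≤ (∑-cuts-headˡ-≤ Mʳ P) (∑-cuts-headʳ-≤ Mˡ P)) ⟩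
      ∑ (cuts P) (λ c → 3 * targets c + 3 * targets (flip c)) + (∑ P Mʳ + ∑ P Mˡ)
        ≡⟨ cong (∑ (cuts P) (λ c → 3 * targets c + 3 * targets (flip c)) +_)
             (trans (sym (∑-+ P Mʳ Mˡ)) (trans (∑-cong P both-sides) (∑-* P 2 _))) ⟩
      ∑ (cuts P) (λ c → 3 * targets c + 3 * targets (flip c)) +
        2 * ∑[ v ∈ P ] ∑[ D ∈ S ] (# not (cyc D) * moves₂ D v) ∎
      where
      open ≤-Reasoning
      Mʳ Mˡ : V → ℕ
      Mʳ u = reward u + 2 * moves (reverse P) u
      Mˡ w = reward w + 2 * moves P w
      -- An end of another component is used once on either side of `v`, an end of `P` twice on one
      -- side, so all ends come out with the factor 2.
      both-sides : ∀ v → Mʳ v + Mˡ v ≡ 2 * ∑[ D ∈ S ] (# not (cyc D) * moves₂ D v)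
      both-sides v = trans (shuffle (reward v) (moves P v) (moves (reverse P) v))
        (cong (2 *_) (sym (trans (∑-↭ p (λ D → # not (cyc D) * moves₂ D v))
          (cong (λ b → # not b * moves₂ P v + reward v) nc))))
        where
        shuffle : ∀ r a b → (r + 2 * b) + (r + 2 * a) ≡ 2 * ((a + b + 0) + r)
        shuffle = solve-∀
      bit-drop : ∀ b m → # b * m ≤ m
      bit-drop true  m = ≤-reflexive (*-identityˡ m)
      bit-drop false m = z≤n
      per-cut : ∀ {c} → c ∈ cuts P →
        PathBound.γ τ c ≤ (3 * targets c + 3 * targets (flip c)) + (headˡ Mʳ c + headʳ Mˡ c)
      per-cut {[] , _} c∈ = z≤n
      per-cut {(_ ∷ _) , []} c∈ = z≤n
      per-cut {(u ∷ l) , (w ∷ r)} c∈ = begin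
        # more (w ∷ r) * edgeGainʳ (τ u) (τ w) + # more (u ∷ l) * edgeGainˡ (τ u) (τ w)
          ≤⟨ +-mono-≤ (*-monoʳ-≤ (# more (w ∷ r)) (bit-drop (hits (τ w) ≡ᵇ 0) (gainʳ (τ u))))
                      (*-monoʳ-≤ (# more (u ∷ l)) (bit-drop (hits (τ u) ≡ᵇ 0) (gainˡ (τ w)))) ⟩
        # more (w ∷ r) * gainʳ (τ u) + # more (u ∷ l) * gainˡ (τ w)
          ≤⟨ +-mono-≤
               (subst (λ Z → # more (w ∷ r) * (12 ⊓ (4 * (pN u + 2 * # hit Z u)))
                             ≤ 3 * targets (u ∷ l , w ∷ r) + (reward u + 2 * moves Z u))
                 (sym rev-eq) (side u l w r (fwd eq)))
               (subst (λ Z → # more (u ∷ l) * (12 ⊓ (4 * (pN w + 2 * # hit Z w)))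
                             ≤ 3 * targets (w ∷ r , u ∷ l) + (reward w + 2 * moves Z w))
                 (sym eq) (side w r u l (bwd eq))) ⟩
        3 * targets (u ∷ l , w ∷ r) + Mʳ u + (3 * targets (w ∷ r , u ∷ l) + Mˡ w)
          ≡⟨ +-interchange (3 * targets (u ∷ l , w ∷ r)) (Mʳ u) _ _ ⟩
        (3 * targets (u ∷ l , w ∷ r) + 3 * targets (w ∷ r , u ∷ l)) + (Mʳ u + Mˡ w) ∎
        where
        eq : P ≡ (u ∷ l) ʳ++ (w ∷ r)
        eq = cuts-∈ c∈
        rev-eq : reverse P ≡ (w ∷ r) ʳ++ (u ∷ l)
        rev-eq = trans (cong reverse eq) (reverse-ʳ++ (u ∷ l) (w ∷ r))

    -- Every inner vertex is the candidate end at the cuts on both of its sides; its 3 from each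
    -- make the 6 paid along an edge.
    targets-sum : ∑ (cuts P) (λ c → 3 * targets c + 3 * targets (flip c))
                  ≡ 6 * ∑[ x ∈ allFin n ] (∑ (cuts P) (free x) * weight x)
    targets-sum = begin
      ∑ (cuts P) (λ c → 3 * targets c + 3 * targets (flip c))
        ≡⟨ ∑-+ (cuts P) (λ c → 3 * targets c) (λ c → 3 * targets (flip c)) ⟩
      ∑ (cuts P) (λ c → 3 * targets c) + ∑ (cuts P) (λ c → 3 * targets (flip c))
        ≡⟨ cong₂ _+_ (trans (∑-* (cuts P) 3 targets) (cong (3 *_) (total (λ c → c))))
                     (trans (∑-* (cuts P) 3 (targets ∘ flip)) (cong (3 *_) (trans (total flip)
                       (∑-cong (allFin n) λ x → cong (_* weight x) (free-flip x P))))) ⟩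
      3 * W + 3 * W
        ≡⟨ *-distribʳ-+ W 3 3 ⟨
      6 * W ∎
      where
      open ≡-Reasoning
      W : ℕ
      W = ∑[ x ∈ allFin n ] (∑ (cuts P) (free x) * weight x)
      total : (f : Path × Path → Path × Path) →
              ∑ (cuts P) (targets ∘ f) ≡ ∑[ x ∈ allFin n ] (∑ (cuts P) (free x ∘ f) * weight x)
      total f = trans (∑-comm (cuts P) (allFin n) (λ c x → free x (f c) * weight x))
        (∑-cong (allFin n) λ x → ∑-*ʳ (cuts P) (weight x) (free x ∘ f))

    balance : ∑[ v ∈ P ] costOf (hN S v) (hC S v) + 12 ≤ 36 * length P +
              (6 * ∑[ x ∈ allFin n ] (∑ (cuts P) (free x) * weight x) +
               2 * ∑[ v ∈ P ] ∑[ D ∈ S ] (# not (cyc D) * moves₂ D v))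
    balance = begin
      ∑[ v ∈ P ] costOf (hN S v) (hC S v) + 12
        ≡⟨ cong (_+ 12) (∑-cong P λ v → cong₂ costOf (hN-τ v) (hC-τ v)) ⟩
      ∑[ v ∈ P ] cost (τ v) + 12
        ≤⟨ component-bound ⟩
      36 * length P + ∑ (cuts P) (PathBound.γ τ)
        ≤⟨ +-monoʳ-≤ (36 * length P) gains-≤ ⟩
      36 * length P + (∑ (cuts P) (λ c → 3 * targets c + 3 * targets (flip c)) +
        2 * ∑[ v ∈ P ] ∑[ D ∈ S ] (# not (cyc D) * moves₂ D v))
        ≡⟨ cong (λ z → 36 * length P + (z + 2 * ∑[ v ∈ P ] ∑[ D ∈ S ] (# not (cyc D) * moves₂ D v))) targets-sum ⟩
      _ ∎
      where open ≤-Reasoning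

-- Double counting

module Count {n : ℕ} (G : Graph n) (reg : ∀ v → ∑[ w ∈ allFin n ] # Paths.adj G v w ≡ 6)
             {S : List (List (Fin n))} (o : Paths.Opt G S) (ns : Paths.singles G S ≡ 0) where
  open Paths G
  open Merges G
  open Exchange G
  open Moves G
  open Covers G
  open Degrees G reg
  open Local G reg
  open Gains G reg o ns

  private
    mn : Min S
    mn = opt⇒min o
    cv : Cover S
    cv = Opt.cover o

    N C : Path → ℕ
    N P = # not (cyc P)
    C P = # cyc P

    low high h κ : V → ℕ
    low  x = # (hN S x + hC S x ≤ᵇ 2) * (8 * hN S x)
    high x = # (2 ≤ᵇ hN S x + hC S x) * (6 * (4 ∸ (hN S x + hC S x)))
    h = hN S
    κ = hC S

  good-∈ : ∀ {P} → P ∈ S → Good P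
  good-∈ P∈ = good-of mn (proj₂ (∈⇒↭ P∈))

  ∑-inN : ∀ f → ∑[ P ∈ S ] (N P * ∑ P f) ≡ ∑[ x ∈ allFin n ] (inN x * f x)
  ∑-inN f = begin
    ∑[ P ∈ S ] (N P * ∑ P f)
      ≡⟨ ∑-cong S (λ P → trans (cong (N P *_) (∑-occ P f)) (sym (∑-* (allFin n) (N P) _))) ⟩
    ∑[ P ∈ S ] ∑[ x ∈ allFin n ] (N P * (occ x P * f x))
      ≡⟨ ∑-comm S (allFin n) (λ P x → N P * (occ x P * f x)) ⟩
    ∑[ x ∈ allFin n ] ∑[ P ∈ S ] (N P * (occ x P * f x))
      ≡⟨ ∑-cong (allFin n) (λ x → trans (∑-cong S λ P → sym (*-assoc (N P) (occ x P) (f x)))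
                                        (∑-*ʳ S (f x) (λ P → N P * occ x P))) ⟩
    ∑[ x ∈ allFin n ] (inN x * f x) ∎
    where open ≡-Reasoning

  -- Otherwise `x` is on a cyclic component different from `D`, against `cyclic-apart`.
  seen-inN : ∀ {D e O x} → D ∈ S → Oriented D (e ∷ O) → Adj G e x →
             (∀ {Q} → Q ∈ S → 1 ≤ occ x Q → cyc Q ≡ true → Q ≢ D) → 1 ≤ inN x
  seen-inN {D} {x = x} D∈ d ex other with inN-or x
  ... | inj₁ le = le
  ... | inj₂ (Q , Q∈ , x∈ , cQ) with rest , p ← ∈⇒↭ D∈ with ∈-resp-↭ p Q∈
  ...   | here eq  = ⊥-elim (other Q∈ x∈ cQ eq)
  ...   | there Q∈′ = ⊥-elim (cyclic-apart mn (Perm.trans p (prep _ (proj₂ (∈⇒↭ Q∈′)))) d cQ x∈ ex)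

  h-inN : ∀ x → 1 ≤ h x → 1 ≤ inN x
  h-inN x le with D , O , D∈ , d , e , nc ← hN-hit S x le
    with z , t , refl , zx ← hit-inv O e =
    seen-inN D∈ d zx λ { _ _ cQ refl → true≢false cQ nc }

  h≤inN*h : ∀ x → h x ≤ inN x * h x
  h≤inN*h x with h x | h-inN x
  ... | zero  | _ = z≤n
  ... | suc k | f = m≤n*m (suc k) (inN x) ⦃ >-nonZero (f (s≤s z≤n)) ⦄

  ∑-hits : ∀ {D O} → D ∈ S → Oriented D O → ∑[ v ∈ allFin n ] # hit O v ≡ 5
  ∑-hits {O = O} D∈ d with or-good d (good-∈ D∈) | or-single d
  ... | good {e} {[]} l | eq = ⊥-elim (true≢false (sym eq) (not-single mn ns D∈))
  ... | good {e} {e′ ∷ t} l | _ = hits-5 (good l)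

  ∑-h₂ : ∀ {D} → D ∈ S → ∑[ v ∈ allFin n ] h₂ D v ≡ 10
  ∑-h₂ {D} D∈ = trans (∑-+ (allFin n) (λ v → # hit D v) (λ v → # hit (reverse D) v))
                      (cong₂ _+_ (∑-hits D∈ (fwd refl)) (∑-hits D∈ (bwd refl)))

  lowBit : V → ℕ
  lowBit v = # (H S v ≤ᵇ 2)

  -- An end hits five vertices, so each of them is at stake in the exchanges at the four others.
  ∑-moves : ∀ {D O} → D ∈ S → Oriented D O →
            ∑[ u ∈ allFin n ] moves O u ≡ 4 * ∑[ v ∈ allFin n ] (# hit O v * lowBit v)
  ∑-moves {D} {O} D∈ d = begin
    ∑[ u ∈ allFin n ] (# hit O u * loss S O u)
      ≡⟨ ∑-cong (allFin n) (λ u → sym (∑-* (allFin n) (# hit O u) _)) ⟩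
    ∑[ u ∈ allFin n ] ∑[ v ∈ allFin n ] (# hit O u * # (hit O v ∧ (not (u == v) ∧ (H S v ≤ᵇ 2))))
      ≡⟨ ∑-comm (allFin n) (allFin n) (λ u v → # hit O u * # (hit O v ∧ (not (u == v) ∧ (H S v ≤ᵇ 2)))) ⟩
    ∑[ v ∈ allFin n ] ∑[ u ∈ allFin n ] (# hit O u * # (hit O v ∧ (not (u == v) ∧ (H S v ≤ᵇ 2))))
      ≡⟨ ∑-cong (allFin n) (λ v → trans
           (∑-cong (allFin n) λ u → trans
             (bits (hit O u) (hit O v) (u == v) (H S v ≤ᵇ 2))
             (cong (λ b → (# hit O v * lowBit v) * # (hit O u ∧ not b)) (==-sym u v)))
           (∑-* (allFin n) (# hit O v * lowBit v) (λ u → # (hit O u ∧ not (v == u))))) ⟩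
    ∑[ v ∈ allFin n ] ((# hit O v * lowBit v) * ∑[ u ∈ allFin n ] # (hit O u ∧ not (v == u)))
      ≡⟨ ∑-cong (allFin n) (λ v → four (hit O v) (lowBit v) _ (trans (∑-remove (hit O) v) (∑-hits D∈ d))) ⟩
    ∑[ v ∈ allFin n ] (4 * (# hit O v * lowBit v))
      ≡⟨ ∑-* (allFin n) 4 _ ⟩
    4 * ∑[ v ∈ allFin n ] (# hit O v * lowBit v) ∎
    where
    open ≡-Reasoning
    bits : ∀ a b e l → # a * # (b ∧ (not e ∧ l)) ≡ (# b * # l) * # (a ∧ not e)
    bits true  true  true  true  = refl
    bits true  true  true  false = refl
    bits true  true  false true  = refl
    bits true  true  false false = refl
    bits true  false e     l     = refl
    bits false b     e     l     = sym (*-zeroʳ (# b * # l))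
    four : ∀ b l X → X + # b ≡ 5 → (# b * l) * X ≡ 4 * (# b * l)
    four true  l X e with refl ← +-cancelʳ-≡ 1 X 4 e = *-comm (l + 0) 4
    four false l X e = refl

  -- By `hit-capacity`, a vertex of a non-cyclic component with `H` hits, at least two, has at most
  -- `4 - H` free edges to pay for.
  high-part : 6 * ∑[ P ∈ S ] ∑[ x ∈ allFin n ] (∑ (cuts P) (free x) * weight x)
              ≤ ∑[ x ∈ allFin n ] (inN x * high x)
  high-part = begin
    6 * ∑[ P ∈ S ] ∑[ x ∈ allFin n ] (∑ (cuts P) (free x) * weight x)
      ≡⟨ cong (6 *_) (trans (∑-comm S (allFin n) (λ P x → ∑ (cuts P) (free x) * weight x))
           (∑-cong (allFin n) λ x → ∑-*ʳ S (weight x) (λ P → ∑ (cuts P) (free x)))) ⟩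
    6 * ∑[ x ∈ allFin n ] (F x * weight x)
      ≡⟨ ∑-* (allFin n) 6 _ ⟨
    ∑[ x ∈ allFin n ] (6 * (F x * weight x))
      ≤⟨ ∑-mono (allFin n) pointwise ⟩
    ∑[ x ∈ allFin n ] (inN x * high x) ∎
    where
    open ≤-Reasoning
    F : V → ℕ
    F x = ∑[ P ∈ S ] ∑ (cuts P) (free x)
    F-≤ : ∀ x → 1 ≤ inN x → 2 ≤ H S x → F x ≤ 4 ∸ H S x
    F-≤ x le 2≤H with P , P∈ , le′ ← ∑-find S (λ Q → # not (cyc Q) * occ x Q) le
      with nc , x∈ ← *-≤1 (not (cyc P)) (occ x P) le′ =
      ≤-trans (≤-reflexive (sym (m+n∸m≡n (H S x) (F x))))
        (∸-monoˡ-≤ (H S x) (Component.hit-capacity o ns (proj₂ (∈⇒↭ P∈)) (not-true nc) x∈ (≤-trans (s≤s z≤n) 2≤H)))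
    shuffle : ∀ i f → 6 * (f * (1 * i)) ≡ i * (1 * (6 * f))
    shuffle = solve-∀
    bound : ∀ b i f k → (1 ≤ i → b ≡ true → f ≤ k) → 6 * (f * (# b * i)) ≤ i * (# b * (6 * k))
    bound false i       f k c = ≤-trans (≤-reflexive (cong (6 *_) (*-zeroʳ f))) z≤n
    bound true  zero    f k c = ≤-trans (≤-reflexive (cong (6 *_) (*-zeroʳ f))) z≤n
    bound true  (suc i) f k c = ≤-trans (≤-reflexive (shuffle (suc i) f))
      (*-monoʳ-≤ (suc i) (*-monoʳ-≤ 1 (*-monoʳ-≤ 6 (c (s≤s z≤n) refl))))
    pointwise : ∀ x → 6 * (F x * weight x) ≤ inN x * high x
    pointwise x = ≤-trans (bound (2 ≤ᵇ H S x) (inN x) (F x) (4 ∸ H S x) λ le e → F-≤ x le (≤ᵇ-sound 2 (H S x) e))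
      (≤-reflexive (cong (λ z → inN x * (# (2 ≤ᵇ z) * (6 * (4 ∸ z)))) (H≡hN+hC S x)))

  -- The 8 in `costOf` is 2 for each of the four exchanges in `∑-moves`.
  low-part : 2 * ∑[ P ∈ S ] ∑[ v ∈ P ] ∑[ D ∈ S ] (# not (cyc D) * moves₂ D v)
             ≤ ∑[ x ∈ allFin n ] (inN x * low x)
  low-part = begin
    2 * ∑[ P ∈ S ] ∑[ v ∈ P ] ∑[ D ∈ S ] (N D * moves₂ D v)
      ≡⟨ cong (2 *_) (trans (∑-vertices cv (λ v → ∑[ D ∈ S ] (N D * moves₂ D v)))
           (trans (∑-comm (allFin n) S (λ v D → N D * moves₂ D v))
             (∑-cong-∈ S λ {D} D∈ → trans (∑-* (allFin n) (N D) (moves₂ D)) (cong (N D *_) (arcs D∈))))) ⟩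
    2 * ∑[ D ∈ S ] (N D * ∑[ v ∈ allFin n ] (4 * (h₂ D v * lowBit v)))
      ≡⟨ cong (2 *_) (trans (∑-cong S λ D → sym (∑-* (allFin n) (N D) _))
           (trans (∑-comm S (allFin n) (λ D v → N D * (4 * (h₂ D v * lowBit v))))
             (∑-cong (allFin n) λ v → trans (∑-cong S λ D → shuffle (N D) (h₂ D v) (lowBit v))
               (∑-*ʳ S (4 * lowBit v) (λ D → N D * h₂ D v))))) ⟩
    2 * ∑[ v ∈ allFin n ] (h v * (4 * lowBit v))
      ≡⟨ ∑-* (allFin n) 2 _ ⟨
    ∑[ v ∈ allFin n ] (2 * (h v * (4 * lowBit v)))
      ≤⟨ ∑-mono (allFin n) pointwise ⟩
    ∑[ x ∈ allFin n ] (inN x * low x) ∎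
    where
    open ≤-Reasoning
    shuffle : ∀ c g l → c * (4 * (g * l)) ≡ c * g * (4 * l)
    shuffle = solve-∀
    shuffle′ : ∀ g l → 2 * (g * (4 * l)) ≡ l * (8 * g)
    shuffle′ = solve-∀
    shuffle″ : ∀ i g l → l * (8 * (i * g)) ≡ i * (l * (8 * g))
    shuffle″ = solve-∀
    arcs : ∀ {D} → D ∈ S → ∑[ v ∈ allFin n ] moves₂ D v ≡ ∑[ v ∈ allFin n ] (4 * (h₂ D v * lowBit v))
    arcs {D} D∈ = trans (∑-+ (allFin n) (moves D) (moves (reverse D)))
      (trans (cong₂ _+_ (∑-moves D∈ (fwd refl)) (∑-moves D∈ (bwd refl)))
      (trans (sym (*-distribˡ-+ 4 (∑[ v ∈ allFin n ] (# hit D v * lowBit v)) _))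
      (trans (cong (4 *_) (trans (sym (∑-+ (allFin n) (λ v → # hit D v * lowBit v) (λ v → # hit (reverse D) v * lowBit v)))
        (∑-cong (allFin n) λ v → sym (*-distribʳ-+ (lowBit v) (# hit D v) (# hit (reverse D) v)))))
        (sym (∑-* (allFin n) 4 (λ v → h₂ D v * lowBit v))))))
    pointwise : ∀ v → 2 * (h v * (4 * lowBit v)) ≤ inN v * low v
    pointwise v = begin
      2 * (h v * (4 * lowBit v))           ≡⟨ shuffle′ (h v) (lowBit v) ⟩
      lowBit v * (8 * h v)                 ≤⟨ *-monoʳ-≤ (lowBit v) (*-monoʳ-≤ 8 (h≤inN*h v)) ⟩
      lowBit v * (8 * (inN v * h v))       ≡⟨ shuffle″ (inN v) (h v) (lowBit v) ⟩
      inN v * (lowBit v * (8 * h v))       ≡⟨ cong (λ z → inN v * (# (z ≤ᵇ 2) * (8 * h v))) (H≡hN+hC S v) ⟩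
      inN v * low v                        ∎

  -- Over all components together, what the vertices pay towards gains covers the gains that are
  -- received. The two cancel, and only the payments to ends remain.
  noncyclic-balance : ∑[ x ∈ allFin n ] (inN x * (24 * h x + 18 * κ x)) + 12 * ∑ S N
                      ≤ ∑[ P ∈ S ] (N P * (36 * length P))
  noncyclic-balance = +-cancelʳ-≤ (Hi + Lo) _ _ (begin
    ∑[ x ∈ allFin n ] (inN x * (24 * h x + 18 * κ x)) + 12 * ∑ S N + (Hi + Lo)
      ≡⟨ shuffle (∑[ x ∈ allFin n ] (inN x * (24 * h x + 18 * κ x))) (12 * ∑ S N) (Hi + Lo) ⟩
    ∑[ x ∈ allFin n ] (inN x * (24 * h x + 18 * κ x)) + (Hi + Lo) + 12 * ∑ S N
      ≡⟨ cong (_+ 12 * ∑ S N) costs ⟨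
    ∑[ x ∈ allFin n ] (inN x * costOf (h x) (κ x)) + 12 * ∑ S N
      ≡⟨ cong (_+ 12 * ∑ S N) (∑-inN (λ x → costOf (h x) (κ x))) ⟨
    ∑[ P ∈ S ] (N P * ∑[ v ∈ P ] costOf (h v) (κ v)) + 12 * ∑ S N
      ≡⟨ cong (∑[ P ∈ S ] (N P * ∑[ v ∈ P ] costOf (h v) (κ v)) +_) (∑-* S 12 N) ⟨
    ∑[ P ∈ S ] (N P * ∑[ v ∈ P ] costOf (h v) (κ v)) + ∑[ P ∈ S ] (12 * N P)
      ≡⟨ ∑-+ S _ _ ⟨
    ∑[ P ∈ S ] (N P * ∑[ v ∈ P ] costOf (h v) (κ v) + 12 * N P)
      ≤⟨ ∑-mono-∈ S per-path ⟩
    ∑[ P ∈ S ] (N P * (36 * length P) + (6 * W P + 2 * M P))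
      ≡⟨ trans (∑-+ S _ _) (cong (∑[ P ∈ S ] (N P * (36 * length P)) +_)
           (trans (∑-+ S _ _) (cong₂ _+_ (∑-* S 6 W) (∑-* S 2 M)))) ⟩
    ∑[ P ∈ S ] (N P * (36 * length P)) + (6 * ∑ S W + 2 * ∑ S M)
      ≤⟨ +-monoʳ-≤ (∑[ P ∈ S ] (N P * (36 * length P))) (+-mono-≤ high-part low-part) ⟩
    ∑[ P ∈ S ] (N P * (36 * length P)) + (Hi + Lo) ∎)
    where
    open ≤-Reasoning
    Hi Lo : ℕ
    Hi = ∑[ x ∈ allFin n ] (inN x * high x)
    Lo = ∑[ x ∈ allFin n ] (inN x * low x)
    W M : Path → ℕ
    W P = ∑[ x ∈ allFin n ] (∑ (cuts P) (free x) * weight x)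
    M P = ∑[ v ∈ P ] ∑[ D ∈ S ] (# not (cyc D) * moves₂ D v)
    shuffle : ∀ a b c → a + b + c ≡ a + c + b
    shuffle = solve-∀
    costs : ∑[ x ∈ allFin n ] (inN x * costOf (h x) (κ x))
            ≡ ∑[ x ∈ allFin n ] (inN x * (24 * h x + 18 * κ x)) + (Hi + Lo)
    costs = trans (∑-cong (allFin n) λ x → trans
        (*-distribˡ-+ (inN x) (24 * h x + 18 * κ x) (high x + low x))
        (cong (inN x * (24 * h x + 18 * κ x) +_) (*-distribˡ-+ (inN x) (high x) (low x))))
      (trans (∑-+ (allFin n) (λ x → inN x * (24 * h x + 18 * κ x)) (λ x → inN x * high x + inN x * low x))
        (cong (∑[ x ∈ allFin n ] (inN x * (24 * h x + 18 * κ x)) +_)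
          (∑-+ (allFin n) (λ x → inN x * high x) (λ x → inN x * low x))))
    per-path : ∀ {P} → P ∈ S → N P * ∑[ v ∈ P ] costOf (h v) (κ v) + 12 * N P
               ≤ N P * (36 * length P) + (6 * W P + 2 * M P)
    per-path {P} P∈ with cyc P in nc
    ... | true  = z≤n
    ... | false = subst₂ _≤_
      (cong (_+ 12) (sym (+-identityʳ _))) (cong (_+ (6 * W P + 2 * M P)) (sym (+-identityʳ (36 * length P))))
      (Side.balance (proj₂ (∈⇒↭ P∈)) nc)

  sent-by-noncyclic : ∑[ D ∈ S ] (N D * 10) ≤ ∑[ x ∈ allFin n ] (inN x * h x)
  sent-by-noncyclic = begin
    ∑[ D ∈ S ] (N D * 10)
      ≡⟨ ∑-cong-∈ S (λ {D} D∈ → trans (cong (N D *_) (sym (∑-h₂ D∈))) (sym (∑-* (allFin n) (N D) (h₂ D)))) ⟩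
    ∑[ D ∈ S ] ∑[ x ∈ allFin n ] (N D * h₂ D x)
      ≡⟨ ∑-comm S (allFin n) (λ D x → N D * h₂ D x) ⟩
    ∑[ x ∈ allFin n ] h x
      ≤⟨ ∑-mono (allFin n) h≤inN*h ⟩
    ∑[ x ∈ allFin n ] (inN x * h x) ∎
    where open ≤-Reasoning

  -- An end and its six neighbours are seven vertices. Those outside `D` are hits on non-cyclic
  -- components, the others are counted by `length D`.
  sent-by-cyclic : ∀ {D} → D ∈ S → 14 ≤ ∑[ x ∈ allFin n ] (inN x * h₂ D x) + 2 * length D
  sent-by-cyclic {D} D∈ = begin
    14
      ≤⟨ +-mono-≤ (arc (fwd refl)) (arc (bwd refl)) ⟩
    (∑[ x ∈ allFin n ] (inN x * # hit D x) + length D) + (∑[ x ∈ allFin n ] (inN x * # hit (reverse D) x) + length D)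
      ≡⟨ shuffle (∑[ x ∈ allFin n ] (inN x * # hit D x)) (length D) _ ⟩
    (∑[ x ∈ allFin n ] (inN x * # hit D x) + ∑[ x ∈ allFin n ] (inN x * # hit (reverse D) x)) + 2 * length D
      ≡⟨ cong (_+ 2 * length D) (trans (sym (∑-+ (allFin n) _ _))
           (∑-cong (allFin n) λ x → sym (*-distribˡ-+ (inN x) (# hit D x) _))) ⟩
    ∑[ x ∈ allFin n ] (inN x * h₂ D x) + 2 * length D ∎
    where
    open ≤-Reasoning
    shuffle : ∀ a l b → (a + l) + (b + l) ≡ (a + b) + 2 * l
    shuffle = solve-∀
    arc : ∀ {O} → Oriented D O → 7 ≤ ∑[ x ∈ allFin n ] (inN x * # hit O x) + length D
    arc {O} d with or-good d (good-∈ D∈) | or-single d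
    ... | good {e} {[]} l | eq = ⊥-elim (true≢false (sym eq) (not-single mn ns D∈))
    ... | good {e} {e′ ∷ t} l | _ = begin
      6 + 1
        ≡⟨ cong₂ _+_ (sym (reg e)) (sym (trans (∑-cong (allFin n) λ x → sym (*-identityʳ (# (e == x)))) (∑-δ e (λ _ → 1)))) ⟩
      ∑[ x ∈ allFin n ] # adj e x + ∑[ x ∈ allFin n ] # (e == x)
        ≡⟨ ∑-+ (allFin n) _ _ ⟨
      ∑[ x ∈ allFin n ] (# adj e x + # (e == x))
        ≤⟨ ∑-mono (allFin n) pointwise ⟩
      ∑[ x ∈ allFin n ] (inN x * # hit (e ∷ e′ ∷ t) x + occ x D)
        ≡⟨ ∑-+ (allFin n) _ _ ⟩
      ∑[ x ∈ allFin n ] (inN x * # hit (e ∷ e′ ∷ t) x) + ∑[ x ∈ allFin n ] occ x D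
        ≡⟨ cong (∑[ x ∈ allFin n ] (inN x * # hit (e ∷ e′ ∷ t) x) +_)
             (trans (∑-cong (allFin n) λ x → sym (*-identityʳ (occ x D)))
               (trans (sym (∑-occ D (λ _ → 1))) (sym (length-as-∑ D)))) ⟩
      ∑[ x ∈ allFin n ] (inN x * # hit (e ∷ e′ ∷ t) x) + length D ∎
      where
      occ-O : ∀ x → occ x (e ∷ e′ ∷ t) ≡ occ x D
      occ-O x = or-∑ d _
      pointwise : ∀ x → # adj e x + # (e == x) ≤ inN x * # hit (e ∷ e′ ∷ t) x + occ x D
      pointwise x with e == x in eq
      ... | true with refl ← ==-≡ {v = e} {x} eq rewrite adj-irrefl e =
        ≤-trans (≤-trans (occ-here e (e′ ∷ t)) (≤-reflexive (occ-O e))) (m≤n+m _ _)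
      ... | false with adj e x in ex
      ...   | false = z≤n
      ...   | true with occ x D in oD
      ...     | suc k = ≤-trans (s≤s z≤n) (m≤n+m (suc k) _)
      ...     | zero with e′ == x in eq′
      ...       | true with refl ← ==-≡ {v = e′} {x} eq′ =
        ⊥-elim (1+n≰n (≤-trans (occ-there e′ e (e′ ∷ t) (occ-here e′ t)) (≤-reflexive (trans (occ-O e′) oD))))
      ...       | false = ≤-trans (≤-trans (seen-inN D∈ d (adj-sound ex)
          λ { _ x∈ _ refl → <⇒≱ x∈ (≤-reflexive oD) }) (≤-reflexive (sym (*-identityʳ _)))) (m≤m+n _ 0)

  total-length : ∑[ P ∈ S ] length P ≡ n
  total-length = begin
    ∑[ P ∈ S ] length P
      ≡⟨ ∑-cong S length-as-∑ ⟩
    ∑[ P ∈ S ] ∑[ _ ∈ P ] 1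
      ≡⟨ ∑-vertices cv (λ _ → 1) ⟩
    ∑[ _ ∈ allFin n ] 1
      ≡⟨ trans (∑-const (allFin n) 1) (*-identityʳ _) ⟩
    length (allFin n)
      ≡⟨ length-tabulate id ⟩
    n ∎
    where open ≡-Reasoning

  few-components : 7 * length S ≤ n
  few-components = *-cancelˡ-≤ 36 (begin
    36 * (7 * length S)
      ≡⟨ trans (sym (*-assoc 36 7 (length S))) (trans (*-comm 252 (length S)) (sym (∑-const S 252))) ⟩
    ∑[ _ ∈ S ] 252
      ≤⟨ ∑-mono-∈ S demand ⟩
    ∑[ D ∈ S ] (24 * (N D * 10) + 12 * N D + (C D * (36 * length D) + 18 * (C D * out D)))
      ≡⟨ trans (∑-+ S _ _) (cong₂ _+_
           (trans (∑-+ S _ _) (cong₂ _+_ (∑-* S 24 _) (∑-* S 12 N)))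
           (trans (∑-+ S _ _) (cong (∑[ D ∈ S ] (C D * (36 * length D)) +_) (∑-* S 18 _)))) ⟩
    24 * ∑[ D ∈ S ] (N D * 10) + 12 * ∑ S N + (∑[ D ∈ S ] (C D * (36 * length D)) + 18 * ∑[ D ∈ S ] (C D * out D))
      ≤⟨ +-monoˡ-≤ _ (+-monoˡ-≤ (12 * ∑ S N) (*-monoʳ-≤ 24 sent-by-noncyclic)) ⟩
    24 * X + 12 * ∑ S N + (∑[ D ∈ S ] (C D * (36 * length D)) + 18 * ∑[ D ∈ S ] (C D * out D))
      ≡⟨ cong (λ z → 24 * X + 12 * ∑ S N + (∑[ D ∈ S ] (C D * (36 * length D)) + 18 * z)) cyclic-hits ⟩
    24 * X + 12 * ∑ S N + (∑[ D ∈ S ] (C D * (36 * length D)) + 18 * Y)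
      ≡⟨ shuffle (24 * X) (12 * ∑ S N) (∑[ D ∈ S ] (C D * (36 * length D))) (18 * Y) ⟩
    24 * X + 18 * Y + 12 * ∑ S N + ∑[ D ∈ S ] (C D * (36 * length D))
      ≡⟨ cong (λ z → z + 12 * ∑ S N + ∑[ D ∈ S ] (C D * (36 * length D))) combine ⟩
    ∑[ x ∈ allFin n ] (inN x * (24 * h x + 18 * κ x)) + 12 * ∑ S N + ∑[ D ∈ S ] (C D * (36 * length D))
      ≤⟨ +-monoˡ-≤ (∑[ D ∈ S ] (C D * (36 * length D))) noncyclic-balance ⟩
    ∑[ P ∈ S ] (N P * (36 * length P)) + ∑[ D ∈ S ] (C D * (36 * length D))
      ≡⟨ trans (sym (∑-+ S _ _)) (trans (∑-cong S λ P → either (cyc P) (36 * length P)) (∑-* S 36 length)) ⟩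
    36 * ∑[ P ∈ S ] length P
      ≡⟨ cong (36 *_) total-length ⟩
    36 * n ∎)
    where
    open ≤-Reasoning
    X Y : ℕ
    X = ∑[ x ∈ allFin n ] (inN x * h x)
    Y = ∑[ x ∈ allFin n ] (inN x * κ x)
    out : Path → ℕ
    out D = ∑[ x ∈ allFin n ] (inN x * h₂ D x)
    either : ∀ b m → # not b * m + # b * m ≡ m
    either true  m = +-identityʳ m
    either false m = trans (+-identityʳ _) (+-identityʳ m)
    shuffle : ∀ a b c d → a + b + (c + d) ≡ a + d + b + c
    shuffle = solve-∀
    swap-* : ∀ a b c → a * (b * c) ≡ b * (a * c)
    swap-* = solve-∀
    dist : ∀ i a b → 24 * (i * a) + 18 * (i * b) ≡ i * (24 * a + 18 * b)
    dist = solve-∀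
    combine : 24 * X + 18 * Y ≡ ∑[ x ∈ allFin n ] (inN x * (24 * h x + 18 * κ x))
    combine = trans (cong₂ _+_ (sym (∑-* (allFin n) 24 _)) (sym (∑-* (allFin n) 18 _)))
      (trans (sym (∑-+ (allFin n) _ _)) (∑-cong (allFin n) λ x → dist (inN x) (h x) (κ x)))
    cyclic-hits : ∑[ D ∈ S ] (C D * out D) ≡ Y
    cyclic-hits = trans (∑-cong S λ D → sym (∑-* (allFin n) (C D) _))
      (trans (∑-comm S (allFin n) (λ D x → C D * (inN x * h₂ D x)))
        (∑-cong (allFin n) λ x → trans (∑-cong S λ D → swap-* (C D) (inN x) (h₂ D x))
          (∑-* S (inN x) (λ D → C D * h₂ D x))))
    -- A non-cyclic component gets 240 for ten hits and the slack of 12. A cyclic one gets 18 for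
    -- each hit outside and keeps the 36 of each of its vertices, which is 18 for each of the two
    -- ends.
    demand : ∀ {D} → D ∈ S → 252 ≤ 24 * (N D * 10) + 12 * N D + (C D * (36 * length D) + 18 * (C D * out D))
    demand {D} D∈ with cyc D
    ... | false = ≤-refl
    ... | true  = begin
      18 * 14
        ≤⟨ *-monoʳ-≤ 18 (sent-by-cyclic D∈) ⟩
      18 * (out D + 2 * length D)
        ≡⟨ expand (out D) (length D) ⟩
      1 * (36 * length D) + 18 * (1 * out D) ∎
      where
      expand : ∀ a l → 18 * (a + 2 * l) ≡ 1 * (36 * l) + 18 * (1 * a)
      expand = solve-∀

∑-concat : ∀ {A : Set} (xss : List (List A)) f → ∑ (concat xss) f ≡ ∑[ xs ∈ xss ] ∑ xs f
∑-concat []         f = refl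
∑-concat (xs ∷ xss) f = trans (∑-++ xs f) (cong (∑ xs f +_) (∑-concat xss f))

∸-cancelˡ-≤ : ∀ {k a b} → b ≤ k → k ∸ a ≤ k ∸ b → b ≤ a
∸-cancelˡ-≤ b≤k le = ≮⇒≥ λ a<b → <⇒≱ (∸-monoʳ-< a<b b≤k) le

-- Existence of an optimal partition

module Optimum {n : ℕ} (G : Graph n) where
  open Paths G
  open Moves G
  open Covers G

  occ⇒∈ : ∀ {v} (P : Path) → 1 ≤ occ v P → v ∈ P
  occ⇒∈ {v} (x ∷ P) le with x ≟ v
  ... | yes refl = here refl
  ... | no _     = there (occ⇒∈ P le)

  occ≤1⇒unique : ∀ (P : Path) → (∀ v → occ v P ≤ 1) → Unique P
  occ≤1⇒unique []      le = []
  occ≤1⇒unique (x ∷ P) le =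
    All.tabulate (λ { {y} y∈ refl → 1+n≰n (≤-trans (+-mono-≤ (≤-reflexive (cong #_ (sym (==-refl x)))) (∈⇒occ y∈)) (le x)) }) ∷
    occ≤1⇒unique P (λ v → ≤-trans (m≤n+m _ (# (x == v))) (le v))

  unique⇒occ≤1 : ∀ {P : Path} → Unique P → ∀ v → occ v P ≤ 1
  unique⇒occ≤1 []                  v = z≤n
  unique⇒occ≤1 {x ∷ P} (x∉ ∷ u) v with x ≟ v
  ... | no _ = unique⇒occ≤1 u v
  ... | yes refl with occ x P in eq
  ...   | zero  = ≤-refl
  ...   | suc k = ⊥-elim (All.lookup x∉ (occ⇒∈ P (≤-trans (s≤s z≤n) (≤-reflexive (sym eq)))) refl)

  partition⇒cover : ∀ {S} → IsPathPartition G S → Cover S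
  partition⇒cover {S} (mkIsPathPartition paths disjoint covers) = record
    { allGood = All.map toGood paths
    ; once    = λ v → ≤-antisym
        (≤-trans (≤-reflexive (sym (∑-concat S _)))
          (unique⇒occ≤1 (concat⁺ (All.map IsPath.distinct paths) disjoint) v))
        (at-least (covers v))
    }
    where
    toGood : ∀ {P} → IsPath G P → Good P
    toGood {[]}    q = ⊥-elim (IsPath.nonempty q refl)
    toGood {_ ∷ _} q = good (IsPath.linked q)
    at-least : ∀ {S v} → Any (v ∈_) S → 1 ≤ ∑[ P ∈ S ] occ v P
    at-least (here v∈)  = ≤-trans (∈⇒occ v∈) (m≤m+n _ _)
    at-least (there v∈) = ≤-trans (at-least v∈) (m≤n+m _ _)

  cover⇒partition : ∀ {S} → Cover S → IsPathPartition G S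
  cover⇒partition {S} c = mkIsPathPartition
    (All.tabulate (λ {P} P∈ → toPath (All.lookup (allGood c) P∈) (occ≤1⇒unique P (unique-in c P∈))))
    (apart S (λ v → ≤-reflexive (once c v)))
    (λ v → let P , P∈ , v∈ = component c v in Any.map (λ { refl → occ⇒∈ P v∈ }) P∈)
    where
    toPath : ∀ {P} → Good P → Unique P → IsPath G P
    toPath (good l) u = mkIsPath (λ ()) u l
    apart : ∀ (S : List Path) → (∀ v → ∑[ P ∈ S ] occ v P ≤ 1) → AllPairs Disjoint S
    apart []      le = []
    apart (P ∷ S) le =
      All.tabulate (λ {Q} Q∈ {v} (v∈P , v∈Q) → 1+n≰n (≤-trans
        (+-mono-≤ (∈⇒occ v∈P) (≤-trans (∈⇒occ v∈Q) (∑-∈-≤ (proj₂ (∈⇒↭ Q∈)) (occ v)))) (le v))) ∷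
      apart S (λ v → ≤-trans (m≤n+m _ (occ v P)) (le v))

  minimal : (Q : List Path → Set) → (∀ S → Dec (Q S)) → (∀ {S} → Q S → IsPathPartition G S) →
            (f : List Path → ℕ) → ∃[ S ] Q S → ∃[ S ] (Q S × (∀ {S′} → Q S′ → f S ≤ f S′))
  minimal Q Q? part f (S₀ , q₀) =
    argmin f S₀ cands ,
    argmin-all f q₀ (All.all-filter Q? (candidates n)) ,
    λ q → All.lookup (f[argmin]≤f[xs] S₀ cands)
            (∈-filter⁺ Q? (partition∈candidates (part q)) q)
    where
    cands : List (List Path)
    cands = filter Q? (candidates n)

  cycles≤length : ∀ S → cycles S ≤ length S
  cycles≤length S = ≤-trans (∑-mono S (λ P → #≤1 (cyc P))) (≤-reflexive (sym (length-as-∑ S)))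

  Φ≤2n : ∀ S → Φ S ≤ n * 2
  Φ≤2n S = ≤-trans (∑-mono (allFin n) (λ v → m⊓n≤n (H S v) 2))
    (≤-reflexive (trans (∑-const (allFin n) 2) (cong (_* 2) (length-tabulate {n = n} (id {A = V})))))

  optimum : ∃[ S ] Opt S
  optimum
    with S₁ , q₁ , min₁ ← minimal (IsPathPartition G) (isPathPartition? G) id length
           (singletons n , singletons-isPathPartition G)
    with S₂ , q₂ , min₂ ← minimal (λ S → IsPathPartition G S × length S ≤ length S₁)
           (λ S → isPathPartition? G S ×-dec (length S ≤? length S₁)) proj₁ singles (S₁ , q₁ , ≤-refl)
    with S₃ , q₃ , min₃ ← minimal (λ S → (IsPathPartition G S × length S ≤ length S₁) × singles S ≤ singles S₂)
           (λ S → (isPathPartition? G S ×-dec (length S ≤? length S₁)) ×-dec (singles S ≤? singles S₂))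
           -- Maximising is minimising the distance to an upper bound; a component closes at most
           -- one cycle, so `length S₁` is large enough for the subtraction to be exact. `Φ` is
           -- treated likewise with `n * 2`.
           (proj₁ ∘ proj₁) (λ S → length S₁ ∸ cycles S) (S₂ , q₂ , ≤-refl)
    with S₄ , (((q₄ , ln) , sg) , cy) , min₄ ←
           minimal (λ S → ((IsPathPartition G S × length S ≤ length S₁) × singles S ≤ singles S₂) × cycles S₃ ≤ cycles S)
           (λ S → ((isPathPartition? G S ×-dec (length S ≤? length S₁)) ×-dec (singles S ≤? singles S₂))
                  ×-dec (cycles S₃ ≤? cycles S))
           (proj₁ ∘ proj₁ ∘ proj₁) (λ S → n * 2 ∸ Φ S) (S₃ , q₃ , ≤-refl) =
    S₄ , record
      { cover      = partition⇒cover q₄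
      ; minLength  = λ c → ≤-trans ln (min₁ (cover⇒partition c))
      ; minSingles = λ c le → ≤-trans sg (min₂ (cover⇒partition c , ≤-trans le ln))
      ; maxCycles  = λ {S′} c le le′ → ≤-trans
          (∸-cancelˡ-≤ (≤-trans (cycles≤length S′) (≤-trans le ln))
            (min₃ ((cover⇒partition c , ≤-trans le ln) , ≤-trans le′ sg))) cy
      ; maxΦ       = λ {S′} c le le′ le″ → ∸-cancelˡ-≤ (Φ≤2n S′)
            (min₄ (((cover⇒partition c , ≤-trans le ln) , ≤-trans le′ sg) , ≤-trans cy le″))
      }

theorem1 : ∀ {n : ℕ} (G : Graph n) → Regular 6 G →
    (∃[ ps ] (IsPathPartition G ps × 7 * length ps ≤ n)) × 7 * πₚ G ≤ n
theorem1 {n} G regular = (S , partition , bound) ,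
  ≤-trans (*-monoʳ-≤ 7 (proj₂ (proj₂ (minimumPathPartition G)) S partition)) bound
  where
  open Paths G
  open Optimum G
  reg : ∀ v → ∑[ w ∈ allFin n ] # adj v w ≡ 6
  reg v = trans (sym (∑-filter (adj? G v) (allFin n))) (regular v)
  S : List Path
  S = proj₁ optimum
  opt : Opt S
  opt = proj₂ optimum
  partition : IsPathPartition G S
  partition = cover⇒partition (Opt.cover opt)
  bound : 7 * length S ≤ n
  bound = Count.few-components G reg opt (NoSingles.no-singles G reg
    (record { minimum = opt⇒min opt ; fewest = Opt.minSingles opt }))
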